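{- The field $\mathcal{O}_{RP}\subset\mathbb{C}$ of regular origami numbers contains $\zeta_n=e^{2\pi i/n}$ for every $n\in\mathbb{N}$, $n\ge1$.
   Context: Constructions. Identify $\mathbb{C}$ with the Euclidean plane. A construction starts with the points $0,1$ (given) and proceeds by finitely many steps; each step adds a new constructed line or point obtained from previously constructed ("given") ones by one of the axioms below. Folding along a line $f$ means applying the reflection across $f$; "folding $f$ places a point $p$ onto a line $\ell$" means that the reflection of $p$ across $f$ lies on $\ell$. Huzita-Justin axioms (HJAs): (O1) we can fold the line connecting two given distinct points; (O2) we can fold the perpendicular bisector of two given distinct points; (O3) we can fold the bisector of the angle defined by two given lines (either bisector, for intersecting lines); (O4) we can fold, through a given point, the perpendicular to a given line; (O5) we can fold a line passing through a given point that places another given point onto a given line; (O6) we can fold a line that places simultaneously two given points onto two given lines, respectively; (O7) we can fold a line perpendicular to a given line that places a given point onto another given line; (LI) the intersection point of two given non-parallel lines is constructible. In O5, O6, O7 the axiom is applied only to inputs for which there are finitely many lines with the required property, and any of these lines may be constructed. Regular Polygon Axioms (RPAs): for each $n\ge 3$, ($\mathrm{RPA}_n$) given the vertices $A_1,\dots,A_{n+1}$ (in counterclockwise order) of a regular $(n+1)$-gon, we can fold the line containing any side of the regular $n$-gon with vertices $B_1,\dots,B_n$ (in counterclockwise order) determined by $B_1=A_1$ and $B_2=A_2$. A number $\alpha\in\mathbb{C}$ is a regular origami number if there is a finite sequence of applications of the HJAs and the RPAs that starts with $\{0,1\}$ and ends in the point $\alpha$. $\mathcal{O}_{RP}$ denotes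 the set of all regular origami numbers. -}

module Defs where

open import Data.Fin using (Fin; zero; suc; toℕ)
open import Data.Integer using (+_)
import Data.Integer as ℤ
import Data.Integer.Properties as ℤP
open import Data.List using (List; []; _∷_)
open import Data.List.Membership.Propositional using () renaming (_∈_ to _∈ˡ_)
open import Data.List.Relation.Unary.Any using (Any)
open import Data.Nat as ℕ using (ℕ; zero; suc; _⊔_; NonZero; _!)
open import Data.Nat.DivMod using (_mod_)
import Data.Nat.Properties as ℕP
open import Data.Product using (∃; ∃₂; _×_; _,_; proj₁; proj₂)
open import Data.Rational as ℚ using (ℚ; 0ℚ; 1ℚ; ½; ∣_∣)
import Data.Rational.Properties as ℚP
open import Data.Rational.Solver using (module +-*-Solver)
import Data.Rational.Unnormalised as ℚᵘ
import Data.Rational.Unnormalised.Properties as ℚᵘP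
open import Level using (0ℓ)
open import Relation.Binary.PropositionalEquality
open import Relation.Nullary using (¬_)
open import Relation.Unary using (Pred)

2ℚ 3ℚ : ℚ
2ℚ = + 2 ℚ./ 1
3ℚ = + 3 ℚ./ 1

0≤1 : 0ℚ ℚ.≤ 1ℚ
0≤1 = ℚP.nonNegative⁻¹ 1ℚ

*-mono-≤ˡ : ∀ {a b} c → 0ℚ ℚ.≤ c → a ℚ.≤ b → c ℚ.* a ℚ.≤ c ℚ.* b
*-mono-≤ˡ c 0≤c = ℚP.*-monoˡ-≤-nonNeg c {{ℚ.nonNegative 0≤c}}

*-mono-≤ʳ : ∀ {a b} c → 0ℚ ℚ.≤ c → a ℚ.≤ b → a ℚ.* c ℚ.≤ b ℚ.* c
*-mono-≤ʳ c 0≤c = ℚP.*-monoʳ-≤-nonNeg c {{ℚ.nonNegative 0≤c}}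

*-nonNeg : ∀ {a b} → 0ℚ ℚ.≤ a → 0ℚ ℚ.≤ b → 0ℚ ℚ.≤ a ℚ.* b
*-nonNeg {a} {b} 0≤a 0≤b =
  ℚP.≤-trans (ℚP.≤-reflexive (sym (ℚP.*-zeroʳ a))) (*-mono-≤ˡ a 0≤a 0≤b)

+-nonNeg : ∀ {a b} → 0ℚ ℚ.≤ a → 0ℚ ℚ.≤ b → 0ℚ ℚ.≤ a ℚ.+ b
+-nonNeg 0≤a 0≤b = ℚP.≤-trans (ℚP.≤-reflexive (sym (ℚP.+-identityˡ 0ℚ))) (ℚP.+-mono-≤ 0≤a 0≤b)

∣-∣-mono-* : ∀ {A B} a b → ∣ a ∣ ℚ.≤ A → ∣ b ∣ ℚ.≤ B → ∣ a ℚ.* b ∣ ℚ.≤ A ℚ.* B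
∣-∣-mono-* {A} {B} a b a≤A b≤B = begin
  ∣ a ℚ.* b ∣      ≡⟨ ℚP.∣p*q∣≡∣p∣*∣q∣ a b ⟩
  ∣ a ∣ ℚ.* ∣ b ∣  ≤⟨ *-mono-≤ʳ ∣ b ∣ (ℚP.0≤∣p∣ b) a≤A ⟩
  A ℚ.* ∣ b ∣      ≤⟨ *-mono-≤ˡ A (ℚP.≤-trans (ℚP.0≤∣p∣ a) a≤A) b≤B ⟩
  A ℚ.* B          ∎
  where open ℚP.≤-Reasoning

∣-∣-triangle : ∀ {A B} a b → ∣ a ∣ ℚ.≤ A → ∣ b ∣ ℚ.≤ B → ∣ a ℚ.+ b ∣ ℚ.≤ A ℚ.+ B
∣-∣-triangle a b a≤A b≤B = ℚP.≤-trans (ℚP.∣p+q∣≤∣p∣+∣q∣ a b) (ℚP.+-mono-≤ a≤A b≤B)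

∣-∣-swap : ∀ a b → ∣ a ℚ.- b ∣ ≡ ∣ b ℚ.- a ∣
∣-∣-swap a b = trans
  (cong ∣_∣ (solve 2 (λ a b → a :- b := :- (b :- a)) refl a b))
  (ℚP.∣-p∣≡∣p∣ (b ℚ.- a))
  where open +-*-Solver

-p≤∣p∣ : ∀ p → ℚ.- p ℚ.≤ ∣ p ∣
-p≤∣p∣ p = subst (ℚ.- p ℚ.≤_) (ℚP.∣-p∣≡∣p∣ p) (p≤∣p∣ (ℚ.- p))
  where
  p≤∣p∣ : ∀ q → q ℚ.≤ ∣ q ∣
  p≤∣p∣ (ℚ.mkℚ (+ n) d c) = ℚP.≤-refl
  p≤∣p∣ q@(ℚ.mkℚ (ℤ.-[1+ n ]) d c) =
    ℚP.≤-trans (ℚP.<⇒≤ (ℚP.negative⁻¹ q)) (ℚP.0≤∣p∣ q)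

opaque
  recip : ∀ q → 0ℚ ℚ.< q → ∃ λ r → 0ℚ ℚ.< r × q ℚ.* r ≡ 1ℚ
  recip q 0<q = r , ℚP.positive⁻¹ r {{ℚP.1/pos⇒pos q {{q>0}}}} , ℚP.*-inverseʳ q {{q≢0}}
    where
    q>0 : ℚ.Positive q
    q>0 = ℚ.positive 0<q
    q≢0 : ℚ.NonZero q
    q≢0 = ℚP.pos⇒nonZero q {{q>0}}
    r : ℚ
    r = (ℚ.1/ q) {{q≢0}}

opaque
  shrink : ∀ K ε → 0ℚ ℚ.≤ K → 0ℚ ℚ.< ε → ∃ λ δ → 0ℚ ℚ.< δ × K ℚ.* δ ℚ.≤ ε
  shrink K ε 0≤K 0<ε = ε ℚ.* r , 0<εr , (begin
      K ℚ.* (ε ℚ.* r)             ≤⟨ *-mono-≤ʳ (ε ℚ.* r) (ℚP.<⇒≤ 0<εr) K≤K+1 ⟩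
      (K ℚ.+ 1ℚ) ℚ.* (ε ℚ.* r)   ≡⟨ solve 3 (λ k e r → k :* (e :* r) := e :* (k :* r)) refl (K ℚ.+ 1ℚ) ε r ⟩
      ε ℚ.* ((K ℚ.+ 1ℚ) ℚ.* r)   ≡⟨ cong (ε ℚ.*_) eq ⟩
      ε ℚ.* 1ℚ                    ≡⟨ ℚP.*-identityʳ ε ⟩
      ε                           ∎)
    where
    open ℚP.≤-Reasoning
    open +-*-Solver
    inverse : ∃ λ r → 0ℚ ℚ.< r × (K ℚ.+ 1ℚ) ℚ.* r ≡ 1ℚ
    inverse = recip (K ℚ.+ 1ℚ) (ℚP.+-mono-≤-< 0≤K (ℚP.positive⁻¹ 1ℚ))
    r : ℚ
    r = proj₁ inverse
    0<r : 0ℚ ℚ.< r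
    0<r = proj₁ (proj₂ inverse)
    eq : (K ℚ.+ 1ℚ) ℚ.* r ≡ 1ℚ
    eq = proj₂ (proj₂ inverse)
    0<εr : 0ℚ ℚ.< ε ℚ.* r
    0<εr = ℚP.positive⁻¹ (ε ℚ.* r) {{ℚP.pos*pos⇒pos ε {{ℚ.positive 0<ε}} r {{ℚ.positive 0<r}}}}
    K≤K+1 : K ℚ.≤ K ℚ.+ 1ℚ
    K≤K+1 = ℚP.≤-trans (ℚP.≤-reflexive (sym (ℚP.+-identityʳ K))) (ℚP.+-monoʳ-≤ K 0≤1)

-- ℝ is the setoid of Cauchy sequences of rationals; the field operations act
-- termwise and ≈ᴿ is its equality.
Cauchy : (ℕ → ℚ) → Set
Cauchy x = ∀ ε → 0ℚ ℚ.< ε → ∃ λ N → ∀ m n → N ℕ.≤ m → N ℕ.≤ n → ∣ x m ℚ.- x n ∣ ℚ.≤ ε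

record ℝ : Set where
  constructor mkℝ
  field
    seq    : ℕ → ℚ
    cauchy : Cauchy seq

open ℝ public

infix  4 _≈ᴿ_ _<ᴿ_
infix  8 -ᴿ_
infixl 7 _*ᴿ_
infixl 6 _+ᴿ_ _-ᴿ_

_≈ᴿ_ : ℝ → ℝ → Set
x ≈ᴿ y = ∀ ε → 0ℚ ℚ.< ε → ∃ λ N → ∀ n → N ℕ.≤ n → ∣ seq x n ℚ.- seq y n ∣ ℚ.≤ ε

_<ᴿ_ : ℝ → ℝ → Set
x <ᴿ y = ∃ λ δ → 0ℚ ℚ.< δ × ∃ λ N → ∀ n → N ℕ.≤ n → δ ℚ.≤ seq y n ℚ.- seq x n

opaque
  const-cauchy : ∀ q → Cauchy (λ _ → q)
  const-cauchy q = λ ε 0<ε → 0 , λ _ _ _ _ →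
    subst (ℚ._≤ ε) (cong ∣_∣ (sym (ℚP.+-inverseʳ q))) (ℚP.<⇒≤ 0<ε)

fromℚ : ℚ → ℝ
fromℚ q = mkℝ (λ _ → q) (const-cauchy q)

0ᴿ 1ᴿ : ℝ
0ᴿ = fromℚ 0ℚ
1ᴿ = fromℚ 1ℚ

opaque
  bounded : (x : ℝ) → ∃ λ B → 0ℚ ℚ.≤ B × ∃ λ N → ∀ n → N ℕ.≤ n → ∣ seq x n ∣ ℚ.≤ B
  bounded x with cauchy x 1ℚ (ℚP.positive⁻¹ 1ℚ)
  ... | N , h = 1ℚ ℚ.+ ∣ seq x N ∣ , +-nonNeg 0≤1 (ℚP.0≤∣p∣ (seq x N)) , N , λ n N≤n →
    subst (ℚ._≤ 1ℚ ℚ.+ ∣ seq x N ∣)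
      (cong ∣_∣ (solve 2 (λ a b → (a :- b) :+ b := a) refl (seq x n) (seq x N)))
      (∣-∣-triangle (seq x n ℚ.- seq x N) (seq x N) (h n N N≤n ℕP.≤-refl) ℚP.≤-refl)
    where open +-*-Solver

opaque
  +-cauchy : ∀ x y → Cauchy (λ n → seq x n ℚ.+ seq y n)
  +-cauchy x y = λ ε 0<ε →
    let δ , 0<δ , 2δ≤ε = shrink 2ℚ ε (ℚP.nonNegative⁻¹ 2ℚ) 0<ε
        N , f = cauchy x δ 0<δ
        M , g = cauchy y δ 0<δ
    in N ⊔ M , λ m n p q → begin
      ∣ (seq x m ℚ.+ seq y m) ℚ.- (seq x n ℚ.+ seq y n) ∣
        ≡⟨ cong ∣_∣ (solve 4 (λ a b c d → (a :+ b) :- (c :+ d) := (a :- c) :+ (b :- d)) refl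
             (seq x m) (seq y m) (seq x n) (seq y n)) ⟩
      ∣ (seq x m ℚ.- seq x n) ℚ.+ (seq y m ℚ.- seq y n) ∣
        ≤⟨ ∣-∣-triangle (seq x m ℚ.- seq x n) (seq y m ℚ.- seq y n)
             (f m n (ℕP.m⊔n≤o⇒m≤o N M p) (ℕP.m⊔n≤o⇒m≤o N M q))
             (g m n (ℕP.m⊔n≤o⇒n≤o N M p) (ℕP.m⊔n≤o⇒n≤o N M q)) ⟩
      δ ℚ.+ δ  ≡⟨ solve 1 (λ d → d :+ d := con 2ℚ :* d) refl δ ⟩
      2ℚ ℚ.* δ ≤⟨ 2δ≤ε ⟩
      ε        ∎
    where
    open ℚP.≤-Reasoning
    open +-*-Solver

_+ᴿ_ : ℝ → ℝ → ℝ
x +ᴿ y = mkℝ (λ n → seq x n ℚ.+ seq y n) (+-cauchy x y)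

opaque
  neg-cauchy : ∀ x → Cauchy (λ n → ℚ.- seq x n)
  neg-cauchy x = λ ε 0<ε →
    let N , f = cauchy x ε 0<ε
    in N , λ m n p q → subst (ℚ._≤ ε)
         (cong ∣_∣ (solve 2 (λ a b → a :- b := :- b :- :- a) refl (seq x n) (seq x m)))
         (f n m q p)
    where open +-*-Solver

-ᴿ_ : ℝ → ℝ
-ᴿ x = mkℝ (λ n → ℚ.- seq x n) (neg-cauchy x)

_-ᴿ_ : ℝ → ℝ → ℝ
x -ᴿ y = x +ᴿ -ᴿ y

opaque
  *-cauchy : ∀ x y → Cauchy (λ n → seq x n ℚ.* seq y n)
  *-cauchy x y = λ ε 0<ε →
    let A , 0≤A , Nx , a = bounded x
        B , 0≤B , Ny , b = bounded y
        δ , 0<δ , Kδ≤ε = shrink (A ℚ.+ B) ε (+-nonNeg 0≤A 0≤B) 0<ε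
        N , f = cauchy x δ 0<δ
        M , g = cauchy y δ 0<δ
    in (Nx ⊔ Ny) ⊔ (N ⊔ M) , λ m n p q → begin
      ∣ seq x m ℚ.* seq y m ℚ.- seq x n ℚ.* seq y n ∣
        ≡⟨ cong ∣_∣ (solve 4 (λ a b c d → a :* b :- c :* d := a :* (b :- d) :+ d :* (a :- c)) refl
             (seq x m) (seq y m) (seq x n) (seq y n)) ⟩
      ∣ seq x m ℚ.* (seq y m ℚ.- seq y n) ℚ.+ seq y n ℚ.* (seq x m ℚ.- seq x n) ∣
        ≤⟨ ∣-∣-triangle (seq x m ℚ.* (seq y m ℚ.- seq y n)) (seq y n ℚ.* (seq x m ℚ.- seq x n))
             (∣-∣-mono-* (seq x m) (seq y m ℚ.- seq y n)
               (a m (ℕP.m⊔n≤o⇒m≤o Nx Ny (ℕP.m⊔n≤o⇒m≤o (Nx ⊔ Ny) (N ⊔ M) p)))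
               (g m n (ℕP.m⊔n≤o⇒n≤o N M (ℕP.m⊔n≤o⇒n≤o (Nx ⊔ Ny) (N ⊔ M) p))
                      (ℕP.m⊔n≤o⇒n≤o N M (ℕP.m⊔n≤o⇒n≤o (Nx ⊔ Ny) (N ⊔ M) q))))
             (∣-∣-mono-* (seq y n) (seq x m ℚ.- seq x n)
               (b n (ℕP.m⊔n≤o⇒n≤o Nx Ny (ℕP.m⊔n≤o⇒m≤o (Nx ⊔ Ny) (N ⊔ M) q)))
               (f m n (ℕP.m⊔n≤o⇒m≤o N M (ℕP.m⊔n≤o⇒n≤o (Nx ⊔ Ny) (N ⊔ M) p))
                      (ℕP.m⊔n≤o⇒m≤o N M (ℕP.m⊔n≤o⇒n≤o (Nx ⊔ Ny) (N ⊔ M) q)))) ⟩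
      A ℚ.* δ ℚ.+ B ℚ.* δ  ≡⟨ sym (ℚP.*-distribʳ-+ δ A B) ⟩
      (A ℚ.+ B) ℚ.* δ      ≤⟨ Kδ≤ε ⟩
      ε                    ∎
    where
    open ℚP.≤-Reasoning
    open +-*-Solver

_*ᴿ_ : ℝ → ℝ → ℝ
x *ᴿ y = mkℝ (λ n → seq x n ℚ.* seq y n) (*-cauchy x y)

_⟶ᴿ_ : (ℕ → ℝ) → ℝ → Set
s ⟶ᴿ l = ∀ ε → 0ℚ ℚ.< ε → ∃ λ N → ∀ n → N ℕ.≤ n →
  l -ᴿ fromℚ ε <ᴿ s n × s n <ᴿ l +ᴿ fromℚ ε

-- A Cauchy condition on a sequence of reals that is checked on all late entries
-- of the representatives, so that the diagonal represents the limit.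
UniformTail : (ℕ → ℝ) → Set
UniformTail s = ∀ ε → 0ℚ ℚ.< ε → ∃ λ N → ∀ n k → N ℕ.≤ n → N ℕ.≤ k →
  ∣ seq (s n) k ℚ.- seq (s N) k ∣ ℚ.≤ ε

module Diagonal (s : ℕ → ℝ) (tail : UniformTail s) where

  open ℚP.≤-Reasoning
  open +-*-Solver

  opaque
    diag-cauchy : Cauchy (λ k → seq (s k) k)
    diag-cauchy = λ ε 0<ε →
      let δ , 0<δ , 3δ≤ε = shrink 3ℚ ε (ℚP.nonNegative⁻¹ 3ℚ) 0<ε
          N , f = tail δ 0<δ
          M , g = cauchy (s N) δ 0<δ
      in N ⊔ M , λ m n p q →
        let p₁ = ℕP.m⊔n≤o⇒m≤o N M p
            p₂ = ℕP.m⊔n≤o⇒n≤o N M p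
            q₁ = ℕP.m⊔n≤o⇒m≤o N M q
            q₂ = ℕP.m⊔n≤o⇒n≤o N M q
            a = seq (s m) m
            b = seq (s N) m
            c = seq (s N) n
            d = seq (s n) n
        in begin
          ∣ a ℚ.- d ∣
            ≡⟨ cong ∣_∣ (solve 4 (λ a b c d → a :- d := (a :- b) :+ ((b :- c) :+ (c :- d))) refl a b c d) ⟩
          ∣ (a ℚ.- b) ℚ.+ ((b ℚ.- c) ℚ.+ (c ℚ.- d)) ∣
            ≤⟨ ∣-∣-triangle (a ℚ.- b) ((b ℚ.- c) ℚ.+ (c ℚ.- d)) (f m m p₁ p₁)
                 (∣-∣-triangle (b ℚ.- c) (c ℚ.- d) (g m n p₂ q₂)
                   (ℚP.≤-trans (ℚP.≤-reflexive (∣-∣-swap c d)) (f n n q₁ q₁))) ⟩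
          δ ℚ.+ (δ ℚ.+ δ)  ≡⟨ solve 1 (λ d → d :+ (d :+ d) := con 3ℚ :* d) refl δ ⟩
          3ℚ ℚ.* δ         ≤⟨ 3δ≤ε ⟩
          ε                ∎

  diag : ℝ
  diag = mkℝ (λ k → seq (s k) k) diag-cauchy

  margin : ∀ {ε δ} a b c → 3ℚ ℚ.* δ ℚ.≤ ε → ∣ a ℚ.- b ∣ ℚ.≤ δ → ∣ c ℚ.- b ∣ ℚ.≤ δ →
           δ ℚ.≤ a ℚ.- (c ℚ.- ε)
  margin {ε} {δ} a b c 3δ≤ε p q = begin
    δ
      ≡⟨ solve 1 (λ d → d := con 3ℚ :* d :+ (:- (d :+ d))) refl δ ⟩
    3ℚ ℚ.* δ ℚ.- (δ ℚ.+ δ)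
      ≤⟨ ℚP.+-mono-≤ 3δ≤ε (ℚP.neg-antimono-≤ c-a≤2δ) ⟩
    ε ℚ.- (c ℚ.- a)
      ≡⟨ solve 3 (λ e a c → e :- (c :- a) := a :- (c :- e)) refl ε a c ⟩
    a ℚ.- (c ℚ.- ε)  ∎
    where
    c-a≤2δ : c ℚ.- a ℚ.≤ δ ℚ.+ δ
    c-a≤2δ = begin
      c ℚ.- a                      ≡⟨ solve 2 (λ a c → c :- a := :- (a :- c)) refl a c ⟩
      ℚ.- (a ℚ.- c)                ≤⟨ -p≤∣p∣ (a ℚ.- c) ⟩
      ∣ a ℚ.- c ∣                  ≡⟨ cong ∣_∣ (solve 3 (λ a b c → a :- c := (a :- b) :+ (b :- c)) refl a b c) ⟩
      ∣ (a ℚ.- b) ℚ.+ (b ℚ.- c) ∣  ≤⟨ ∣-∣-triangle (a ℚ.- b) (b ℚ.- c) p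
                                        (ℚP.≤-trans (ℚP.≤-reflexive (∣-∣-swap b c)) q) ⟩
      δ ℚ.+ δ                      ∎

  converges : s ⟶ᴿ diag
  converges ε 0<ε =
    let δ , 0<δ , 3δ≤ε = shrink 3ℚ ε (ℚP.nonNegative⁻¹ 3ℚ) 0<ε
        N , f = tail δ 0<δ
    in N , λ n N≤n →
      (δ , 0<δ , N , λ k N≤k →
        margin (seq (s n) k) (seq (s N) k) (seq (s k) k) 3δ≤ε (f n k N≤n N≤k) (f k k N≤k N≤k)) ,
      (δ , 0<δ , N , λ k N≤k → ℚP.≤-trans
        (margin (seq (s k) k) (seq (s N) k) (seq (s n) k) 3δ≤ε (f k k N≤k N≤k) (f n k N≤n N≤k))
        (ℚP.≤-reflexive (solve 3 (λ a b e → a :- (b :- e) := (a :+ e) :- b) refl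
          (seq (s k) k) (seq (s n) k) ε)))

record ℂ : Set where
  constructor _+i_
  field
    re im : ℝ

open ℂ public

infix  4 _≈_
infix  8 -_
infixr 8 _^_
infixl 7 _*_
infixl 6 _+_ _-_

_≈_ : ℂ → ℂ → Set
z ≈ w = re z ≈ᴿ re w × im z ≈ᴿ im w

0ᶜ 1ᶜ i : ℂ
0ᶜ = 0ᴿ +i 0ᴿ
1ᶜ = 1ᴿ +i 0ᴿ
i  = 0ᴿ +i 1ᴿ

fromℝ : ℝ → ℂ
fromℝ x = x +i 0ᴿ

_+_ _-_ _*_ : ℂ → ℂ → ℂ
z + w = (re z +ᴿ re w) +i (im z +ᴿ im w)
z - w = (re z -ᴿ re w) +i (im z -ᴿ im w)
z * w = (re z *ᴿ re w -ᴿ im z *ᴿ im w) +i (re z *ᴿ im w +ᴿ im z *ᴿ re w)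

-_ : ℂ → ℂ
- z = (-ᴿ re z) +i (-ᴿ im z)

_^_ : ℂ → ℕ → ℂ
z ^ zero  = 1ᶜ
z ^ suc n = z * z ^ n

_⟶_ : (ℕ → ℂ) → ℂ → Set
s ⟶ l = (λ n → re (s n)) ⟶ᴿ re l × (λ n → im (s n)) ⟶ᴿ im l

1/_! : ℕ → ℚ
1/ n ! = (+ 1 ℚ./ (n !)) {{n ℕP.!≢0}}

expTerm : ℂ → ℕ → ℂ
expTerm z n = fromℝ (fromℚ (1/ n !)) * z ^ n

expSum : ℂ → ℕ → ℂ
expSum z zero    = 0ᶜ
expSum z (suc n) = expSum z n + expTerm z n

1/suc : ℕ → ℚ
1/suc n = + 1 ℚ./ suc n

fromℕ : ℕ → ℚ
fromℕ n = + n ℚ./ 1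

opaque
  1/-* : ∀ m n .{{_ : NonZero m}} .{{_ : NonZero n}} .{{_ : NonZero (m ℕ.* n)}} →
         + 1 ℚ./ (m ℕ.* n) ≡ (+ 1 ℚ./ m) ℚ.* (+ 1 ℚ./ n)
  1/-* (suc m) (suc n) = ℚP.toℚᵘ-injective (begin
    ℚ.toℚᵘ (+ 1 ℚ./ (suc m ℕ.* suc n))
      ≈⟨ ℚP.toℚᵘ-fromℚᵘ (ℚᵘ.mkℚᵘ (+ 1) (n ℕ.+ m ℕ.* suc n)) ⟩
    ℚᵘ.mkℚᵘ (+ 1) m ℚᵘ.* ℚᵘ.mkℚᵘ (+ 1) n
      ≈⟨ ℚᵘP.*-cong (ℚP.toℚᵘ-fromℚᵘ (ℚᵘ.mkℚᵘ (+ 1) m)) (ℚP.toℚᵘ-fromℚᵘ (ℚᵘ.mkℚᵘ (+ 1) n)) ⟨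
    ℚ.toℚᵘ (+ 1 ℚ./ suc m) ℚᵘ.* ℚ.toℚᵘ (+ 1 ℚ./ suc n)
      ≈⟨ ℚP.toℚᵘ-homo-* (+ 1 ℚ./ suc m) (+ 1 ℚ./ suc n) ⟨
    ℚ.toℚᵘ ((+ 1 ℚ./ suc m) ℚ.* (+ 1 ℚ./ suc n)) ∎)
    where open ℚᵘP.≃-Reasoning

1/!-suc : ∀ n → 1/ suc n ! ≡ 1/suc n ℚ.* 1/ n !
1/!-suc n = 1/-* (suc n) (n !) {{_}} {{n ℕP.!≢0}} {{suc n ℕP.!≢0}}

opaque
  0<1/suc : ∀ n → 0ℚ ℚ.< 1/suc n
  0<1/suc n = ℚP.positive⁻¹ (1/suc n) {{ℚP.normalize-pos 1 (suc n)}}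

opaque
  0≤1/! : ∀ n → 0ℚ ℚ.≤ 1/ n !
  0≤1/! zero    = 0≤1
  0≤1/! (suc n) = subst (0ℚ ℚ.≤_) (sym (1/!-suc n)) (*-nonNeg (ℚP.<⇒≤ (0<1/suc n)) (0≤1/! n))

opaque
  suc*1/suc : ∀ n → fromℕ (suc n) ℚ.* 1/suc n ≡ 1ℚ
  suc*1/suc n = ℚP.toℚᵘ-injective (begin
    ℚ.toℚᵘ (fromℕ (suc n) ℚ.* 1/suc n)
      ≈⟨ ℚP.toℚᵘ-homo-* (fromℕ (suc n)) (1/suc n) ⟩
    ℚ.toℚᵘ (fromℕ (suc n)) ℚᵘ.* ℚ.toℚᵘ (1/suc n)
      ≈⟨ ℚᵘP.*-cong (ℚP.toℚᵘ-fromℚᵘ (ℚᵘ.mkℚᵘ (+ suc n) 0)) (ℚP.toℚᵘ-fromℚᵘ (ℚᵘ.mkℚᵘ (+ 1) n)) ⟩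
    ℚᵘ.mkℚᵘ (+ suc n) 0 ℚᵘ.* ℚᵘ.mkℚᵘ (+ 1) n
      ≈⟨ ℚᵘP.*-inverseʳ (ℚᵘ.mkℚᵘ (+ suc n) 0) ⟩
    ℚᵘ.1ℚᵘ ∎)
    where open ℚᵘP.≃-Reasoning

opaque
  fromℕ-mono : ∀ {m n} → m ℕ.≤ n → fromℕ m ℚ.≤ fromℕ n
  fromℕ-mono {m} {n} m≤n = ℚP.toℚᵘ-cancel-≤ (begin
    ℚ.toℚᵘ (fromℕ m)   ≃⟨ ℚP.toℚᵘ-fromℚᵘ (ℚᵘ.mkℚᵘ (+ m) 0) ⟩
    ℚᵘ.mkℚᵘ (+ m) 0    ≤⟨ ℚᵘ.*≤* (ℤP.*-monoʳ-≤-nonNeg (+ 1) (ℤ.+≤+ m≤n)) ⟩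
    ℚᵘ.mkℚᵘ (+ n) 0    ≃⟨ ℚP.toℚᵘ-fromℚᵘ (ℚᵘ.mkℚᵘ (+ n) 0) ⟨
    ℚ.toℚᵘ (fromℕ n)   ∎)
    where open ℚᵘP.≤-Reasoning

opaque
  archimedean : ∀ q → ∃ λ n → q ℚ.≤ fromℕ n
  archimedean q@(ℚ.mkℚ p d c) = ℤ.∣ p ∣ , ℚP.toℚᵘ-cancel-≤ (begin
    ℚᵘ.mkℚᵘ p d                ≤⟨ ℚᵘ.*≤* (ℤP.≤-trans (ℤP.≤-reflexive (ℤP.*-identityʳ p)) p≤) ⟩
    ℚᵘ.mkℚᵘ (+ ℤ.∣ p ∣) 0      ≃⟨ ℚP.toℚᵘ-fromℚᵘ (ℚᵘ.mkℚᵘ (+ ℤ.∣ p ∣) 0) ⟨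
    ℚ.toℚᵘ (fromℕ ℤ.∣ p ∣)     ∎)
    where
    open ℚᵘP.≤-Reasoning
    p≤∣p∣ : ∀ p → p ℤ.≤ + ℤ.∣ p ∣
    p≤∣p∣ (+ n)       = ℤP.≤-refl
    p≤∣p∣ ℤ.-[1+ n ]  = ℤ.-≤+
    p≤ : p ℤ.≤ + ℤ.∣ p ∣ ℤ.* + suc d
    p≤ = ℤP.≤-trans (p≤∣p∣ p)
           (ℤP.≤-trans (ℤ.+≤+ (ℕP.m≤m*n ℤ.∣ p ∣ (suc d)))
             (ℤP.≤-reflexive (ℤP.pos-* ℤ.∣ p ∣ (suc d))))

opaque
  *1/suc-small : ∀ C ε → 0ℚ ℚ.≤ C → 0ℚ ℚ.< ε → ∃ λ L → ∀ n → L ℕ.≤ n → C ℚ.* 1/suc n ℚ.≤ ε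
  *1/suc-small C ε 0≤C 0<ε = L , λ n L≤n → begin
      C ℚ.* 1/suc n                        ≡⟨ ℚP.*-identityˡ (C ℚ.* 1/suc n) ⟨
      1ℚ ℚ.* (C ℚ.* 1/suc n)              ≡⟨ cong (ℚ._* (C ℚ.* 1/suc n)) εr≡1 ⟨
      (ε ℚ.* r) ℚ.* (C ℚ.* 1/suc n)
        ≡⟨ solve 4 (λ e r c u → (e :* r) :* (c :* u) := (e :* u) :* (c :* r)) refl ε r C (1/suc n) ⟩
      (ε ℚ.* 1/suc n) ℚ.* (C ℚ.* r)
        ≤⟨ *-mono-≤ˡ (ε ℚ.* 1/suc n) (*-nonNeg (ℚP.<⇒≤ 0<ε) (ℚP.<⇒≤ (0<1/suc n)))
             (ℚP.≤-trans Cr≤L (fromℕ-mono (ℕP.m≤n⇒m≤1+n L≤n))) ⟩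
      (ε ℚ.* 1/suc n) ℚ.* fromℕ (suc n)
        ≡⟨ solve 3 (λ e u k → (e :* u) :* k := e :* (k :* u)) refl ε (1/suc n) (fromℕ (suc n)) ⟩
      ε ℚ.* (fromℕ (suc n) ℚ.* 1/suc n)  ≡⟨ cong (ε ℚ.*_) (suc*1/suc n) ⟩
      ε ℚ.* 1ℚ                            ≡⟨ ℚP.*-identityʳ ε ⟩
      ε                                    ∎
    where
    open ℚP.≤-Reasoning
    open +-*-Solver
    inverse : ∃ λ r → 0ℚ ℚ.< r × ε ℚ.* r ≡ 1ℚ
    inverse = recip ε 0<ε
    r : ℚ
    r = proj₁ inverse
    εr≡1 : ε ℚ.* r ≡ 1ℚ
    εr≡1 = proj₂ (proj₂ inverse)
    L : ℕ
    L = proj₁ (archimedean (C ℚ.* r))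
    Cr≤L : C ℚ.* r ℚ.≤ fromℕ L
    Cr≤L = proj₂ (archimedean (C ℚ.* r))

norm : ℕ → ℂ → ℚ
norm k z = ∣ seq (re z) k ∣ ℚ.+ ∣ seq (im z) k ∣

0≤norm : ∀ k z → 0ℚ ℚ.≤ norm k z
0≤norm k z = +-nonNeg (ℚP.0≤∣p∣ (seq (re z) k)) (ℚP.0≤∣p∣ (seq (im z) k))

norm-* : ∀ k z w → norm k (z * w) ℚ.≤ norm k z ℚ.* norm k w
norm-* k z w = begin
  ∣ a ℚ.* c ℚ.- b ℚ.* d ∣ ℚ.+ ∣ a ℚ.* d ℚ.+ b ℚ.* c ∣
    ≤⟨ ℚP.+-mono-≤ (ℚP.∣p-q∣≤∣p∣+∣q∣ (a ℚ.* c) (b ℚ.* d)) (ℚP.∣p+q∣≤∣p∣+∣q∣ (a ℚ.* d) (b ℚ.* c)) ⟩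
  (∣ a ℚ.* c ∣ ℚ.+ ∣ b ℚ.* d ∣) ℚ.+ (∣ a ℚ.* d ∣ ℚ.+ ∣ b ℚ.* c ∣)
    ≡⟨ cong₂ ℚ._+_ (cong₂ ℚ._+_ (ℚP.∣p*q∣≡∣p∣*∣q∣ a c) (ℚP.∣p*q∣≡∣p∣*∣q∣ b d))
                   (cong₂ ℚ._+_ (ℚP.∣p*q∣≡∣p∣*∣q∣ a d) (ℚP.∣p*q∣≡∣p∣*∣q∣ b c)) ⟩
  (∣ a ∣ ℚ.* ∣ c ∣ ℚ.+ ∣ b ∣ ℚ.* ∣ d ∣) ℚ.+ (∣ a ∣ ℚ.* ∣ d ∣ ℚ.+ ∣ b ∣ ℚ.* ∣ c ∣)
    ≡⟨ solve 4 (λ a b c d → (a :* c :+ b :* d) :+ (a :* d :+ b :* c) := (a :+ b) :* (c :+ d)) refl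
         (∣ a ∣) (∣ b ∣) (∣ c ∣) (∣ d ∣) ⟩
  (∣ a ∣ ℚ.+ ∣ b ∣) ℚ.* (∣ c ∣ ℚ.+ ∣ d ∣) ∎
  where
  open ℚP.≤-Reasoning
  open +-*-Solver
  a = seq (re z) k
  b = seq (im z) k
  c = seq (re w) k
  d = seq (im w) k

module ExpTail (z : ℂ) (M : ℚ) (0≤M : 0ℚ ℚ.≤ M) (N₀ : ℕ)
               (norm≤M : ∀ k → N₀ ℕ.≤ k → norm k z ℚ.≤ M) where

  open ℚP.≤-Reasoning
  open +-*-Solver

  power : ℕ → ℚ
  power zero    = 1ℚ
  power (suc n) = M ℚ.* power n

  0≤power : ∀ n → 0ℚ ℚ.≤ power n
  0≤power zero    = 0≤1
  0≤power (suc n) = *-nonNeg 0≤M (0≤power n)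

  opaque
    e : ℕ → ℚ
    e n = 1/ n ! ℚ.* power n

    0≤e : ∀ n → 0ℚ ℚ.≤ e n
    0≤e n = *-nonNeg (0≤1/! n) (0≤power n)

    e-suc : ∀ n → e (suc n) ≡ e n ℚ.* (M ℚ.* 1/suc n)
    e-suc n = trans (cong (ℚ._* power (suc n)) (1/!-suc n))
      (solve 4 (λ u f m p → (u :* f) :* (m :* p) := (f :* p) :* (m :* u)) refl
        (1/suc n) (1/ n !) M (power n))

  norm-^ : ∀ k → N₀ ℕ.≤ k → ∀ n → norm k (z ^ n) ℚ.≤ power n
  norm-^ k p zero    = ℚP.≤-refl
  norm-^ k p (suc n) = begin
    norm k (z * z ^ n)           ≤⟨ norm-* k z (z ^ n) ⟩
    norm k z ℚ.* norm k (z ^ n)  ≤⟨ *-mono-≤ʳ (norm k (z ^ n)) (0≤norm k (z ^ n)) (norm≤M k p) ⟩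
    M ℚ.* norm k (z ^ n)         ≤⟨ *-mono-≤ˡ M 0≤M (norm-^ k p n) ⟩
    M ℚ.* power n                ∎

  opaque
    unfolding e

    norm-term : ∀ k → N₀ ℕ.≤ k → ∀ n → norm k (expTerm z n) ℚ.≤ e n
    norm-term k p n = begin
      norm k (fromℝ (fromℚ (1/ n !)) * z ^ n)   ≤⟨ norm-* k (fromℝ (fromℚ (1/ n !))) (z ^ n) ⟩
      (∣ 1/ n ! ∣ ℚ.+ 0ℚ) ℚ.* norm k (z ^ n)    ≡⟨ cong (ℚ._* norm k (z ^ n)) (trans (ℚP.+-identityʳ (∣ 1/ n ! ∣)) (ℚP.0≤p⇒∣p∣≡p (0≤1/! n))) ⟩
      1/ n ! ℚ.* norm k (z ^ n)                 ≤⟨ *-mono-≤ˡ (1/ n !) (0≤1/! n) (norm-^ k p n) ⟩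
      e n                                       ∎

  -- From K on the dominating terms at least halve at each step.
  halving = *1/suc-small (2ℚ ℚ.* M) 1ℚ (*-nonNeg (ℚP.nonNegative⁻¹ 2ℚ) 0≤M) (ℚP.positive⁻¹ 1ℚ)

  K : ℕ
  K = proj₁ halving

  halves : ∀ n → K ℕ.≤ n → 2ℚ ℚ.* e (suc n) ℚ.≤ e n
  halves n K≤n = begin
    2ℚ ℚ.* e (suc n)                    ≡⟨ cong (2ℚ ℚ.*_) (e-suc n) ⟩
    2ℚ ℚ.* (e n ℚ.* (M ℚ.* 1/suc n))
      ≡⟨ solve 4 (λ t e m u → t :* (e :* (m :* u)) := e :* ((t :* m) :* u)) refl 2ℚ (e n) M (1/suc n) ⟩
    e n ℚ.* ((2ℚ ℚ.* M) ℚ.* 1/suc n)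
      ≤⟨ *-mono-≤ˡ (e n) (0≤e n) (proj₂ halving n K≤n) ⟩
    e n ℚ.* 1ℚ                          ≡⟨ ℚP.*-identityʳ (e n) ⟩
    e n                                 ∎

  e-step : ∀ n → K ℕ.≤ n → e (suc n) ℚ.≤ e n
  e-step n K≤n = begin
    e (suc n)                ≡⟨ ℚP.+-identityʳ (e (suc n)) ⟨
    e (suc n) ℚ.+ 0ℚ         ≤⟨ ℚP.+-monoʳ-≤ (e (suc n)) (0≤e (suc n)) ⟩
    e (suc n) ℚ.+ e (suc n)  ≡⟨ solve 1 (λ d → d :+ d := con 2ℚ :* d) refl (e (suc n)) ⟩
    2ℚ ℚ.* e (suc n)         ≤⟨ halves n K≤n ⟩
    e n                      ∎

  e-anti : ∀ {m n} → K ℕ.≤ m → m ℕ.≤ n → e n ℚ.≤ e m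
  e-anti {m} K≤m m≤n = go (ℕP.≤⇒≤′ m≤n)
    where
    go : ∀ {n} → m ℕ.≤′ n → e n ℚ.≤ e m
    go ℕ.≤′-refl             = ℚP.≤-refl
    go (ℕ.≤′-step {n = n} p) = ℚP.≤-trans (e-step n (ℕP.≤-trans K≤m (ℕP.≤′⇒≤ p))) (go p)

  opaque
    small : ∀ ε → 0ℚ ℚ.< ε → ∃ λ N → K ℕ.≤ N × 2ℚ ℚ.* e N ℚ.≤ ε
    small ε 0<ε =
      let C = 2ℚ ℚ.* (e K ℚ.* M)
          L , h = *1/suc-small C ε (*-nonNeg (ℚP.nonNegative⁻¹ 2ℚ) (*-nonNeg (0≤e K) 0≤M)) 0<ε
          n = L ℕ.+ K
          u = M ℚ.* 1/suc n
      in suc n , ℕP.m≤n⇒m≤1+n (ℕP.m≤n+m K L) , (begin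
        2ℚ ℚ.* e (suc n)       ≡⟨ cong (2ℚ ℚ.*_) (e-suc n) ⟩
        2ℚ ℚ.* (e n ℚ.* u)
          ≤⟨ *-mono-≤ˡ 2ℚ (ℚP.nonNegative⁻¹ 2ℚ) (*-mono-≤ʳ u (*-nonNeg 0≤M (ℚP.<⇒≤ (0<1/suc n))) (e-anti ℕP.≤-refl (ℕP.m≤n+m K L))) ⟩
        2ℚ ℚ.* (e K ℚ.* u)
          ≡⟨ solve 4 (λ t e m u → t :* (e :* (m :* u)) := (t :* (e :* m)) :* u) refl 2ℚ (e K) M (1/suc n) ⟩
        C ℚ.* 1/suc n          ≤⟨ h n (ℕP.m≤m+n L K) ⟩
        ε                      ∎)

  module Component (part : ℂ → ℝ)
                   (part-step : ∀ n k → seq (part (expSum z (suc n))) k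
                                   ≡ seq (part (expSum z n)) k ℚ.+ seq (part (expTerm z n)) k)
                   (part≤norm : ∀ k w → ∣ seq (part w) k ∣ ℚ.≤ norm k w) where

    a : ℕ → ℕ → ℚ
    a k n = seq (part (expSum z n)) k

    partial : ∀ k → N₀ ℕ.≤ k → ∀ m → K ℕ.≤ m → ∀ d →
              ∣ a k (d ℕ.+ m) ℚ.- a k m ∣ ℚ.≤ 2ℚ ℚ.* e m ℚ.- 2ℚ ℚ.* e (d ℕ.+ m)
    partial k p m K≤m zero = ℚP.≤-reflexive (trans (cong ∣_∣ (ℚP.+-inverseʳ (a k m)))
                               (sym (ℚP.+-inverseʳ (2ℚ ℚ.* e m))))
    partial k p m K≤m (suc d) = begin
      ∣ a k (suc n) ℚ.- a k m ∣
        ≡⟨ cong ∣_∣ (trans (cong (ℚ._- a k m) (part-step n k))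
             (solve 3 (λ x t y → (x :+ t) :- y := (x :- y) :+ t) refl (a k n) t (a k m))) ⟩
      ∣ (a k n ℚ.- a k m) ℚ.+ t ∣
        ≤⟨ ∣-∣-triangle (a k n ℚ.- a k m) t (partial k p m K≤m d)
             (ℚP.≤-trans (part≤norm k (expTerm z n)) (norm-term k p n)) ⟩
      (2ℚ ℚ.* e m ℚ.- 2ℚ ℚ.* e n) ℚ.+ e n
        ≡⟨ solve 2 (λ x y → (con 2ℚ :* x :- con 2ℚ :* y) :+ y := con 2ℚ :* x :- y) refl (e m) (e n) ⟩
      2ℚ ℚ.* e m ℚ.- e n
        ≤⟨ ℚP.+-monoʳ-≤ (2ℚ ℚ.* e m)
             (ℚP.neg-antimono-≤ (halves n (ℕP.≤-trans K≤m (ℕP.m≤n+m m d)))) ⟩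
      2ℚ ℚ.* e m ℚ.- 2ℚ ℚ.* e (suc n) ∎
      where
      n = d ℕ.+ m
      t = seq (part (expTerm z n)) k

    tail : UniformTail (λ n → part (expSum z n))
    tail ε 0<ε =
      let N₁ , K≤N₁ , 2e≤ε = small ε 0<ε
          N = N₁ ⊔ N₀
          K≤N = ℕP.≤-trans K≤N₁ (ℕP.m≤m⊔n N₁ N₀)
      in N , λ n k N≤n N≤k → begin
        ∣ a k n ℚ.- a k N ∣
          ≡⟨ cong (λ j → ∣ a k j ℚ.- a k N ∣) (ℕP.m∸n+n≡m N≤n) ⟨
        ∣ a k (n ℕ.∸ N ℕ.+ N) ℚ.- a k N ∣
          ≤⟨ partial k (ℕP.≤-trans (ℕP.m≤n⊔m N₁ N₀) N≤k) N K≤N (n ℕ.∸ N) ⟩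
        2ℚ ℚ.* e N ℚ.- 2ℚ ℚ.* e (n ℕ.∸ N ℕ.+ N)
          ≤⟨ ℚP.+-monoʳ-≤ (2ℚ ℚ.* e N)
               (ℚP.neg-antimono-≤ (*-nonNeg (ℚP.nonNegative⁻¹ 2ℚ) (0≤e (n ℕ.∸ N ℕ.+ N)))) ⟩
        2ℚ ℚ.* e N ℚ.+ 0ℚ  ≡⟨ ℚP.+-identityʳ (2ℚ ℚ.* e N) ⟩
        2ℚ ℚ.* e N         ≤⟨ *-mono-≤ˡ 2ℚ (ℚP.nonNegative⁻¹ 2ℚ) (e-anti K≤N₁ (ℕP.m≤m⊔n N₁ N₀)) ⟩
        2ℚ ℚ.* e N₁        ≤⟨ 2e≤ε ⟩
        ε                  ∎

opaque
  re-tail : ∀ z → UniformTail (λ n → re (expSum z n))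
  re-tail z =
    let A , 0≤A , Nx , a = bounded (re z)
        B , 0≤B , Ny , b = bounded (im z)
        module T = ExpTail z (A ℚ.+ B) (+-nonNeg 0≤A 0≤B) (Nx ⊔ Ny)
          (λ k p → ℚP.+-mono-≤ (a k (ℕP.m⊔n≤o⇒m≤o Nx Ny p)) (b k (ℕP.m⊔n≤o⇒n≤o Nx Ny p)))
    in T.Component.tail re (λ _ _ → refl) (λ k w →
         ℚP.≤-trans (ℚP.≤-reflexive (sym (ℚP.+-identityʳ (∣ seq (re w) k ∣))))
           (ℚP.+-monoʳ-≤ (∣ seq (re w) k ∣) (ℚP.0≤∣p∣ (seq (im w) k))))

  im-tail : ∀ z → UniformTail (λ n → im (expSum z n))
  im-tail z =
    let A , 0≤A , Nx , a = bounded (re z)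
        B , 0≤B , Ny , b = bounded (im z)
        module T = ExpTail z (A ℚ.+ B) (+-nonNeg 0≤A 0≤B) (Nx ⊔ Ny)
          (λ k p → ℚP.+-mono-≤ (a k (ℕP.m⊔n≤o⇒m≤o Nx Ny p)) (b k (ℕP.m⊔n≤o⇒n≤o Nx Ny p)))
    in T.Component.tail im (λ _ _ → refl) (λ k w →
         ℚP.≤-trans (ℚP.≤-reflexive (sym (ℚP.+-identityˡ (∣ seq (im w) k ∣))))
           (ℚP.+-monoˡ-≤ (∣ seq (im w) k ∣) (ℚP.0≤∣p∣ (seq (re w) k))))

-- Defined on representatives; exp-converges identifies exp z with the sum of
-- the series Σ zⁿ/n!.
exp : ℂ → ℂ
exp z = Diagonal.diag (λ n → re (expSum z n)) (re-tail z) +i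
        Diagonal.diag (λ n → im (expSum z n)) (im-tail z)

opaque
  exp-converges : ∀ z → expSum z ⟶ exp z
  exp-converges z = Diagonal.converges (λ n → re (expSum z n)) (re-tail z) ,
                    Diagonal.converges (λ n → im (expSum z n)) (im-tail z)

sin : ℝ → ℝ
sin x = im (exp (i * fromℝ x))

-- π is characterised as the least positive zero of the sine.
IsPi : ℝ → Set
IsPi π = 0ᴿ <ᴿ π × sin π ≈ᴿ 0ᴿ × (∀ x → 0ᴿ <ᴿ x → x <ᴿ π → ¬ sin x ≈ᴿ 0ᴿ)

ζ : ℝ → (n : ℕ) → .{{NonZero n}} → ℂ
ζ π n = exp (i * fromℝ (fromℚ (+ 2 ℚ./ n) *ᴿ π))

dot cross : ℂ → ℂ → ℝ
dot   z w = re z *ᴿ re w +ᴿ im z *ᴿ im w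
cross z w = re z *ᴿ im w -ᴿ im z *ᴿ re w

record Line : Set where
  field
    base      : ℂ
    direction : ℂ
    nonzero   : ¬ direction ≈ 0ᶜ

open Line public

infix 4 _On_ _≃_

_On_ : ℂ → Line → Set
z On ℓ = cross (z - base ℓ) (direction ℓ) ≈ᴿ 0ᴿ

_≃_ : Line → Line → Set
ℓ ≃ m = ∀ z → (z On ℓ → z On m) × (z On m → z On ℓ)

Parallel Perpendicular : Line → Line → Set
Parallel      ℓ m = cross (direction ℓ) (direction m) ≈ᴿ 0ᴿ
Perpendicular ℓ m = dot (direction ℓ) (direction m) ≈ᴿ 0ᴿ

midpoint : ℂ → ℂ → ℂ
midpoint z w = fromℝ (fromℚ ½) * (z + w)

-- w is the image of z under the reflection across f.
Reflects : Line → ℂ → ℂ → Set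
Reflects f z w = midpoint z w On f × dot (w - z) (direction f) ≈ᴿ 0ᴿ

-- The reflection of p across f lies on ℓ.
Places : Line → ℂ → Line → Set
Places f p ℓ = ∃ λ q → Reflects f p q × q On ℓ

-- For p ≉ q this says that f is the perpendicular bisector of p and q.
PerpendicularBisector : Line → ℂ → ℂ → Set
PerpendicularBisector f p q = midpoint p q On f × dot (q - p) (direction f) ≈ᴿ 0ᴿ

-- f is a bisector of the angle defined by ℓ and m: the reflection across f
-- carries ℓ to m.  Distinct lines have exactly two bisectors if they
-- intersect, and one (the line midway between them) if they are parallel.
Bisector : Line → Line → Line → Set
Bisector f ℓ m = ∀ p q → p On ℓ → Reflects f p q → q On m

FinitelyMany : Pred Line 0ℓ → Set
FinitelyMany P = ∃ λ fs → ∀ f → P f → Any (f ≃_) fs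

-- A 0, …, A (n - 1) are, in counterclockwise order, the vertices of a regular
-- n-gon: the image of 1, ζₙ, …, ζₙⁿ⁻¹ under an orientation-preserving similarity.
record RegularPolygon (π : ℝ) (n : ℕ) .{{_ : NonZero n}} (A : Fin n → ℂ) : Set where
  field
    centre   : ℂ
    radius   : ℂ
    nonzero  : ¬ radius ≈ 0ᶜ
    vertices : ∀ j → A j ≈ centre + radius * ζ π n ^ toℕ j

next : ∀ {n} .{{_ : NonZero n}} → Fin n → Fin n
next {n} j = suc (toℕ j) mod n

data Object : Set where
  point : ℂ → Object
  line  : Line → Object

-- Step π Γ o: a single axiom produces o from the objects in Γ.
data Step (π : ℝ) (Γ : List Object) : Object → Set where

  O1 : ∀ {p q f} → point p ∈ˡ Γ → point q ∈ˡ Γ → ¬ p ≈ q →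
       p On f → q On f →
       Step π Γ (line f)

  O2 : ∀ {p q f} → point p ∈ˡ Γ → point q ∈ˡ Γ → ¬ p ≈ q →
       PerpendicularBisector f p q →
       Step π Γ (line f)

  -- Equal lines define no angle (every perpendicular to ℓ carries ℓ to itself).
  O3 : ∀ {ℓ m f} → line ℓ ∈ˡ Γ → line m ∈ˡ Γ → ¬ ℓ ≃ m →
       Bisector f ℓ m →
       Step π Γ (line f)

  O4 : ∀ {p ℓ f} → point p ∈ˡ Γ → line ℓ ∈ˡ Γ →
       p On f → Perpendicular f ℓ →
       Step π Γ (line f)

  O5 : ∀ {p q ℓ f} → point p ∈ˡ Γ → point q ∈ˡ Γ → line ℓ ∈ˡ Γ →
       let Fold g = p On g × Places g q ℓ in
       FinitelyMany Fold → Fold f →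
       Step π Γ (line f)

  O6 : ∀ {p q ℓ m f} → point p ∈ˡ Γ → point q ∈ˡ Γ → line ℓ ∈ˡ Γ → line m ∈ˡ Γ →
       let Fold g = Places g p ℓ × Places g q m in
       FinitelyMany Fold → Fold f →
       Step π Γ (line f)

  O7 : ∀ {p ℓ m f} → point p ∈ˡ Γ → line ℓ ∈ˡ Γ → line m ∈ˡ Γ →
       let Fold g = Perpendicular g ℓ × Places g p m in
       FinitelyMany Fold → Fold f →
       Step π Γ (line f)

  LI : ∀ {ℓ m p} → line ℓ ∈ˡ Γ → line m ∈ˡ Γ → ¬ Parallel ℓ m →
       p On ℓ → p On m →
       Step π Γ (point p)

  -- The axiom RPAₙ for n = 3 + k.
  RPA : ∀ k {A : Fin (4 ℕ.+ k) → ℂ} {B : Fin (3 ℕ.+ k) → ℂ} {f} →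
        RegularPolygon π (4 ℕ.+ k) A → (∀ j → point (A j) ∈ˡ Γ) →
        RegularPolygon π (3 ℕ.+ k) B → B zero ≈ A zero → B (suc zero) ≈ A (suc zero) →
        ∀ j → B j On f → B (next j) On f →
        Step π Γ (line f)

-- The lists of objects, latest first, that arise in finitely many steps.
data Construction (π : ℝ) : List Object → Set where
  start : Construction π (point 1ᶜ ∷ point 0ᶜ ∷ [])
  _then_ : ∀ {Γ o} → Construction π Γ → Step π Γ o → Construction π (o ∷ Γ)

-- The regular origami numbers.  Cutting a construction short makes any of its
-- points the final one; ≈ makes the set respect the equality of ℂ.
𝒪-RP : ℝ → Pred ℂ 0ℓ
𝒪-RP π α = ∃₂ λ Γ β → Construction π Γ × point β ∈ˡ Γ × α ≈ β

{-# OPTIONS --safe #-}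

-- Bisecting angles yields every line through the origin whose angle is a
-- multiple of π/2ᵏ, hence also the parallels of these lines.  The regular n-gon
-- whose first two vertices are -1 and 0 has ζₙ as its third vertex.  For n = 2ᵏ
-- its vertices are intersections of such lines through -1 and 0, by the inscribed
-- angle theorem.  RPAₙ keeps the first two vertices while it passes from the
-- (n+1)-gon to the n-gon, so descending from a power of two reaches every n ≥ 3.
--
-- On the analytic side this needs exp (a + b) = exp a · exp b and sin (π q) ≠ 0
-- for 0 < q < 1.  No real number has to be inverted: a polygon of unit side has
-- radius 1/(ζ - 1) = -(1/n) Σ_{k<n} Σ_{j<k} ζʲ because the powers of ζ sum to 0.

module Submission where

open import Algebra.Bundles using (CommutativeRing; CommutativeSemiring)
import Algebra.Solver.Ring
import Algebra.Solver.Ring.AlmostCommutativeRing as ACR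
import Algebra.Solver.Ring.NaturalCoefficients.Default
open import Algebra.Structures using (IsCommutativeRing)
open import Data.Empty using (⊥-elim)
open import Data.Fin using (Fin; zero; suc; toℕ; fromℕ<)
import Data.Fin.Properties as FinP
open import Data.Integer using (+_)
import Data.Integer as ℤ
import Data.Integer.Properties as ℤP
import Data.Integer.Solver as ℤS
open import Data.List using ([]; _∷_)
open import Data.List.Membership.Propositional using () renaming (_∈_ to _∈ˡ_)
open import Data.List.Relation.Binary.Subset.Propositional using (_⊆_)
open import Data.List.Relation.Unary.Any using (here; there)
open import Data.Maybe using (Maybe; just; nothing)
open import Data.Nat as ℕ using (ℕ; zero; suc; NonZero; _⊔_)
import Data.Nat.DivMod as ℕD
import Data.Nat.Properties as ℕP
open import Data.Product using (∃; _×_; _,_; proj₁; proj₂)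
open import Data.Rational as ℚ using (ℚ; 0ℚ; 1ℚ; ½; ∣_∣)
import Data.Rational.Properties as ℚP
open import Data.Rational.Solver using (module +-*-Solver)
import Data.Rational.Unnormalised as ℚᵘ
import Data.Rational.Unnormalised.Properties as ℚᵘP
open import Data.Sum using (_⊎_; inj₁; inj₂)
open import Function using (_∘_)
open import Level using (0ℓ)
open import Relation.Binary using (Setoid)
open import Relation.Binary.PropositionalEquality using (_≡_; refl; sym; trans; cong; cong₂; subst)
open import Relation.Nullary using (¬_; yes; no)
open import Relation.Nullary.Decidable using (from-yes)
open import Relation.Unary using (_∈_)

-- Power series

-- `IsPi` describes π by zeros of the sine alone, so other values come from the addition theorem:
-- sin π = 2 sin (π/2) cos (π/2) forces cos (π/2) = 0, and then exp (iπ) = -1. Non-parallelism of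
-- the lines attached to a polygon is reduced to sin (π q) ≠ 0 by writing the two directions as a
-- and z a with |a| = 1. Such an inequality is a mere negation and yields no inverse; it is used
-- only through `*-cancel`, which removes a nonzero factor from a vanishing product.
--
-- With first vertices -1 and 0 and unit sides, the side vectors are 1, ζ, ζ², ..., so the third
-- vertex is 0 + ζ. RPAₙ supplies sides and no vertices; the vertices of the smaller polygon are
-- intersections of consecutive sides, whose directions differ by the factor ζ.
--
-- The addition theorem needs an explicit error bound. The product of two partial sums runs over a
-- square of index pairs, the partial sum for a + b over a triangle inside it. Replacing a and b by
-- a common rational bound M, the difference is at most a piece of the tail of the series of exp
-- (2M).

module Convolution (R : CommutativeSemiring 0ℓ 0ℓ) where

  open CommutativeSemiring R hiding (zero) renaming (refl to ≈-refl; sym to ≈-sym; trans to ≈-trans)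
  open import Relation.Binary.Reasoning.Setoid setoid
  open Algebra.Solver.Ring.NaturalCoefficients.Default R

  private
    Sequence : Set
    Sequence = ℕ → Carrier

  Σ : Sequence → Sequence
  Σ f zero    = 0#
  Σ f (suc n) = Σ f n + f n

  infixl 7 _⋆_

  _⋆_ : Sequence → Sequence → Sequence
  (f ⋆ g) zero    = f 0 * g 0
  (f ⋆ g) (suc n) = f 0 * g (suc n) + ((f ∘ suc) ⋆ g) n

  Σ-head : ∀ f n → Σ f (suc n) ≈ f 0 + Σ (f ∘ suc) n
  Σ-head f zero    = +-comm 0# (f 0)
  Σ-head f (suc n) = ≈-trans (+-congʳ (Σ-head f n)) (+-assoc (f 0) _ _)

  Σ-⋆ : ∀ f g n → Σ (f ⋆ g) (suc n) ≈ f 0 * Σ g (suc n) + Σ ((f ∘ suc) ⋆ g) n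
  Σ-⋆ f g zero    = solve 2 (λ a b → con 0 :+ a :* b := a :* (con 0 :+ b) :+ con 0) ≈-refl (f 0) (g 0)
  Σ-⋆ f g (suc n) = ≈-trans (+-congʳ (Σ-⋆ f g n))
    (solve 5 (λ a s t b c → (a :* s :+ t) :+ (a :* b :+ c) := a :* (s :+ b) :+ (t :+ c)) ≈-refl
      (f 0) (Σ g (suc n)) (Σ ((f ∘ suc) ⋆ g) n) (g (suc n)) (((f ∘ suc) ⋆ g) n))

  ⋆-cong : ∀ {f f′ g g′} → (∀ n → f n ≈ f′ n) → (∀ n → g n ≈ g′ n) → ∀ n → (f ⋆ g) n ≈ (f′ ⋆ g′) n
  ⋆-cong p q zero    = *-cong (p 0) (q 0)
  ⋆-cong p q (suc n) = +-cong (*-cong (p 0) (q (suc n))) (⋆-cong (p ∘ suc) q n)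

  ⋆-distribʳ : ∀ f f′ g n → ((λ j → f j + f′ j) ⋆ g) n ≈ (f ⋆ g) n + (f′ ⋆ g) n
  ⋆-distribʳ f f′ g zero    = distribʳ (g 0) (f 0) (f′ 0)
  ⋆-distribʳ f f′ g (suc n) = ≈-trans (+-congˡ (⋆-distribʳ (f ∘ suc) (f′ ∘ suc) g n))
    (solve 5 (λ a b c s t → (a :+ b) :* c :+ (s :+ t) := (a :* c :+ s) :+ (b :* c :+ t)) ≈-refl
      (f 0) (f′ 0) (g (suc n)) (((f ∘ suc) ⋆ g) n) (((f′ ∘ suc) ⋆ g) n))

  ⋆-scaleˡ : ∀ c f g n → ((λ j → c * f j) ⋆ g) n ≈ c * (f ⋆ g) n
  ⋆-scaleˡ c f g zero    = *-assoc c (f 0) (g 0)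
  ⋆-scaleˡ c f g (suc n) = ≈-trans (+-congˡ (⋆-scaleˡ c (f ∘ suc) g n))
    (solve 4 (λ c a b s → c :* a :* b :+ c :* s := c :* (a :* b :+ s)) ≈-refl
      c (f 0) (g (suc n)) (((f ∘ suc) ⋆ g) n))

  ⋆-scaleʳ : ∀ c f g n → (f ⋆ (λ j → c * g j)) n ≈ c * (f ⋆ g) n
  ⋆-scaleʳ c f g zero    = solve 3 (λ c a b → a :* (c :* b) := c :* (a :* b)) ≈-refl c (f 0) (g 0)
  ⋆-scaleʳ c f g (suc n) = ≈-trans (+-congˡ (⋆-scaleʳ c (f ∘ suc) g n))
    (solve 4 (λ c a b s → a :* (c :* b) :+ c :* s := c :* (a :* b :+ s)) ≈-refl
      c (f 0) (g (suc n)) (((f ∘ suc) ⋆ g) n))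

  ι : Sequence
  ι zero    = 0#
  ι (suc n) = 1# + ι n

  -- The formal derivative of the power series with coefficients f.
  D : Sequence → Sequence
  D f n = ι (suc n) * f (suc n)

  -- The induction writes the first series as `f 0` plus x times the shifted series f′, and applies
  -- the product rule to f′ and g.
  leibniz : ∀ f g n → D (f ⋆ g) n ≈ (D f ⋆ g) n + (f ⋆ D g) n
  leibniz f g zero = solve 4 (λ a b c d →
      (con 1 :+ con 0) :* (a :* d :+ b :* c) :=
      (con 1 :+ con 0) :* b :* c :+ a :* ((con 1 :+ con 0) :* d)) ≈-refl
    (f 0) (f 1) (g 0) (g 1)
  leibniz f g (suc n) = begin
    (1# + ι (suc n)) * (f 0 * g (suc (suc n)) + (f′ ⋆ g) (suc n))
      ≈⟨ solve 4 (λ k a b s → (con 1 :+ k) :* (a :* b :+ s) := (a :* ((con 1 :+ k) :* b) :+ s) :+ k :* s)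
           ≈-refl (ι (suc n)) (f 0) (g (suc (suc n))) ((f′ ⋆ g) (suc n)) ⟩
    (f 0 * D g (suc n) + (f′ ⋆ g) (suc n)) + D (f′ ⋆ g) n
      ≈⟨ +-congˡ (leibniz f′ g n) ⟩
    (f 0 * D g (suc n) + (f 1 * g (suc n) + (f″ ⋆ g) n)) + ((D f′ ⋆ g) n + (f′ ⋆ D g) n)
      ≈⟨ solve 5 (λ a b e s t → ((a :+ (b :+ e)) :+ (s :+ t)) := ((con 1 :+ con 0) :* b :+ (e :+ s)) :+ (a :+ t))
           ≈-refl (f 0 * D g (suc n)) (f 1 * g (suc n)) ((f″ ⋆ g) n) ((D f′ ⋆ g) n) ((f′ ⋆ D g) n) ⟩
    ((1# + 0#) * (f 1 * g (suc n)) + ((f″ ⋆ g) n + (D f′ ⋆ g) n)) + (f 0 * D g (suc n) + (f′ ⋆ D g) n)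
      -- The weight n + 2 in the shift of `D f` splits as 1 + (n + 1), so this shift is f″ + `D f′`.
      ≈⟨ +-congʳ (+-cong (≈-sym (*-assoc _ _ _)) (≈-sym (≈-trans
           (⋆-cong (λ j → solve 2 (λ k a → (con 1 :+ k) :* a := a :+ k :* a) ≈-refl (ι (suc j)) (f (suc (suc j))))
                   (λ _ → ≈-refl) n)
           (⋆-distribʳ f″ (D f′) g n)))) ⟩
    (D f 0 * g (suc n) + ((D f ∘ suc) ⋆ g) n) + (f 0 * D g (suc n) + (f′ ⋆ D g) n) ∎
    where
    f′ f″ : Sequence
    f′ = f ∘ suc
    f″ = f′ ∘ suc

  -- The coefficients of exp (a x), described by the initial value problem y(0) = 1, y′ = a y. The
  -- product rule then handles products without binomial coefficients.
  record Exponential (a : Carrier) (f : Sequence) : Set where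
    constructor _,_
    field
      value      : f 0 ≈ 1#
      derivative : ∀ n → D f n ≈ a * f n

  open Exponential public

  ⋆-exponential : ∀ {a b f g} → Exponential a f → Exponential b g → Exponential (a + b) (f ⋆ g)
  ⋆-exponential {a} {b} {f} {g} (f₀ , f′) (g₀ , g′) =
    ≈-trans (*-cong f₀ g₀) (*-identityˡ 1#) , λ n → begin
      D (f ⋆ g) n                                          ≈⟨ leibniz f g n ⟩
      (D f ⋆ g) n + (f ⋆ D g) n
        ≈⟨ +-cong (⋆-cong f′ (λ _ → ≈-refl) n) (⋆-cong (λ _ → ≈-refl) g′ n) ⟩
      ((λ j → a * f j) ⋆ g) n + (f ⋆ (λ j → b * g j)) n
        ≈⟨ +-cong (⋆-scaleˡ a f g n) (⋆-scaleʳ b f g n) ⟩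
      a * (f ⋆ g) n + b * (f ⋆ g) n                        ≈⟨ distribʳ _ a b ⟨
      (a + b) * (f ⋆ g) n                                  ∎

  -- The differential equation determines `f (suc n)` from `f n` as soon as n + 1 is invertible.
  exponential-unique : (∀ n → ∃ λ r → r * ι (suc n) ≈ 1#) →
                       ∀ {a f g} → Exponential a f → Exponential a g → ∀ n → f n ≈ g n
  exponential-unique inv (f₀ , f′) (g₀ , g′) zero = ≈-trans f₀ (≈-sym g₀)
  exponential-unique inv {a} {f} {g} F@(f₀ , f′) G@(g₀ , g′) (suc n) with inv n
  ... | r , rι≈1 = begin
    f (suc n)                    ≈⟨ cancel (f (suc n)) ⟨
    r * (ι (suc n) * f (suc n))  ≈⟨ *-congˡ (≈-trans (f′ n) (≈-trans (*-congˡ (exponential-unique inv F G n)) (≈-sym (g′ n)))) ⟩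
    r * (ι (suc n) * g (suc n))  ≈⟨ cancel (g (suc n)) ⟩
    g (suc n)                    ∎
    where
    cancel : ∀ x → r * (ι (suc n) * x) ≈ x
    cancel x = ≈-trans (≈-sym (*-assoc r _ x)) (≈-trans (*-congʳ rι≈1) (*-identityˡ x))

  Σ-cong : ∀ {f g} → (∀ n → f n ≈ g n) → ∀ n → Σ f n ≈ Σ g n
  Σ-cong p zero    = ≈-refl
  Σ-cong p (suc n) = +-cong (Σ-cong p n) (p n)

open import Defs

-- Real and complex equality

-- Record versions of the equalities, whose arguments Agda can infer.
infix 4 _≐_ _∼_ _≋_

record _≐_ (z w : ℂ) : Set where
  constructor mk≐
  field
    re≡ : ∀ k → seq (re z) k ≡ seq (re w) k
    im≡ : ∀ k → seq (im z) k ≡ seq (im w) k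

record _∼_ (x y : ℝ) : Set where
  constructor ⌈_⌉
  field
    ⌊_⌋ : x ≈ᴿ y

record _≋_ (z w : ℂ) : Set where
  constructor mk≋
  field
    re∼ : re z ∼ re w
    im∼ : im z ∼ im w

open _≐_ public
open _∼_ public
open _≋_ public

≋⇒≈ : ∀ {z w} → z ≋ w → z ≈ w
≋⇒≈ p = ⌊ re∼ p ⌋ , ⌊ im∼ p ⌋

≈⇒≋ : ∀ {z w} → z ≈ w → z ≋ w
≈⇒≋ (p , q) = mk≋ ⌈ p ⌉ ⌈ q ⌉

pointwise : ∀ {x y} → (∀ k → seq x k ≡ seq y k) → x ∼ y
pointwise {x} {y} h = ⌈ (λ ε 0<ε → 0 , λ n _ → subst (ℚ._≤ ε)
  (cong ∣_∣ (trans (sym (ℚP.+-inverseʳ (seq y n))) (cong (ℚ._- seq y n) (sym (h n)))))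
  (ℚP.<⇒≤ 0<ε)) ⌉

≐⇒≋ : ∀ {z w} → z ≐ w → z ≋ w
≐⇒≋ p = mk≋ (pointwise (re≡ p)) (pointwise (im≡ p))

-- Entrywise equality is finer than `≋`, but at each index it is an equation in ℚ. The ring laws are
-- therefore polynomial identities, the ring solver applies, and identities between partial sums
-- already hold at this level.
module Pointwise where
  open +-*-Solver

  isCommutativeRing : IsCommutativeRing _≐_ _+_ _*_ -_ 0ᶜ 1ᶜ
  isCommutativeRing = record
    { isRing = record
      { +-isAbelianGroup = record
        { isGroup = record
          { isMonoid = record
            { isSemigroup = record
              { isMagma = record
                { isEquivalence = record
                  { refl  = mk≐ (λ _ → refl) (λ _ → refl)
                  ; sym   = λ p → mk≐ (λ k → sym (re≡ p k)) (λ k → sym (im≡ p k))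
                  ; trans = λ p q → mk≐ (λ k → trans (re≡ p k) (re≡ q k)) (λ k → trans (im≡ p k) (im≡ q k))
                  }
                ; ∙-cong = λ p q → mk≐ (λ k → cong₂ ℚ._+_ (re≡ p k) (re≡ q k))
                                       (λ k → cong₂ ℚ._+_ (im≡ p k) (im≡ q k))
                }
              ; assoc = λ x y z → mk≐ (λ k → ℚP.+-assoc (seq (re x) k) (seq (re y) k) (seq (re z) k))
                                      (λ k → ℚP.+-assoc (seq (im x) k) (seq (im y) k) (seq (im z) k))
              }
            ; identity = (λ x → mk≐ (λ k → ℚP.+-identityˡ (seq (re x) k)) (λ k → ℚP.+-identityˡ (seq (im x) k)))
                       , (λ x → mk≐ (λ k → ℚP.+-identityʳ (seq (re x) k)) (λ k → ℚP.+-identityʳ (seq (im x) k)))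
            }
          ; inverse = (λ x → mk≐ (λ k → ℚP.+-inverseˡ (seq (re x) k)) (λ k → ℚP.+-inverseˡ (seq (im x) k)))
                    , (λ x → mk≐ (λ k → ℚP.+-inverseʳ (seq (re x) k)) (λ k → ℚP.+-inverseʳ (seq (im x) k)))
          ; ⁻¹-cong = λ p → mk≐ (λ k → cong ℚ.-_ (re≡ p k)) (λ k → cong ℚ.-_ (im≡ p k))
          }
        ; comm = λ x y → mk≐ (λ k → ℚP.+-comm (seq (re x) k) (seq (re y) k))
                             (λ k → ℚP.+-comm (seq (im x) k) (seq (im y) k))
        }
      ; *-cong = λ p q → mk≐
          (λ k → cong₂ ℚ._-_ (cong₂ ℚ._*_ (re≡ p k) (re≡ q k)) (cong₂ ℚ._*_ (im≡ p k) (im≡ q k)))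
          (λ k → cong₂ ℚ._+_ (cong₂ ℚ._*_ (re≡ p k) (im≡ q k)) (cong₂ ℚ._*_ (im≡ p k) (re≡ q k)))
      ; *-assoc = λ x y z → mk≐
          (λ k → solve 6 (λ a b c d e f →
             (a :* c :- b :* d) :* e :- (a :* d :+ b :* c) :* f :=
             a :* (c :* e :- d :* f) :- b :* (c :* f :+ d :* e)) refl
             (seq (re x) k) (seq (im x) k) (seq (re y) k) (seq (im y) k) (seq (re z) k) (seq (im z) k))
          (λ k → solve 6 (λ a b c d e f →
             (a :* c :- b :* d) :* f :+ (a :* d :+ b :* c) :* e :=
             a :* (c :* f :+ d :* e) :+ b :* (c :* e :- d :* f)) refl
             (seq (re x) k) (seq (im x) k) (seq (re y) k) (seq (im y) k) (seq (re z) k) (seq (im z) k))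
      ; *-identity = (λ x → mk≐
          (λ k → solve 2 (λ a b → con 1ℚ :* a :- con 0ℚ :* b := a) refl (seq (re x) k) (seq (im x) k))
          (λ k → solve 2 (λ a b → con 1ℚ :* b :+ con 0ℚ :* a := b) refl (seq (re x) k) (seq (im x) k)))
        , (λ x → mk≐
          (λ k → solve 2 (λ a b → a :* con 1ℚ :- b :* con 0ℚ := a) refl (seq (re x) k) (seq (im x) k))
          (λ k → solve 2 (λ a b → a :* con 0ℚ :+ b :* con 1ℚ := b) refl (seq (re x) k) (seq (im x) k)))
      ; distrib = (λ x y z → mk≐
          (λ k → solve 6 (λ a b c d e f →
             a :* (c :+ e) :- b :* (d :+ f) := (a :* c :- b :* d) :+ (a :* e :- b :* f)) refl
             (seq (re x) k) (seq (im x) k) (seq (re y) k) (seq (im y) k) (seq (re z) k) (seq (im z) k))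
          (λ k → solve 6 (λ a b c d e f →
             a :* (d :+ f) :+ b :* (c :+ e) := (a :* d :+ b :* c) :+ (a :* f :+ b :* e)) refl
             (seq (re x) k) (seq (im x) k) (seq (re y) k) (seq (im y) k) (seq (re z) k) (seq (im z) k)))
        , (λ x y z → mk≐
          (λ k → solve 6 (λ a b c d e f →
             (c :+ e) :* a :- (d :+ f) :* b := (c :* a :- d :* b) :+ (e :* a :- f :* b)) refl
             (seq (re x) k) (seq (im x) k) (seq (re y) k) (seq (im y) k) (seq (re z) k) (seq (im z) k))
          (λ k → solve 6 (λ a b c d e f →
             (c :+ e) :* b :+ (d :+ f) :* a := (c :* b :+ d :* a) :+ (e :* b :+ f :* a)) refl
             (seq (re x) k) (seq (im x) k) (seq (re y) k) (seq (im y) k) (seq (re z) k) (seq (im z) k)))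
      }
    ; *-comm = λ x y → mk≐
        (λ k → solve 4 (λ a b c d → a :* c :- b :* d := c :* a :- d :* b) refl
           (seq (re x) k) (seq (im x) k) (seq (re y) k) (seq (im y) k))
        (λ k → solve 4 (λ a b c d → a :* d :+ b :* c := c :* b :+ d :* a) refl
           (seq (re x) k) (seq (im x) k) (seq (re y) k) (seq (im y) k))
    }

  commutativeRing : CommutativeRing 0ℓ 0ℓ
  commutativeRing = record { isCommutativeRing = isCommutativeRing }

  open CommutativeRing commutativeRing public using (setoid)
    renaming (refl to ≐-refl; sym to ≐-sym; trans to ≐-trans; +-cong to +-cong; *-cong to *-cong)

open Pointwise public using (≐-refl; ≐-sym; ≐-trans)

module ℂ-Solver where

  scalar : ℚ → ℂ
  scalar q = fromℝ (fromℚ q)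

  private
    open +-*-Solver using (solve; con; _:*_; _:+_; _:-_; _:=_)

    target = ACR.fromCommutativeRing Pointwise.commutativeRing

    homo : CommutativeRing.rawRing ℚP.+-*-commutativeRing ACR.-Raw-AlmostCommutative⟶ target
    homo = record
      { ⟦_⟧    = scalar
      ; +-homo = λ p q → mk≐ (λ _ → refl) (λ _ → refl)
      ; *-homo = λ p q → mk≐
          (λ _ → solve 2 (λ p q → p :* q := p :* q :- con 0ℚ :* con 0ℚ) refl p q)
          (λ _ → solve 2 (λ p q → con 0ℚ := p :* con 0ℚ :+ con 0ℚ :* q) refl p q)
      ; -‿homo = λ p → mk≐ (λ _ → refl) (λ _ → refl)
      ; 0-homo = ≐-refl
      ; 1-homo = ≐-refl
      }

    scalar-≟ : ∀ p q → Maybe (scalar p ≐ scalar q)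
    scalar-≟ p q with p ℚP.≟ q
    ... | yes refl = just ≐-refl
    ... | no _     = nothing

  open Algebra.Solver.Ring _ target homo scalar-≟ public

open ℂ-Solver public using (scalar)

-- The addition theorem of the exponential

module Cℚ = Convolution (CommutativeRing.commutativeSemiring ℚP.+-*-commutativeRing)
module Cℂ = Convolution (CommutativeRing.commutativeSemiring Pointwise.commutativeRing)

fromℕ-suc : ∀ n → fromℕ (suc n) ≡ 1ℚ ℚ.+ fromℕ n
fromℕ-suc n = ℚP.toℚᵘ-injective (begin
  ℚ.toℚᵘ (fromℕ (suc n))              ≈⟨ ℚP.toℚᵘ-fromℚᵘ (ℚᵘ.mkℚᵘ (+ suc n) 0) ⟩
  ℚᵘ.mkℚᵘ (+ suc n) 0                 ≈⟨ ℚᵘ.*≡* (cong (λ m → (+ 1 ℤ.+ m) ℤ.* + 1) (sym (ℤP.*-identityʳ (+ n)))) ⟩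
  ℚᵘ.1ℚᵘ ℚᵘ.+ ℚᵘ.mkℚᵘ (+ n) 0         ≈⟨ ℚᵘP.+-congʳ ℚᵘ.1ℚᵘ (ℚP.toℚᵘ-fromℚᵘ (ℚᵘ.mkℚᵘ (+ n) 0)) ⟨
  ℚ.toℚᵘ 1ℚ ℚᵘ.+ ℚ.toℚᵘ (fromℕ n)     ≈⟨ ℚP.toℚᵘ-homo-+ 1ℚ (fromℕ n) ⟨
  ℚ.toℚᵘ (1ℚ ℚ.+ fromℕ n)             ∎)
  where open ℚᵘP.≃-Reasoning

ι≡fromℕ : ∀ n → Cℚ.ι n ≡ fromℕ n
ι≡fromℕ zero    = refl
ι≡fromℕ (suc n) = trans (cong (1ℚ ℚ.+_) (ι≡fromℕ n)) (sym (fromℕ-suc n))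

ι-suc*1/suc : ∀ n → Cℚ.ι (suc n) ℚ.* 1/suc n ≡ 1ℚ
ι-suc*1/suc n = trans (cong (ℚ._* 1/suc n) (ι≡fromℕ (suc n))) (suc*1/suc n)

ι-scalar : ∀ n → Cℂ.ι n ≐ scalar (Cℚ.ι n)
ι-scalar zero    = ≐-refl
ι-scalar (suc n) = mk≐ (λ k → cong (1ℚ ℚ.+_) (re≡ (ι-scalar n) k))
                       (λ k → cong (0ℚ ℚ.+_) (im≡ (ι-scalar n) k))

scalar-* : ∀ p q → scalar (p ℚ.* q) ≐ scalar p * scalar q
scalar-* p q = mk≐
  (λ _ → solve 2 (λ p q → p :* q := p :* q :- con 0ℚ :* con 0ℚ) refl p q)
  (λ _ → solve 2 (λ p q → con 0ℚ := p :* con 0ℚ :+ con 0ℚ :* q) refl p q)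
  where open +-*-Solver

expTerm-exponential : ∀ z → Cℂ.Exponential z (expTerm z)
expTerm-exponential z = ℂ-Solver.solve 0 (con 1ℚ :* con 1ℚ := con 1ℚ) ≐-refl Cℂ., λ n → begin
    Cℂ.ι (suc n) * (scalar (1/ suc n !) * (z * z ^ n))
      ≈⟨ *-congʳ (ι-scalar (suc n)) ⟩
    scalar (Cℚ.ι (suc n)) * (scalar (1/ suc n !) * (z * z ^ n))
      ≈⟨ ℂ-Solver.solve 4 (λ a b z y → a :* (b :* (z :* y)) := z :* ((a :* b) :* y)) ≐-refl
           (scalar (Cℚ.ι (suc n))) (scalar (1/ suc n !)) z (z ^ n) ⟩
    z * ((scalar (Cℚ.ι (suc n)) * scalar (1/ suc n !)) * z ^ n)
      ≈⟨ *-congˡ (*-congʳ (scalar-* (Cℚ.ι (suc n)) (1/ suc n !))) ⟨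
    z * (scalar (Cℚ.ι (suc n) ℚ.* (1/ suc n !)) * z ^ n)
      ≡⟨ cong (λ q → z * (scalar q * z ^ n)) (coefficient n) ⟩
    z * expTerm z n ∎
  where
  open CommutativeRing Pointwise.commutativeRing using (setoid; *-congˡ; *-congʳ)
  open import Relation.Binary.Reasoning.Setoid setoid
  open ℂ-Solver using (con; _:*_; _:=_)
  coefficient : ∀ n → Cℚ.ι (suc n) ℚ.* (1/ suc n !) ≡ 1/ n !
  coefficient n = trans (cong (Cℚ.ι (suc n) ℚ.*_) (1/!-suc n))
    (trans (sym (ℚP.*-assoc (Cℚ.ι (suc n)) (1/suc n) (1/ n !)))
      (trans (cong (ℚ._* (1/ n !)) (ι-suc*1/suc n)) (ℚP.*-identityˡ (1/ n !))))

expSum≐Σ : ∀ z n → expSum z n ≐ Cℂ.Σ (expTerm z) n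
expSum≐Σ z zero    = ≐-refl
expSum≐Σ z (suc n) = Pointwise.+-cong (expSum≐Σ z n) (≐-refl {expTerm z n})

ℚ-inverse : ∀ n → ∃ λ r → r ℚ.* Cℚ.ι (suc n) ≡ 1ℚ
ℚ-inverse n = 1/suc n , trans (ℚP.*-comm (1/suc n) (Cℚ.ι (suc n))) (ι-suc*1/suc n)

ℂ-inverse : ∀ n → ∃ λ r → r * Cℂ.ι (suc n) ≐ 1ᶜ
ℂ-inverse n = scalar (1/suc n) , ≐-trans (Pointwise.*-cong (≐-refl {scalar (1/suc n)}) (ι-scalar (suc n)))
  (≐-trans (≐-sym (scalar-* (1/suc n) (Cℚ.ι (suc n))))
    (mk≐ (λ _ → proj₂ (ℚ-inverse n)) (λ _ → refl)))

-- The binomial theorem divided by n!: both sides solve the initial value problem with rate a + b.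
expTerm-+ : ∀ a b n → expTerm (a + b) n ≐ (expTerm a Cℂ.⋆ expTerm b) n
expTerm-+ a b = Cℂ.exponential-unique ℂ-inverse (expTerm-exponential (a + b))
  (Cℂ.⋆-exponential (expTerm-exponential a) (expTerm-exponential b))

-- Identifies a rational exponential sequence with the entries of `expTerm`, so that the tail
-- estimate for `expSum` also covers the majorants.
expTerm-scalar : ∀ q k → Cℚ.Exponential q (λ n → seq (re (expTerm (scalar q) n)) k)
expTerm-scalar q k = re≡ (Cℂ.value (expTerm-exponential (scalar q))) k Cℚ., λ n →
  let t = expTerm (scalar q) n
      t′ = expTerm (scalar q) (suc n)
  in begin
  Cℚ.ι (suc n) ℚ.* seq (re t′) k
    ≡⟨ solve 3 (λ i a b → i :* a := i :* a :- con 0ℚ :* b) refl (Cℚ.ι (suc n)) (seq (re t′) k) (seq (im t′) k) ⟩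
  seq (re (scalar (Cℚ.ι (suc n)) * t′)) k
    ≡⟨ re≡ (Pointwise.*-cong (ι-scalar (suc n)) (≐-refl {t′})) k ⟨
  seq (re (Cℂ.ι (suc n) * t′)) k
    ≡⟨ re≡ (Cℂ.derivative (expTerm-exponential (scalar q)) n) k ⟩
  seq (re (scalar q * t)) k
    ≡⟨ solve 3 (λ i a b → i :* a :- con 0ℚ :* b := i :* a) refl q (seq (re t) k) (seq (im t) k) ⟩
  q ℚ.* seq (re t) k ∎
  where
  open +-*-Solver
  open Relation.Binary.PropositionalEquality.≡-Reasoning

opaque
  unfolding ExpTail.e

  e-exponential : ∀ z M 0≤M N₀ h → Cℚ.Exponential M (ExpTail.e z M 0≤M N₀ h)
  e-exponential z M 0≤M N₀ h = refl Cℚ., λ n →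
    trans (cong (Cℚ.ι (suc n) ℚ.*_) (ExpTail.e-suc z M 0≤M N₀ h n))
      (trans (solve 4 (λ i x m u → i :* (x :* (m :* u)) := (i :* u) :* (m :* x)) refl
               (Cℚ.ι (suc n)) (ExpTail.e z M 0≤M N₀ h n) M (1/suc n))
        (trans (cong (ℚ._* (M ℚ.* ExpTail.e z M 0≤M N₀ h n)) (ι-suc*1/suc n))
          (ℚP.*-identityˡ (M ℚ.* ExpTail.e z M 0≤M N₀ h n))))
    where open +-*-Solver

-- The error of the Cauchy product

norm-+ : ∀ k z w → norm k (z + w) ℚ.≤ norm k z ℚ.+ norm k w
norm-+ k z w = ℚP.≤-trans
  (ℚP.+-mono-≤ (ℚP.∣p+q∣≤∣p∣+∣q∣ (seq (re z) k) (seq (re w) k)) (ℚP.∣p+q∣≤∣p∣+∣q∣ (seq (im z) k) (seq (im w) k)))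
  (ℚP.≤-reflexive (solve 4 (λ a b c d → (a :+ b) :+ (c :+ d) := (a :+ c) :+ (b :+ d)) refl
    (∣ seq (re z) k ∣) (∣ seq (re w) k ∣) (∣ seq (im z) k ∣) (∣ seq (im w) k ∣)))
  where open +-*-Solver

norm-cong : ∀ k {z w} → z ≐ w → norm k z ≡ norm k w
norm-cong k p = cong₂ (λ a b → ∣ a ∣ ℚ.+ ∣ b ∣) (re≡ p k) (im≡ p k)

module Domination (k : ℕ) where

  open ℚP.≤-Reasoning
  open +-*-Solver

  Dominated : (ℕ → ℂ) → (ℕ → ℚ) → Set
  Dominated f F = ∀ n → norm k (f n) ℚ.≤ F n

  norm-Σ-Σ : ∀ {g G} → Dominated g G → ∀ {i m} → i ℕ.≤′ m →
             norm k (Cℂ.Σ g m - Cℂ.Σ g i) ℚ.≤ Cℚ.Σ G m ℚ.- Cℚ.Σ G i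
  norm-Σ-Σ {g} {G} g≤G {i} ℕ.≤′-refl = ℚP.≤-reflexive (trans
    (norm-cong k (ℂ-Solver.solve 1 (λ x → x ℂ-Solver.:- x ℂ-Solver.:= ℂ-Solver.con 0ℚ) ≐-refl (Cℂ.Σ g i)))
    (sym (ℚP.+-inverseʳ (Cℚ.Σ G i))))
  norm-Σ-Σ {g} {G} g≤G {i} (ℕ.≤′-step {n = m} i≤m) = begin
    norm k ((Cℂ.Σ g m + g m) - Cℂ.Σ g i)
      ≡⟨ norm-cong k (ℂ-Solver.solve 3 (λ x t y → (x ℂ-Solver.:+ t) ℂ-Solver.:- y ℂ-Solver.:= (x ℂ-Solver.:- y) ℂ-Solver.:+ t) ≐-refl
           (Cℂ.Σ g m) (g m) (Cℂ.Σ g i)) ⟩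
    norm k ((Cℂ.Σ g m - Cℂ.Σ g i) + g m)
      ≤⟨ norm-+ k (Cℂ.Σ g m - Cℂ.Σ g i) (g m) ⟩
    norm k (Cℂ.Σ g m - Cℂ.Σ g i) ℚ.+ norm k (g m)
      ≤⟨ ℚP.+-mono-≤ (norm-Σ-Σ g≤G i≤m) (g≤G m) ⟩
    (Cℚ.Σ G m ℚ.- Cℚ.Σ G i) ℚ.+ G m
      ≡⟨ solve 3 (λ x t y → (x :- y) :+ t := (x :+ t) :- y) refl (Cℚ.Σ G m) (G m) (Cℚ.Σ G i) ⟩
    (Cℚ.Σ G m ℚ.+ G m) ℚ.- Cℚ.Σ G i ∎

  -- The difference is the sum of f i · g j over i < n, j < m with i + j ≥ n, and each of its terms
  -- is dominated by F i · G j. Removing the first term of f lowers n but not m, which is why the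
  -- two bounds are separate.
  product-error : ∀ {f F g G} → Dominated f F → Dominated g G → ∀ n m → n ℕ.≤ m →
    norm k (Cℂ.Σ f n * Cℂ.Σ g m - Cℂ.Σ (f Cℂ.⋆ g) n) ℚ.≤ Cℚ.Σ F n ℚ.* Cℚ.Σ G m ℚ.- Cℚ.Σ (F Cℚ.⋆ G) n
  product-error {f} {F} {g} {G} f≤F g≤G zero m _ = ℚP.≤-reflexive (trans
    (norm-cong k (ℂ-Solver.solve 1 (λ x → ℂ-Solver.con 0ℚ ℂ-Solver.:* x ℂ-Solver.:- ℂ-Solver.con 0ℚ
                                          ℂ-Solver.:= ℂ-Solver.con 0ℚ) ≐-refl (Cℂ.Σ g m)))
    (solve 1 (λ x → con 0ℚ := con 0ℚ :* x :- con 0ℚ) refl (Cℚ.Σ G m)))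
  product-error {f} {F} {g} {G} f≤F g≤G (suc n) m n<m = begin
    norm k (Cℂ.Σ f (suc n) * Cℂ.Σ g m - Cℂ.Σ (f Cℂ.⋆ g) (suc n))
      ≡⟨ norm-cong k (+-cong (*-cong (Cℂ.Σ-head f n) (≐-refl {Cℂ.Σ g m})) (-‿cong (Cℂ.Σ-⋆ f g n))) ⟩
    norm k ((f 0 + Cℂ.Σ f′ n) * Cℂ.Σ g m - (f 0 * Cℂ.Σ g (suc n) + Cℂ.Σ (f′ Cℂ.⋆ g) n))
      ≡⟨ norm-cong k (ℂ-Solver.solve 5 (λ a s t u v →
           ((a ℂ-Solver.:+ s) ℂ-Solver.:* t) ℂ-Solver.:- ((a ℂ-Solver.:* u) ℂ-Solver.:+ v) ℂ-Solver.:=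
           (a ℂ-Solver.:* (t ℂ-Solver.:- u)) ℂ-Solver.:+ ((s ℂ-Solver.:* t) ℂ-Solver.:- v)) ≐-refl
           (f 0) (Cℂ.Σ f′ n) (Cℂ.Σ g m) (Cℂ.Σ g (suc n)) (Cℂ.Σ (f′ Cℂ.⋆ g) n)) ⟩
    norm k (f 0 * (Cℂ.Σ g m - Cℂ.Σ g (suc n)) + (Cℂ.Σ f′ n * Cℂ.Σ g m - Cℂ.Σ (f′ Cℂ.⋆ g) n))
      ≤⟨ norm-+ k (f 0 * (Cℂ.Σ g m - Cℂ.Σ g (suc n))) (Cℂ.Σ f′ n * Cℂ.Σ g m - Cℂ.Σ (f′ Cℂ.⋆ g) n) ⟩
    norm k (f 0 * (Cℂ.Σ g m - Cℂ.Σ g (suc n))) ℚ.+ norm k (Cℂ.Σ f′ n * Cℂ.Σ g m - Cℂ.Σ (f′ Cℂ.⋆ g) n)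
      ≤⟨ ℚP.+-mono-≤ head (product-error (f≤F ∘ suc) g≤G n m (ℕP.<⇒≤ n<m)) ⟩
    F 0 ℚ.* (Cℚ.Σ G m ℚ.- Cℚ.Σ G (suc n)) ℚ.+ (Cℚ.Σ F′ n ℚ.* Cℚ.Σ G m ℚ.- Cℚ.Σ (F′ Cℚ.⋆ G) n)
      ≡⟨ solve 5 (λ a s t u v → (a :* (t :- u)) :+ ((s :* t) :- v) := ((a :+ s) :* t) :- ((a :* u) :+ v)) refl
           (F 0) (Cℚ.Σ F′ n) (Cℚ.Σ G m) (Cℚ.Σ G (suc n)) (Cℚ.Σ (F′ Cℚ.⋆ G) n) ⟩
    (F 0 ℚ.+ Cℚ.Σ F′ n) ℚ.* Cℚ.Σ G m ℚ.- (F 0 ℚ.* Cℚ.Σ G (suc n) ℚ.+ Cℚ.Σ (F′ Cℚ.⋆ G) n)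
      ≡⟨ cong₂ (λ x y → x ℚ.* Cℚ.Σ G m ℚ.- y) (Cℚ.Σ-head F n) (Cℚ.Σ-⋆ F G n) ⟨
    Cℚ.Σ F (suc n) ℚ.* Cℚ.Σ G m ℚ.- Cℚ.Σ (F Cℚ.⋆ G) (suc n) ∎
    where
    open CommutativeRing Pointwise.commutativeRing using (+-cong; *-cong; -‿cong)
    f′ = f ∘ suc
    F′ = F ∘ suc
    head : norm k (f 0 * (Cℂ.Σ g m - Cℂ.Σ g (suc n))) ℚ.≤ F 0 ℚ.* (Cℚ.Σ G m ℚ.- Cℚ.Σ G (suc n))
    head = begin
      norm k (f 0 * (Cℂ.Σ g m - Cℂ.Σ g (suc n)))
        ≤⟨ norm-* k (f 0) (Cℂ.Σ g m - Cℂ.Σ g (suc n)) ⟩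
      norm k (f 0) ℚ.* norm k (Cℂ.Σ g m - Cℂ.Σ g (suc n))
        ≤⟨ *-mono-≤ʳ (norm k (Cℂ.Σ g m - Cℂ.Σ g (suc n))) (0≤norm k (Cℂ.Σ g m - Cℂ.Σ g (suc n))) (f≤F 0) ⟩
      F 0 ℚ.* norm k (Cℂ.Σ g m - Cℂ.Σ g (suc n))
        ≤⟨ *-mono-≤ˡ (F 0) (ℚP.≤-trans (0≤norm k (f 0)) (f≤F 0)) (norm-Σ-Σ g≤G (ℕP.≤⇒≤′ n<m)) ⟩
      F 0 ℚ.* (Cℚ.Σ G m ℚ.- Cℚ.Σ G (suc n)) ∎

module NonNegative where

  open ℚP.≤-Reasoning

  0≤Σ : ∀ {G} → (∀ n → 0ℚ ℚ.≤ G n) → ∀ n → 0ℚ ℚ.≤ Cℚ.Σ G n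
  0≤Σ 0≤G zero    = ℚP.≤-refl
  0≤Σ 0≤G (suc n) = +-nonNeg (0≤Σ 0≤G n) (0≤G n)

  Σ-mono : ∀ {G} → (∀ n → 0ℚ ℚ.≤ G n) → ∀ {m n} → m ℕ.≤′ n → Cℚ.Σ G m ℚ.≤ Cℚ.Σ G n
  Σ-mono 0≤G ℕ.≤′-refl = ℚP.≤-refl
  Σ-mono {G} 0≤G {m} (ℕ.≤′-step {n = n} p) = begin
    Cℚ.Σ G m            ≤⟨ Σ-mono 0≤G p ⟩
    Cℚ.Σ G n            ≡⟨ ℚP.+-identityʳ (Cℚ.Σ G n) ⟨
    Cℚ.Σ G n ℚ.+ 0ℚ     ≤⟨ ℚP.+-monoʳ-≤ (Cℚ.Σ G n) (0≤G n) ⟩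
    Cℚ.Σ G n ℚ.+ G n    ∎

  0≤⋆ : ∀ {F G} → (∀ n → 0ℚ ℚ.≤ F n) → (∀ n → 0ℚ ℚ.≤ G n) → ∀ n → 0ℚ ℚ.≤ (F Cℚ.⋆ G) n
  0≤⋆ 0≤F 0≤G zero    = *-nonNeg (0≤F 0) (0≤G 0)
  0≤⋆ 0≤F 0≤G (suc n) = +-nonNeg (*-nonNeg (0≤F 0) (0≤G (suc n))) (0≤⋆ (0≤F ∘ suc) 0≤G n)

  -- The rectangle i < n, j < m lies in the triangle i + j < n + m, and all terms are nonnegative.
  product≤Σ-⋆ : ∀ {F G} → (∀ n → 0ℚ ℚ.≤ F n) → (∀ n → 0ℚ ℚ.≤ G n) → ∀ n m →
                Cℚ.Σ F n ℚ.* Cℚ.Σ G m ℚ.≤ Cℚ.Σ (F Cℚ.⋆ G) (n ℕ.+ m)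
  product≤Σ-⋆ {F} {G} 0≤F 0≤G zero m = ℚP.≤-trans (ℚP.≤-reflexive (ℚP.*-zeroˡ (Cℚ.Σ G m))) (0≤Σ (0≤⋆ 0≤F 0≤G) m)
  product≤Σ-⋆ {F} {G} 0≤F 0≤G (suc n) m = begin
    Cℚ.Σ F (suc n) ℚ.* Cℚ.Σ G m
      ≡⟨ trans (cong (ℚ._* Cℚ.Σ G m) (Cℚ.Σ-head F n)) (ℚP.*-distribʳ-+ (Cℚ.Σ G m) (F 0) (Cℚ.Σ (F ∘ suc) n)) ⟩
    F 0 ℚ.* Cℚ.Σ G m ℚ.+ Cℚ.Σ (F ∘ suc) n ℚ.* Cℚ.Σ G m
      ≤⟨ ℚP.+-mono-≤ (*-mono-≤ˡ (F 0) (0≤F 0) (Σ-mono 0≤G (ℕP.≤⇒≤′ (ℕP.m≤n+m m (suc n)))))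
                     (product≤Σ-⋆ (0≤F ∘ suc) 0≤G n m) ⟩
    F 0 ℚ.* Cℚ.Σ G (suc n ℕ.+ m) ℚ.+ Cℚ.Σ ((F ∘ suc) Cℚ.⋆ G) (n ℕ.+ m)
      ≡⟨ Cℚ.Σ-⋆ F G (n ℕ.+ m) ⟨
    Cℚ.Σ (F Cℚ.⋆ G) (suc n ℕ.+ m) ∎

∣re∣≤norm : ∀ k z → ∣ seq (re z) k ∣ ℚ.≤ norm k z
∣re∣≤norm k z = ℚP.≤-trans (ℚP.≤-reflexive (sym (ℚP.+-identityʳ (∣ seq (re z) k ∣)))) (ℚP.+-monoʳ-≤ (∣ seq (re z) k ∣) (ℚP.0≤∣p∣ (seq (im z) k)))

∣im∣≤norm : ∀ k z → ∣ seq (im z) k ∣ ℚ.≤ norm k z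
∣im∣≤norm k z = ℚP.≤-trans (ℚP.≤-reflexive (sym (ℚP.+-identityˡ (∣ seq (im z) k ∣)))) (ℚP.+-monoˡ-≤ (∣ seq (im z) k ∣) (ℚP.0≤∣p∣ (seq (re z) k)))

norm-bounded : ∀ z → ∃ λ B → 0ℚ ℚ.≤ B × ∃ λ N → ∀ k → N ℕ.≤ k → norm k z ℚ.≤ B
norm-bounded z =
  let A , 0≤A , N , a = bounded (re z)
      B , 0≤B , M , b = bounded (im z)
  in A ℚ.+ B , +-nonNeg 0≤A 0≤B , N ⊔ M , λ k p →
       ℚP.+-mono-≤ (a k (ℕP.m⊔n≤o⇒m≤o N M p)) (b k (ℕP.m⊔n≤o⇒n≤o N M p))

-- The terms of both series are dominated by Mⁿ/n!, whose convolution square is (2M)ⁿ/n!. The error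
-- is thus at most the sum of (2M)ⁿ/n! over k ≤ n < 2k, which `re-tail` makes small. The index k
-- counts both the summands and the entries of the Cauchy sequences.
exp-error : ∀ a b ε → 0ℚ ℚ.< ε → ∃ λ N → ∀ k → N ℕ.≤ k →
            norm k (expSum a k * expSum b k - expSum (a + b) k) ℚ.≤ ε
exp-error a b ε 0<ε =
  let A , 0≤A , Na , na = norm-bounded a
      B , 0≤B , Nb , nb = norm-bounded b
      M = A ℚ.+ B
      0≤M = +-nonNeg 0≤A 0≤B
      A≤M = ℚP.≤-trans (ℚP.≤-reflexive (sym (ℚP.+-identityʳ A))) (ℚP.+-monoʳ-≤ A 0≤B)
      B≤M = ℚP.≤-trans (ℚP.≤-reflexive (sym (ℚP.+-identityˡ B))) (ℚP.+-monoˡ-≤ B 0≤A)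
      na′ = λ k p → ℚP.≤-trans (na k p) A≤M
      nb′ = λ k p → ℚP.≤-trans (nb k p) B≤M
      module Ta = ExpTail a M 0≤M Na na′
      module Tb = ExpTail b M 0≤M Nb nb′
      F⋆G = Ta.e Cℚ.⋆ Tb.e
      δ , 0<δ , 2δ≤ε = shrink 2ℚ ε (ℚP.nonNegative⁻¹ 2ℚ) 0<ε
      N , tail = re-tail (scalar (M ℚ.+ M)) δ 0<δ
      S = λ n k → seq (re (expSum (scalar (M ℚ.+ M)) n)) k
      F⋆G≡S : ∀ n k → Cℚ.Σ F⋆G n ≡ S n k
      F⋆G≡S n k = trans
        (Cℚ.Σ-cong (Cℚ.exponential-unique ℚ-inverse
          (Cℚ.⋆-exponential (e-exponential a M 0≤M Na na′) (e-exponential b M 0≤M Nb nb′))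
          (expTerm-scalar (M ℚ.+ M) k)) n)
        (partial (M ℚ.+ M) k n)
  in (Na ⊔ Nb) ⊔ N , λ k p →
    let pa = ℕP.m⊔n≤o⇒m≤o Na Nb (ℕP.m⊔n≤o⇒m≤o (Na ⊔ Nb) N p)
        pb = ℕP.m⊔n≤o⇒n≤o Na Nb (ℕP.m⊔n≤o⇒m≤o (Na ⊔ Nb) N p)
        pN = ℕP.m⊔n≤o⇒n≤o (Na ⊔ Nb) N p
    in begin
    norm k (expSum a k * expSum b k - expSum (a + b) k)
      ≡⟨ norm-cong k (+-cong (*-cong (expSum≐Σ a k) (expSum≐Σ b k))
           (-‿cong (≐-trans (expSum≐Σ (a + b) k) (Cℂ.Σ-cong (expTerm-+ a b) k)))) ⟩
    norm k (Cℂ.Σ (expTerm a) k * Cℂ.Σ (expTerm b) k - Cℂ.Σ (expTerm a Cℂ.⋆ expTerm b) k)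
      ≤⟨ Domination.product-error k (Ta.norm-term k pa) (Tb.norm-term k pb) k k ℕP.≤-refl ⟩
    Cℚ.Σ Ta.e k ℚ.* Cℚ.Σ Tb.e k ℚ.- Cℚ.Σ F⋆G k
      ≤⟨ ℚP.+-monoˡ-≤ (ℚ.- Cℚ.Σ F⋆G k) (NonNegative.product≤Σ-⋆ Ta.0≤e Tb.0≤e k k) ⟩
    Cℚ.Σ F⋆G (k ℕ.+ k) ℚ.- Cℚ.Σ F⋆G k
      ≡⟨ cong₂ ℚ._-_ (F⋆G≡S (k ℕ.+ k) k) (F⋆G≡S k k) ⟩
    S (k ℕ.+ k) k ℚ.- S k k
      ≡⟨ solve 3 (λ x y z → x :- y := (:- (z :- x)) :+ (:- (y :- z))) refl (S (k ℕ.+ k) k) (S k k) (S N k) ⟩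
    ℚ.- (S N k ℚ.- S (k ℕ.+ k) k) ℚ.+ ℚ.- (S k k ℚ.- S N k)
      ≤⟨ ℚP.+-mono-≤
           (ℚP.≤-trans (-p≤∣p∣ (S N k ℚ.- S (k ℕ.+ k) k))
             (ℚP.≤-trans (ℚP.≤-reflexive (∣-∣-swap (S N k) (S (k ℕ.+ k) k)))
               (tail (k ℕ.+ k) k (ℕP.≤-trans pN (ℕP.m≤m+n k k)) pN)))
           (ℚP.≤-trans (-p≤∣p∣ (S k k ℚ.- S N k)) (tail k k pN pN)) ⟩
    δ ℚ.+ δ   ≡⟨ solve 1 (λ d → d :+ d := con 2ℚ :* d) refl δ ⟩
    2ℚ ℚ.* δ  ≤⟨ 2δ≤ε ⟩
    ε         ∎
  where
  open ℚP.≤-Reasoning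
  open +-*-Solver
  open CommutativeRing Pointwise.commutativeRing using (+-cong; *-cong; -‿cong)
  partial : ∀ q k n → Cℚ.Σ (λ n → seq (re (expTerm (scalar q) n)) k) n ≡ seq (re (expSum (scalar q) n)) k
  partial q k zero    = refl
  partial q k (suc n) = cong (ℚ._+ seq (re (expTerm (scalar q) n)) k) (partial q k n)

-- Entry k of `exp z` is by definition entry k of `expSum z k`, so the diagonal estimate `exp-error`
-- is exactly what equality demands.
exp-+ : ∀ a b → exp a * exp b ≋ exp (a + b)
exp-+ a b = mk≋
  ⌈ (λ ε 0<ε → let N , h = exp-error a b ε 0<ε in N , λ k p →
      ℚP.≤-trans (∣re∣≤norm k (expSum a k * expSum b k - expSum (a + b) k)) (h k p)) ⌉
  ⌈ (λ ε 0<ε → let N , h = exp-error a b ε 0<ε in N , λ k p →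
      ℚP.≤-trans (∣im∣≤norm k (expSum a k * expSum b k - expSum (a + b) k)) (h k p)) ⌉

-- Null sequences and roots of unity

-- The null sequences form an ideal; an equation between reals follows from
-- others once the difference of its sides is a combination of their differences.
record Null (s : ℕ → ℚ) : Set where
  constructor null
  field
    vanishes : ∀ ε → 0ℚ ℚ.< ε → ∃ λ N → ∀ n → N ℕ.≤ n → ∣ s n ∣ ℚ.≤ ε

open Null

infixr 6 _⊕_
infixr 7 _⊙_

_⊕_ : ∀ {s t} → Null s → Null t → Null (λ n → s n ℚ.+ t n)
_⊕_ {s} {t} p q = null λ ε 0<ε →
  let δ , 0<δ , 2δ≤ε = shrink 2ℚ ε (ℚP.nonNegative⁻¹ 2ℚ) 0<ε
      N , f = vanishes p δ 0<δ
      M , g = vanishes q δ 0<δ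
  in N ⊔ M , λ n N⊔M≤n → begin
    ∣ s n ℚ.+ t n ∣  ≤⟨ ∣-∣-triangle (s n) (t n) (f n (ℕP.m⊔n≤o⇒m≤o N M N⊔M≤n)) (g n (ℕP.m⊔n≤o⇒n≤o N M N⊔M≤n)) ⟩
    δ ℚ.+ δ          ≡⟨ solve 1 (λ d → d :+ d := con 2ℚ :* d) refl δ ⟩
    2ℚ ℚ.* δ         ≤⟨ 2δ≤ε ⟩
    ε                ∎
  where
  open ℚP.≤-Reasoning
  open +-*-Solver

_⊙_ : ∀ (c : ℝ) {s} → Null s → Null (λ n → seq c n ℚ.* s n)
_⊙_ c {s} p = null λ ε 0<ε →
  let B , 0≤B , N , f = bounded c
      δ , 0<δ , Bδ≤ε = shrink B ε 0≤B 0<ε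
      M , g = vanishes p δ 0<δ
  in N ⊔ M , λ n N⊔M≤n → ℚP.≤-trans
    (∣-∣-mono-* (seq c n) (s n) (f n (ℕP.m⊔n≤o⇒m≤o N M N⊔M≤n)) (g n (ℕP.m⊔n≤o⇒n≤o N M N⊔M≤n)))
    Bδ≤ε

difference : ∀ {x y} → x ∼ y → Null (λ n → seq x n ℚ.- seq y n)
difference p = null ⌊ p ⌋

by : ∀ {x y s} → Null s → (∀ n → seq x n ℚ.- seq y n ≡ s n) → x ∼ y
by p h = ⌈ (λ ε 0<ε → let N , f = vanishes p ε 0<ε in
  N , λ n N≤n → subst (ℚ._≤ ε) (cong ∣_∣ (sym (h n))) (f n N≤n)) ⌉

∼-refl : ∀ {x} → x ∼ x
∼-refl = pointwise (λ _ → refl)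

∼-sym : ∀ {x y} → x ∼ y → y ∼ x
∼-sym {x} {y} p = by ((-ᴿ 1ᴿ) ⊙ difference p)
  (λ n → solve 2 (λ x y → y :- x := con (ℚ.- 1ℚ) :* (x :- y)) refl (seq x n) (seq y n))
  where open +-*-Solver

∼-trans : ∀ {x y z} → x ∼ y → y ∼ z → x ∼ z
∼-trans {x} {y} {z} p q = by (difference p ⊕ difference q)
  (λ n → solve 3 (λ x y z → x :- z := (x :- y) :+ (y :- z)) refl (seq x n) (seq y n) (seq z n))
  where open +-*-Solver

+ᴿ-cong : ∀ {x x′ y y′} → x ∼ x′ → y ∼ y′ → x +ᴿ y ∼ x′ +ᴿ y′
+ᴿ-cong {x} {x′} {y} {y′} p q = by (difference p ⊕ difference q)
  (λ n → solve 4 (λ a b c d → (a :+ c) :- (b :+ d) := (a :- b) :+ (c :- d)) refl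
    (seq x n) (seq x′ n) (seq y n) (seq y′ n))
  where open +-*-Solver

-ᴿ-cong : ∀ {x x′} → x ∼ x′ → -ᴿ x ∼ -ᴿ x′
-ᴿ-cong {x} {x′} p = by ((-ᴿ 1ᴿ) ⊙ difference p)
  (λ n → solve 2 (λ a b → (:- a) :- (:- b) := con (ℚ.- 1ℚ) :* (a :- b)) refl (seq x n) (seq x′ n))
  where open +-*-Solver

*ᴿ-cong : ∀ {x x′ y y′} → x ∼ x′ → y ∼ y′ → x *ᴿ y ∼ x′ *ᴿ y′
*ᴿ-cong {x} {x′} {y} {y′} p q = by (y ⊙ difference p ⊕ x′ ⊙ difference q)
  (λ n → solve 4 (λ a b c d → (a :* c) :- (b :* d) := c :* (a :- b) :+ b :* (c :- d)) refl
    (seq x n) (seq x′ n) (seq y n) (seq y′ n))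
  where open +-*-Solver

≋-refl : ∀ {z} → z ≋ z
≋-refl = mk≋ ∼-refl ∼-refl

≋-sym : ∀ {z w} → z ≋ w → w ≋ z
≋-sym p = mk≋ (∼-sym (re∼ p)) (∼-sym (im∼ p))

≋-trans : ∀ {x y z} → x ≋ y → y ≋ z → x ≋ z
≋-trans p q = mk≋ (∼-trans (re∼ p) (re∼ q)) (∼-trans (im∼ p) (im∼ q))

≋-setoid : Setoid _ _
≋-setoid = record
  { _≈_ = _≋_ ; isEquivalence = record { refl = ≋-refl ; sym = ≋-sym ; trans = ≋-trans } }

+-cong : ∀ {x x′ y y′} → x ≋ x′ → y ≋ y′ → x + y ≋ x′ + y′
+-cong p q = mk≋ (+ᴿ-cong (re∼ p) (re∼ q)) (+ᴿ-cong (im∼ p) (im∼ q))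

-‿cong : ∀ {x x′} → x ≋ x′ → - x ≋ - x′
-‿cong p = mk≋ (-ᴿ-cong (re∼ p)) (-ᴿ-cong (im∼ p))

*-cong : ∀ {x x′ y y′} → x ≋ x′ → y ≋ y′ → x * y ≋ x′ * y′
*-cong p q = mk≋
  (+ᴿ-cong (*ᴿ-cong (re∼ p) (re∼ q)) (-ᴿ-cong (*ᴿ-cong (im∼ p) (im∼ q))))
  (+ᴿ-cong (*ᴿ-cong (re∼ p) (im∼ q)) (*ᴿ-cong (im∼ p) (re∼ q)))

+-congˡ : ∀ x {y y′} → y ≋ y′ → x + y ≋ x + y′
+-congˡ x = +-cong (≋-refl {x})

+-congʳ : ∀ y {x x′} → x ≋ x′ → x + y ≋ x′ + y
+-congʳ y p = +-cong p (≋-refl {y})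

*-congˡ : ∀ x {y y′} → y ≋ y′ → x * y ≋ x * y′
*-congˡ x = *-cong (≋-refl {x})

*-congʳ : ∀ y {x x′} → x ≋ x′ → x * y ≋ x′ * y
*-congʳ y p = *-cong p (≋-refl {y})

-- Either y is eventually small or x is eventually small: a rational test at a
-- late index decides which.
*-cancel : ∀ x {y} → x *ᴿ y ∼ 0ᴿ → ¬ x ∼ 0ᴿ → y ∼ 0ᴿ
*-cancel x {y} xy∼0 x≁0 = ⌈ vanish ⌉
  where
  open ℚP.≤-Reasoning
  open +-*-Solver
  minus-0 : ∀ p → p ℚ.- 0ℚ ≡ p
  minus-0 = solve 1 (λ p → p :- con 0ℚ := p) refl
  vanish : y ≈ᴿ 0ᴿ
  -- With δ ≤ ε/2 and η ≤ δ/2, a late entry |y N| ≤ δ keeps y below 2δ ≤ ε, while |y N| > δ keeps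
  -- |y| above η.
  vanish ε 0<ε with shrink 2ℚ ε (ℚP.nonNegative⁻¹ 2ℚ) 0<ε
  ... | δ , 0<δ , 2δ≤ε with shrink 2ℚ δ (ℚP.nonNegative⁻¹ 2ℚ) 0<δ
  ... | η , 0<η , 2η≤δ with cauchy y η 0<η
  ... | N , h with ∣ seq y N ∣ ℚP.≤? δ
  ... | yes yN≤δ = N , λ n N≤n → begin
    ∣ seq y n ℚ.- 0ℚ ∣
      ≡⟨ cong ∣_∣ (solve 2 (λ a b → a :- con 0ℚ := (a :- b) :+ b) refl (seq y n) (seq y N)) ⟩
    ∣ (seq y n ℚ.- seq y N) ℚ.+ seq y N ∣
      ≤⟨ ∣-∣-triangle (seq y n ℚ.- seq y N) (seq y N) (ℚP.≤-trans (h n N N≤n ℕP.≤-refl) η≤δ) yN≤δ ⟩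
    δ ℚ.+ δ   ≡⟨ solve 1 (λ d → d :+ d := con 2ℚ :* d) refl δ ⟩
    2ℚ ℚ.* δ  ≤⟨ 2δ≤ε ⟩
    ε         ∎
    where
    η≤δ : η ℚ.≤ δ
    η≤δ = begin
      η         ≡⟨ ℚP.+-identityʳ η ⟨
      η ℚ.+ 0ℚ  ≤⟨ ℚP.+-monoʳ-≤ η (ℚP.<⇒≤ 0<η) ⟩
      η ℚ.+ η   ≡⟨ solve 1 (λ d → d :+ d := con 2ℚ :* d) refl η ⟩
      2ℚ ℚ.* η  ≤⟨ 2η≤δ ⟩
      δ         ∎
  ... | no yN≰δ = ⊥-elim (x≁0 x∼0)
    where
    η≤y : ∀ n → N ℕ.≤ n → η ℚ.≤ ∣ seq y n ∣
    η≤y n N≤n = begin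
      η                                     ≡⟨ solve 1 (λ e → e := con 2ℚ :* e :- e) refl η ⟩
      2ℚ ℚ.* η ℚ.- η                        ≤⟨ ℚP.+-monoˡ-≤ (ℚ.- η) (ℚP.≤-trans 2η≤δ (ℚP.<⇒≤ (ℚP.≰⇒> yN≰δ))) ⟩
      ∣ seq y N ∣ ℚ.- η                     ≤⟨ ℚP.+-monoˡ-≤ (ℚ.- η) split ⟩
      (η ℚ.+ ∣ seq y n ∣) ℚ.- η             ≡⟨ solve 2 (λ a b → (a :+ b) :- a := b) refl η (∣ seq y n ∣) ⟩
      ∣ seq y n ∣                           ∎
      where
      split : ∣ seq y N ∣ ℚ.≤ η ℚ.+ ∣ seq y n ∣
      split = begin
        ∣ seq y N ∣                              ≡⟨ cong ∣_∣ (solve 2 (λ a b → b := (b :- a) :+ a) refl (seq y n) (seq y N)) ⟩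
        ∣ (seq y N ℚ.- seq y n) ℚ.+ seq y n ∣    ≤⟨ ∣-∣-triangle (seq y N ℚ.- seq y n) (seq y n) (h N n ℕP.≤-refl N≤n) ℚP.≤-refl ⟩
        η ℚ.+ ∣ seq y n ∣                        ∎
    x∼0 : x ∼ 0ᴿ
    -- From N on, r = 1/η bounds 1/|y|, so |x| ≤ r |x y|, which tends to 0.
    x∼0 = ⌈ (λ τ 0<τ →
      let r , 0<r , ηr≡1 = recip η 0<η
          θ , 0<θ , rθ≤τ = shrink r τ (ℚP.<⇒≤ 0<r) 0<τ
          M , f = ⌊ xy∼0 ⌋ θ 0<θ
      in N ⊔ M , λ n N⊔M≤n → begin
        ∣ seq x n ℚ.- 0ℚ ∣                  ≡⟨ cong ∣_∣ (minus-0 (seq x n)) ⟩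
        ∣ seq x n ∣                         ≡⟨ ℚP.*-identityʳ (∣ seq x n ∣) ⟨
        ∣ seq x n ∣ ℚ.* 1ℚ                  ≡⟨ cong (∣ seq x n ∣ ℚ.*_) ηr≡1 ⟨
        ∣ seq x n ∣ ℚ.* (η ℚ.* r)           ≡⟨ solve 3 (λ a b c → a :* (b :* c) := c :* (a :* b)) refl (∣ seq x n ∣) η r ⟩
        r ℚ.* (∣ seq x n ∣ ℚ.* η)
          ≤⟨ *-mono-≤ˡ r (ℚP.<⇒≤ 0<r) (*-mono-≤ˡ (∣ seq x n ∣) (ℚP.0≤∣p∣ (seq x n)) (η≤y n (ℕP.m⊔n≤o⇒m≤o N M N⊔M≤n))) ⟩
        r ℚ.* (∣ seq x n ∣ ℚ.* ∣ seq y n ∣) ≡⟨ cong (r ℚ.*_) (ℚP.∣p*q∣≡∣p∣*∣q∣ (seq x n) (seq y n)) ⟨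
        r ℚ.* ∣ seq x n ℚ.* seq y n ∣       ≡⟨ cong (λ p → r ℚ.* ∣ p ∣) (minus-0 (seq x n ℚ.* seq y n)) ⟨
        r ℚ.* ∣ seq x n ℚ.* seq y n ℚ.- 0ℚ ∣
          ≤⟨ *-mono-≤ˡ r (ℚP.<⇒≤ 0<r) (f n (ℕP.m⊔n≤o⇒n≤o N M N⊔M≤n)) ⟩
        r ℚ.* θ                             ≤⟨ rθ≤τ ⟩
        τ                                   ∎) ⌉

1≁0 : ¬ 1ᴿ ∼ 0ᴿ
1≁0 p with ⌊ p ⌋ ½ (ℚP.positive⁻¹ ½)
... | N , h = ℚP.<-irrefl refl (ℚP.<-≤-trans ½<1 (h N ℕP.≤-refl))
  where
  ½<1 : ½ ℚ.< 1ℚ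
  ½<1 = from-yes (½ ℚP.<? 1ℚ)

-- Conjugation and the exponential on the imaginary axis

conj : ℂ → ℂ
conj z = re z +i (-ᴿ im z)

^-cong≐ : ∀ {z w} → z ≐ w → ∀ n → z ^ n ≐ w ^ n
^-cong≐ p zero    = ≐-refl
^-cong≐ p (suc n) = Pointwise.*-cong p (^-cong≐ p n)

expSum-cong : ∀ {z w} → z ≐ w → ∀ n → expSum z n ≐ expSum w n
expSum-cong p zero    = ≐-refl
expSum-cong p (suc n) = Pointwise.+-cong (expSum-cong p n)
  (Pointwise.*-cong (≐-refl {scalar (1/ n !)}) (^-cong≐ p n))

-- Entry k of the result depends only on entry k of the argument. Entrywise equality fits the
-- arguments i q π, which are rewritten by rational identities in the entries of π.
exp-cong : ∀ {z w} → z ≐ w → exp z ≐ exp w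
exp-cong p = mk≐ (λ k → re≡ (expSum-cong p k) k) (λ k → im≡ (expSum-cong p k) k)

exp-0 : exp 0ᶜ ≋ 1ᶜ
-- Entry 0 is the empty sum 0, so agreement with 1 begins at index 1.
exp-0 = mk≋ ⌈ (λ ε 0<ε → 1 , λ { (suc n) _ → close ε 0<ε (re≡ (expSum-0 n) (suc n)) }) ⌉
            ⌈ (λ ε 0<ε → 1 , λ { (suc n) _ → close ε 0<ε (im≡ (expSum-0 n) (suc n)) }) ⌉
  where
  open ℂ-Solver
  close : ∀ {p q} ε → 0ℚ ℚ.< ε → p ≡ q → ∣ p ℚ.- q ∣ ℚ.≤ ε
  close {p} ε 0<ε refl = subst (ℚ._≤ ε) (cong ∣_∣ (sym (ℚP.+-inverseʳ p))) (ℚP.<⇒≤ 0<ε)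
  expSum-0 : ∀ n → expSum 0ᶜ (suc n) ≐ 1ᶜ
  expSum-0 zero    = solve 0 (con 0ℚ :+ con 1ℚ :* con 1ℚ := con 1ℚ) ≐-refl
  expSum-0 (suc n) = ≐-trans
    (Pointwise.+-cong (expSum-0 n) (≐-refl {expTerm 0ᶜ (suc n)}))
    (solve 2 (λ f z → con 1ℚ :+ f :* (con 0ℚ :* z) := con 1ℚ) ≐-refl (scalar (1/ suc n !)) (0ᶜ ^ n))

conj-* : ∀ z w → conj z * conj w ≐ conj (z * w)
conj-* z w = mk≐
  (λ k → solve 4 (λ a b c d → a :* c :- (:- b) :* (:- d) := a :* c :- b :* d) refl
    (seq (re z) k) (seq (im z) k) (seq (re w) k) (seq (im w) k))
  (λ k → solve 4 (λ a b c d → a :* (:- d) :+ (:- b) :* c := :- (a :* d :+ b :* c)) refl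
    (seq (re z) k) (seq (im z) k) (seq (re w) k) (seq (im w) k))
  where open +-*-Solver

conj-^ : ∀ z n → conj z ^ n ≐ conj (z ^ n)
conj-^ z zero    = mk≐ (λ _ → refl) (λ _ → refl)
conj-^ z (suc n) = ≐-trans (Pointwise.*-cong (≐-refl {conj z}) (conj-^ z n)) (conj-* z (z ^ n))

expSum-conj : ∀ z n → expSum (conj z) n ≐ conj (expSum z n)
expSum-conj z zero    = mk≐ (λ _ → refl) (λ _ → refl)
expSum-conj z (suc n) = ≐-trans
  (Pointwise.+-cong (expSum-conj z n) (≐-trans
    (Pointwise.*-cong real (conj-^ z n)) (conj-* (scalar (1/ n !)) (z ^ n))))
  (mk≐ (λ _ → refl) (λ k → sym (ℚP.neg-distrib-+ (seq (im (expSum z n)) k) (seq (im (expTerm z n)) k))))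
  where
  real : scalar (1/ n !) ≐ conj (scalar (1/ n !))
  real = mk≐ (λ _ → refl) (λ _ → refl)

exp-conj : ∀ z → exp (conj z) ≐ conj (exp z)
exp-conj z = mk≐ (λ k → re≡ (expSum-conj z k) k) (λ k → im≡ (expSum-conj z k) k)

module Cis (π : ℝ) (isPi : IsPi π) where

  opaque
    -- exp (iπq). Rational multiples of π make the addition and halving of angles arithmetic in ℚ.
    cis : ℚ → ℂ
    cis q = exp (i * fromℝ (fromℚ q *ᴿ π))

    cis≡ζ : ∀ n .{{_ : NonZero n}} → cis (+ 2 ℚ./ n) ≡ ζ π n
    cis≡ζ n = refl

    cis-+ : ∀ p q → cis p * cis q ≋ cis (p ℚ.+ q)
    cis-+ p q = ≋-trans
      (exp-+ (i * fromℝ (fromℚ p *ᴿ π)) (i * fromℝ (fromℚ q *ᴿ π)))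
      (≐⇒≋ (exp-cong (mk≐
        (λ k → solve 3 (λ p q t → (con 0ℚ :* (p :* t) :- con 1ℚ :* con 0ℚ) :+ (con 0ℚ :* (q :* t) :- con 1ℚ :* con 0ℚ)
                           := con 0ℚ :* ((p :+ q) :* t) :- con 1ℚ :* con 0ℚ) refl p q (seq π k))
        (λ k → solve 3 (λ p q t → (con 0ℚ :* con 0ℚ :+ con 1ℚ :* (p :* t)) :+ (con 0ℚ :* con 0ℚ :+ con 1ℚ :* (q :* t))
                           := con 0ℚ :* con 0ℚ :+ con 1ℚ :* ((p :+ q) :* t)) refl p q (seq π k)))))
      where open +-*-Solver

    cis-0 : cis 0ℚ ≋ 1ᶜ
    cis-0 = ≋-trans (≐⇒≋ (exp-cong (mk≐
        (λ k → solve 1 (λ t → con 0ℚ :* (con 0ℚ :* t) :- con 1ℚ :* con 0ℚ := con 0ℚ) refl (seq π k))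
        (λ k → solve 1 (λ t → con 0ℚ :* con 0ℚ :+ con 1ℚ :* (con 0ℚ :* t) := con 0ℚ) refl (seq π k))))) exp-0
      where open +-*-Solver

    cis-neg : ∀ q → cis (ℚ.- q) ≐ conj (cis q)
    cis-neg q = ≐-trans (exp-cong (mk≐
        (λ k → solve 2 (λ q t → con 0ℚ :* ((:- q) :* t) :- con 1ℚ :* con 0ℚ := con 0ℚ :* (q :* t) :- con 1ℚ :* con 0ℚ)
                 refl q (seq π k))
        (λ k → solve 2 (λ q t → con 0ℚ :* con 0ℚ :+ con 1ℚ :* ((:- q) :* t) := :- (con 0ℚ :* con 0ℚ :+ con 1ℚ :* (q :* t)))
                 refl q (seq π k))))
      (exp-conj (i * fromℝ (fromℚ q *ᴿ π)))
      where open +-*-Solver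

  -- The conjugate of `cis q` is `cis (- q)`, and their product is `cis 0`.
  cis-unit : ∀ q → dot (cis q) (cis q) ∼ 1ᴿ
  cis-unit q = ∼-trans
    (pointwise (λ k → solve 2 (λ a b → a :* a :+ b :* b := a :* a :- b :* (:- b)) refl
      (seq (re (cis q)) k) (seq (im (cis q)) k)))
    (re∼ (≋-trans (*-congˡ (cis q) (≋-sym (≐⇒≋ (cis-neg q))))
      (≋-trans (cis-+ q (ℚ.- q)) (subst (λ p → cis p ≋ 1ᶜ) (sym (ℚP.+-inverseʳ q)) cis-0))))
    where open +-*-Solver

  opaque
    unfolding cis

    -- Late entries of π exceed a positive rational δ, so q δ and (1 - q) δ witness 0 < q π < π, and
    -- the minimality of π excludes a zero there.
    sin≁0 : ∀ {q} → 0ℚ ℚ.< q → q ℚ.< 1ℚ → ¬ im (cis q) ∼ 0ᴿ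
    sin≁0 {q} 0<q q<1 p = proj₂ (proj₂ isPi) (fromℚ q *ᴿ π) positive below ⌊ p ⌋
      where
      open ℚP.≤-Reasoning
      open +-*-Solver
      δ : ℚ
      δ = proj₁ (proj₁ isPi)
      0<δ : 0ℚ ℚ.< δ
      0<δ = proj₁ (proj₂ (proj₁ isPi))
      scaled : ∀ r → 0ℚ ℚ.< r → 0ℚ ℚ.< r ℚ.* δ
      scaled r 0<r = ℚP.positive⁻¹ (r ℚ.* δ) {{ℚP.pos*pos⇒pos r {{ℚ.positive 0<r}} δ {{ℚ.positive 0<δ}}}}
      N : ℕ
      N = proj₁ (proj₂ (proj₂ (proj₁ isPi)))
      δ≤π : ∀ n → N ℕ.≤ n → δ ℚ.≤ seq π n ℚ.- 0ℚ
      δ≤π = proj₂ (proj₂ (proj₂ (proj₁ isPi)))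
      positive : 0ᴿ <ᴿ fromℚ q *ᴿ π
      positive = q ℚ.* δ , scaled q 0<q , N , λ n N≤n → begin
        q ℚ.* δ                      ≤⟨ *-mono-≤ˡ q (ℚP.<⇒≤ 0<q) (δ≤π n N≤n) ⟩
        q ℚ.* (seq π n ℚ.- 0ℚ)       ≡⟨ solve 2 (λ q t → q :* (t :- con 0ℚ) := q :* t :- con 0ℚ) refl q (seq π n) ⟩
        q ℚ.* seq π n ℚ.- 0ℚ         ∎
      0<1-q : 0ℚ ℚ.< 1ℚ ℚ.- q
      0<1-q = begin-strict
        0ℚ        ≡⟨ ℚP.+-inverseʳ q ⟨
        q ℚ.- q   <⟨ ℚP.+-monoˡ-< (ℚ.- q) q<1 ⟩
        1ℚ ℚ.- q  ∎
      below : fromℚ q *ᴿ π <ᴿ π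
      below = (1ℚ ℚ.- q) ℚ.* δ , scaled (1ℚ ℚ.- q) 0<1-q , N , λ n N≤n → begin
        (1ℚ ℚ.- q) ℚ.* δ                  ≤⟨ *-mono-≤ˡ (1ℚ ℚ.- q) (ℚP.<⇒≤ 0<1-q) (δ≤π n N≤n) ⟩
        (1ℚ ℚ.- q) ℚ.* (seq π n ℚ.- 0ℚ)
          ≡⟨ solve 2 (λ q t → (con 1ℚ :- q) :* (t :- con 0ℚ) := t :- q :* t) refl q (seq π n) ⟩
        seq π n ℚ.- q ℚ.* seq π n         ∎

    sin-π : im (cis 1ℚ) ∼ 0ᴿ
    sin-π = ∼-trans (im∼ (≐⇒≋ (exp-cong (mk≐
        (λ k → cong (λ t → 0ℚ ℚ.* t ℚ.- 1ℚ ℚ.* 0ℚ) (ℚP.*-identityˡ (seq π k)))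
        (λ k → cong (λ t → 0ℚ ℚ.* 0ℚ ℚ.+ 1ℚ ℚ.* t) (ℚP.*-identityˡ (seq π k)))))))
      ⌈ proj₁ (proj₂ isPi) ⌉

  -- sin π = 2 sin (π/2) cos (π/2) vanishes, and sin (π/2) does not.
  cis-½ : re (cis ½) ∼ 0ᴿ
  cis-½ = *-cancel (im (cis ½))
    (by (fromℚ ½ ⊙ difference (∼-trans (im∼ (cis-+ ½ ½)) sin-π))
      (λ k → solve 2 (λ c s → s :* c :- con 0ℚ := con ½ :* ((c :* s :+ s :* c) :- con 0ℚ)) refl
        (seq (re (cis ½)) k) (seq (im (cis ½)) k)))
    (sin≁0 (ℚP.positive⁻¹ ½) (from-yes (½ ℚP.<? 1ℚ)))
    where open +-*-Solver

  -- cos π = cos² (π/2) - sin² (π/2) = 2 cos² (π/2) - 1, with cos (π/2) = 0.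
  cis-1 : cis 1ℚ ≋ - 1ᶜ
  cis-1 = mk≋
    (∼-trans (∼-sym (re∼ (cis-+ ½ ½)))
      (by ((fromℚ 2ℚ *ᴿ re (cis ½)) ⊙ difference cis-½ ⊕ (-ᴿ 1ᴿ) ⊙ difference (cis-unit ½))
        (λ k → solve 2 (λ c s → (c :* c :- s :* s) :- con (ℚ.- 1ℚ) :=
            (con 2ℚ :* c) :* (c :- con 0ℚ) :+ con (ℚ.- 1ℚ) :* ((c :* c :+ s :* s) :- con 1ℚ)) refl
          (seq (re (cis ½)) k) (seq (im (cis ½)) k))))
    (∼-trans sin-π (pointwise (λ _ → refl)))
    where open +-*-Solver

  cis-^ : ∀ q n → cis q ^ n ≋ cis (fromℕ n ℚ.* q)
  cis-^ q zero    = subst (λ p → 1ᶜ ≋ cis p) (sym (ℚP.*-zeroˡ q)) (≋-sym cis-0)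
  cis-^ q (suc n) = ≋-trans (*-congˡ (cis q) (cis-^ q n))
    (subst (λ p → cis q * cis (fromℕ n ℚ.* q) ≋ cis p)
      (trans (solve 2 (λ q m → q :+ m :* q := (con 1ℚ :+ m) :* q) refl q (fromℕ n))
             (cong (ℚ._* q) (sym (fromℕ-suc n))))
      (cis-+ q (fromℕ n ℚ.* q)))
    where open +-*-Solver

-- Constructions

module Constructing (π : ℝ) where

  weaken : ∀ {Γ Δ o} → Γ ⊆ Δ → Step π Γ o → Step π Δ o
  weaken s (O1 p q p≉q a b)          = O1 (s p) (s q) p≉q a b
  weaken s (O2 p q p≉q b)            = O2 (s p) (s q) p≉q b
  weaken s (O3 ℓ m ℓ≄m b)            = O3 (s ℓ) (s m) ℓ≄m b
  weaken s (O4 p ℓ a b)              = O4 (s p) (s ℓ) a b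
  weaken s (O5 p q ℓ fin b)          = O5 (s p) (s q) (s ℓ) fin b
  weaken s (O6 p q ℓ m fin b)        = O6 (s p) (s q) (s ℓ) (s m) fin b
  weaken s (O7 p ℓ m fin b)          = O7 (s p) (s ℓ) (s m) fin b
  weaken s (LI ℓ m ∦ a b)            = LI (s ℓ) (s m) ∦ a b
  weaken s (RPA k A a B b₀ b₁ j c d) = RPA k A (λ j → s (a j)) B b₀ b₁ j c d

  given : ∀ {Γ} → Construction π Γ → (point 1ᶜ ∷ point 0ᶜ ∷ []) ⊆ Γ
  given start      = λ x → x
  given (c then _) = there ∘ given c

  -- Both constructions start from 0 and 1, so the second can be replayed on top of the first.
  merge : ∀ {Γ Δ} → Construction π Γ → Construction π Δ → ∃ λ Θ → Construction π Θ × Γ ⊆ Θ × Δ ⊆ Θ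
  merge c start = _ , c , (λ x → x) , given c
  merge c (d then s) with merge c d
  ... | Θ , e , Γ⊆Θ , Δ⊆Θ = _ , (e then weaken Δ⊆Θ s) , there ∘ Γ⊆Θ , λ { (here eq) → here eq ; (there x) → there (Δ⊆Θ x) }

  Constructible : Object → Set
  Constructible o = ∃ λ Γ → Construction π Γ × o ∈ˡ Γ

  Foldable : Line → Set
  Foldable ℓ = Constructible (line ℓ)

  simultaneously : ∀ n (o : Fin n → Object) → (∀ j → Constructible (o j)) → ∃ λ Γ → Construction π Γ × (∀ j → o j ∈ˡ Γ)
  simultaneously zero    o h = _ , start , λ ()
  simultaneously (suc n) o h with simultaneously n (o ∘ suc) (h ∘ suc) | h zero
  ... | Γ , c , s | Δ , d , t with merge c d
  ... | Θ , e , Γ⊆Θ , Δ⊆Θ = Θ , e , λ { zero → Δ⊆Θ t ; (suc j) → Γ⊆Θ (s j) }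

  -- A step refers to the number that literally occurs in the list, whereas membership in `𝒪-RP` is
  -- up to equality in ℂ; the record keeps that number next to the equality.
  record Point (z : ℂ) : Set where
    constructor mkPoint
    field
      {representative} : ℂ
      constructible    : Constructible (point representative)
      represents       : z ≋ representative

  Point⇒∈ : ∀ {z} → Point z → z ∈ 𝒪-RP π
  Point⇒∈ (mkPoint {β} (Γ , c , m) z≋β) = Γ , β , c , m , ≋⇒≈ z≋β

  Point-resp-≋ : ∀ {z w} → z ≋ w → Point z → Point w
  Point-resp-≋ z≋w (mkPoint c z≋β) = mkPoint c (≋-trans (≋-sym z≋w) z≋β)

  Point-0 : Point 0ᶜ
  Point-0 = mkPoint (_ , start , there (here refl)) ≋-refl

  Point-1 : Point 1ᶜ
  Point-1 = mkPoint (_ , start , here refl) ≋-refl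

  infix 4 _on_ _∥_

  record _on_ (z : ℂ) (f : Line) : Set where
    constructor mk-on
    field
      incidence : cross (z - base f) (direction f) ∼ 0ᴿ

  record _∥_ (a b : ℂ) : Set where
    constructor mk-∥
    field
      collinearity : cross a b ∼ 0ᴿ

  open _on_ public
  open _∥_ public

  on⇒On : ∀ {z f} → z on f → z On f
  on⇒On z∈f = ⌊ incidence z∈f ⌋

  on-resp-≋ : ∀ {z w f} → z ≋ w → z on f → w on f
  on-resp-≋ {z} {w} {f} z≋w z∈f = mk-on (by
      ((-ᴿ im d) ⊙ difference (re∼ z≋w) ⊕ re d ⊙ difference (im∼ z≋w) ⊕ difference (incidence z∈f))
      (λ k → solve 8 (λ a b a′ b′ p q x y →
          ((a′ :- p) :* y :- (b′ :- q) :* x) :- con 0ℚ :=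
          (:- y) :* (a :- a′) :+ (x :* (b :- b′) :+ (((a :- p) :* y :- (b :- q) :* x) :- con 0ℚ))) refl
        (seq (re z) k) (seq (im z) k) (seq (re w) k) (seq (im w) k)
        (seq (re (base f)) k) (seq (im (base f)) k) (seq (re d) k) (seq (im d) k)))
    where
    open +-*-Solver
    d = direction f

  ∥-refl : ∀ {d} → d ∥ d
  ∥-refl {d} = mk-∥ (pointwise (λ k → solve 2 (λ a b → a :* b :- b :* a := con 0ℚ) refl (seq (re d) k) (seq (im d) k)))
    where open +-*-Solver

  ∥-respʳ : ∀ {a b b′} → b ≋ b′ → a ∥ b → a ∥ b′
  ∥-respʳ {a} {b} {b′} p a∥b = mk-∥ (by
      ((-ᴿ re a) ⊙ difference (im∼ p) ⊕ im a ⊙ difference (re∼ p) ⊕ difference (collinearity a∥b))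
      (λ k → solve 6 (λ a b x y x′ y′ →
          (a :* y′ :- b :* x′) :- con 0ℚ :=
          (:- a) :* (y :- y′) :+ (b :* (x :- x′) :+ ((a :* y :- b :* x) :- con 0ℚ))) refl
        (seq (re a) k) (seq (im a) k) (seq (re b) k) (seq (im b) k) (seq (re b′) k) (seq (im b′) k)))
    where open +-*-Solver

  ∥-respˡ : ∀ {a a′ b} → a ≋ a′ → a ∥ b → a′ ∥ b
  ∥-respˡ {a} {a′} {b} p a∥b = mk-∥ (by
      ((-ᴿ im b) ⊙ difference (re∼ p) ⊕ re b ⊙ difference (im∼ p) ⊕ difference (collinearity a∥b))
      (λ k → solve 6 (λ a b a′ b′ x y →
          (a′ :* y :- b′ :* x) :- con 0ℚ :=
          (:- y) :* (a :- a′) :+ (x :* (b :- b′) :+ ((a :* y :- b :* x) :- con 0ℚ))) refl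
        (seq (re a) k) (seq (im a) k) (seq (re a′) k) (seq (im a′) k) (seq (re b) k) (seq (im b) k)))
    where open +-*-Solver

  -- The zero vector is collinear with every vector, so non-collinear vectors can serve as
  -- directions of lines.
  ∦⇒≉0ˡ : ∀ {a b} → ¬ a ∥ b → ¬ a ≋ 0ᶜ
  ∦⇒≉0ˡ {b = b} ∦ a≋0 = ∦ (∥-respˡ (≋-sym a≋0)
      (mk-∥ (pointwise (λ k → solve 2 (λ x y → con 0ℚ :* y :- con 0ℚ :* x := con 0ℚ) refl (seq (re b) k) (seq (im b) k)))))
    where open +-*-Solver

  ∦⇒≉0ʳ : ∀ {a b} → ¬ a ∥ b → ¬ b ≋ 0ᶜ
  ∦⇒≉0ʳ {a} ∦ b≋0 = ∦ (∥-respʳ (≋-sym b≋0)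
      (mk-∥ (pointwise (λ k → solve 2 (λ x y → x :* con 0ℚ :- y :* con 0ℚ := con 0ℚ) refl (seq (re a) k) (seq (im a) k)))))
    where open +-*-Solver

  ray : (p d : ℂ) → ¬ d ≋ 0ᶜ → Line
  ray p d d≉0 = record { base = p ; direction = d ; nonzero = λ d≈0 → d≉0 (≈⇒≋ d≈0) }

  base-on : ∀ f → base f on f
  base-on f = mk-on (pointwise (λ k → solve 4 (λ p q x y → (p :- p) :* y :- (q :- q) :* x := con 0ℚ) refl
      (seq (re (base f)) k) (seq (im (base f)) k) (seq (re (direction f)) k) (seq (im (direction f)) k)))
    where open +-*-Solver

  fold-through : ∀ {p q f} → Point p → Point q → ¬ p ≋ q → p on f → q on f → Foldable f
  fold-through (mkPoint (Γ , c , p′∈Γ) p≋p′) (mkPoint (Δ , d , q′∈Δ) q≋q′) p≉q p∈f q∈f with merge c d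
  ... | Θ , e , Γ⊆Θ , Δ⊆Θ = _ , (e then O1 (Γ⊆Θ p′∈Γ) (Δ⊆Θ q′∈Δ)
      (λ p′≈q′ → p≉q (≋-trans p≋p′ (≋-trans (≈⇒≋ p′≈q′) (≋-sym q≋q′))))
      (on⇒On (on-resp-≋ p≋p′ p∈f)) (on⇒On (on-resp-≋ q≋q′ q∈f))) , here refl

  fold-bisector : ∀ {ℓ m f} → Foldable ℓ → Foldable m → ¬ ℓ ≃ m → Bisector f ℓ m → Foldable f
  fold-bisector (Γ , c , ℓ∈Γ) (Δ , d , m∈Δ) ℓ≄m b with merge c d
  ... | Θ , e , Γ⊆Θ , Δ⊆Θ = _ , (e then O3 (Γ⊆Θ ℓ∈Γ) (Δ⊆Θ m∈Δ) ℓ≄m b) , here refl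

  fold-perpendicular : ∀ {p ℓ f} → Point p → Foldable ℓ → p on f → dot (direction f) (direction ℓ) ∼ 0ᴿ → Foldable f
  fold-perpendicular (mkPoint (Γ , c , p′∈Γ) p≋p′) (Δ , d , ℓ∈Δ) p∈f f⊥ℓ with merge c d
  ... | Θ , e , Γ⊆Θ , Δ⊆Θ =
    _ , (e then O4 (Γ⊆Θ p′∈Γ) (Δ⊆Θ ℓ∈Δ) (on⇒On (on-resp-≋ p≋p′ p∈f)) ⌊ f⊥ℓ ⌋) , here refl

  intersect : ∀ {ℓ m p} → Foldable ℓ → Foldable m → ¬ direction ℓ ∥ direction m → p on ℓ → p on m → Point p
  intersect (Γ , c , ℓ∈Γ) (Δ , d , m∈Δ) ∦ p∈ℓ p∈m with merge c d
  ... | Θ , e , Γ⊆Θ , Δ⊆Θ = mkPoint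
    (_ , (e then LI (Γ⊆Θ ℓ∈Γ) (Δ⊆Θ m∈Δ) (λ p → ∦ (mk-∥ ⌈ p ⌉)) (on⇒On p∈ℓ) (on⇒On p∈m)) , here refl) ≋-refl

  -- Two perpendiculars in succession: h through p perpendicular to ℓ, with direction i times that
  -- of ℓ, then f through p perpendicular to h.
  fold-parallel : ∀ {p ℓ f} → Point p → Foldable ℓ → p on f → direction f ∥ direction ℓ → Foldable f
  fold-parallel {p} {ℓ} {f} P F p∈f f∥ℓ = fold-perpendicular P (fold-perpendicular P F (base-on h) h⊥ℓ) p∈f f⊥h
    where
    open +-*-Solver
    d = direction ℓ
    h : Line
    h = ray p ((-ᴿ im d) +i re d) λ q → nonzero ℓ
      (⌊ im∼ q ⌋ , ⌊ by {im d} {0ᴿ} ((-ᴿ 1ᴿ) ⊙ difference (re∼ q))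
        (λ k → solve 1 (λ y → y :- con 0ℚ := con (ℚ.- 1ℚ) :* ((:- y) :- con 0ℚ)) refl (seq (im d) k)) ⌋)
    h⊥ℓ : dot (direction h) d ∼ 0ᴿ
    h⊥ℓ = pointwise (λ k → solve 2 (λ x y → (:- y) :* x :+ x :* y := con 0ℚ) refl (seq (re d) k) (seq (im d) k))
    f⊥h : dot (direction f) (direction h) ∼ 0ᴿ
    f⊥h = by ((-ᴿ 1ᴿ) ⊙ difference (collinearity f∥ℓ))
      (λ k → solve 4 (λ a b x y → (a :* (:- y) :+ b :* x) :- con 0ℚ := con (ℚ.- 1ℚ) :* ((a :* y :- b :* x) :- con 0ℚ)) refl
        (seq (re (direction f)) k) (seq (im (direction f)) k) (seq (re d) k) (seq (im d) k))

  -- Some line of direction d is constructible; by fold-parallel so are all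
  -- lines of this direction through constructible points.
  record Ruled (d : ℂ) : Set where
    constructor mkRuled
    field
      {ruling} : Line
      foldable : Foldable ruling
      directed : direction ruling ≋ d

  Ruled-resp-≋ : ∀ {a b} → a ≋ b → Ruled a → Ruled b
  Ruled-resp-≋ a≋b (mkRuled F p) = mkRuled F (≋-trans p a≋b)

  fold-ruled : ∀ {d p f} → Ruled d → Point p → p on f → direction f ∥ d → Foldable f
  fold-ruled (mkRuled F p) P p∈f f∥d = fold-parallel P F p∈f (∥-respʳ (≋-sym p) f∥d)

  ray-foldable : ∀ {p d} → Point p → Ruled d → ∀ d≉0 → Foldable (ray p d d≉0)
  ray-foldable {p} {d} P r d≉0 = fold-ruled r P (base-on (ray p d d≉0)) ∥-refl

  Ruled-resp-∥ : ∀ {a b} → Ruled a → ¬ b ≋ 0ᶜ → b ∥ a → Ruled b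
  Ruled-resp-∥ {a} {b} r b≉0 b∥a = mkRuled (fold-ruled r Point-0 (base-on (ray 0ᶜ b b≉0)) b∥a) ≋-refl

  -- The reflection across the line ℝd is p ↦ d p̄ / d̄; it carries ℝ(d v̄) to ℝ(d v).
  bisects : ∀ d v d≉0 dv̄≉0 dv≉0 → Bisector (ray 0ᶜ d d≉0) (ray 0ᶜ (d * conj v) dv̄≉0) (ray 0ᶜ (d * v) dv≉0)
  bisects d v d≉0 dv̄≉0 dv≉0 p q p∈ℓ (mid , perp) = ⌊ q∈m ⌋
    where
    open +-*-Solver
    perp∼ : dot (q - p) d ∼ 0ᴿ
    perp∼ = ⌈ perp ⌉
    mid∼ : cross (midpoint p q - 0ᶜ) d ∼ 0ᴿ
    mid∼ = ⌈ mid ⌉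
    p∈ℓ∼ : cross (p - 0ᶜ) (d * conj v) ∼ 0ᴿ
    p∈ℓ∼ = ⌈ p∈ℓ ⌉
    q∈m : cross (q - 0ᶜ) (d * v) ∼ 0ᴿ
    -- For v = s + t i, cross z (d v) = s · cross z d + t · dot z d, and for the conjugate of v the
    -- sign of t changes. The factor 2 clears the ½ of the midpoint.
    q∈m = by (im v ⊙ difference perp∼ ⊕ (fromℚ 2ℚ *ᴿ re v) ⊙ difference mid∼ ⊕ (-ᴿ 1ᴿ) ⊙ difference p∈ℓ∼)
      (λ k → solve 8 (λ x y s t a b c e →
          ((a :- con 0ℚ) :* (x :* t :+ y :* s) :- (b :- con 0ℚ) :* (x :* s :- y :* t)) :- con 0ℚ :=
          t :* (((a :- c) :* x :+ (b :- e) :* y) :- con 0ℚ) :+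
          ((con 2ℚ :* s) :*
            ((((con ½ :* (c :+ a) :- con 0ℚ :* (e :+ b)) :- con 0ℚ) :* y :-
              ((con ½ :* (e :+ b) :+ con 0ℚ :* (c :+ a)) :- con 0ℚ) :* x) :- con 0ℚ) :+
           con (ℚ.- 1ℚ) :*
             (((c :- con 0ℚ) :* (x :* (:- t) :+ y :* s) :- (e :- con 0ℚ) :* (x :* s :- y :* (:- t))) :- con 0ℚ))) refl
        (seq (re d) k) (seq (im d) k) (seq (re v) k) (seq (im v) k)
        (seq (re q) k) (seq (im q) k) (seq (re p) k) (seq (im p) k))

  on-ray-0 : ∀ {a b b≉0} → a ∥ b → a on ray 0ᶜ b b≉0
  on-ray-0 {a} {b} a∥b = mk-on (∼-trans
      (pointwise (λ k → solve 4 (λ a a′ b b′ → (a :- con 0ℚ) :* b′ :- (a′ :- con 0ℚ) :* b := a :* b′ :- a′ :* b) refl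
        (seq (re a) k) (seq (im a) k) (seq (re b) k) (seq (im b) k)))
      (collinearity a∥b))
    where open +-*-Solver

  ray-0-on : ∀ a {b b≉0} → a on ray 0ᶜ b b≉0 → a ∥ b
  ray-0-on a {b} a∈b = mk-∥ (∼-trans
      (pointwise (λ k → solve 4 (λ a a′ b b′ → a :* b′ :- a′ :* b := (a :- con 0ℚ) :* b′ :- (a′ :- con 0ℚ) :* b) refl
        (seq (re a) k) (seq (im a) k) (seq (re b) k) (seq (im b) k)))
      (incidence a∈b))
    where open +-*-Solver

  bisect : ∀ {d v} → Ruled (d * conj v) → Ruled (d * v) → ¬ d * conj v ∥ d * v → ¬ d ≋ 0ᶜ → Ruled d
  bisect {d} {v} r r′ ∦ d≉0 = mkRuled {ruling = ray 0ᶜ d d≉0} (fold-bisector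
      (ray-foldable Point-0 r (∦⇒≉0ˡ ∦)) (ray-foldable Point-0 r′ (∦⇒≉0ʳ ∦))
      -- If the two lines had the same points, the direction of the first would lie on the second.
      (λ e → ∦ (ray-0-on (d * conj v) {b≉0 = ∦⇒≉0ʳ ∦} (mk-on ⌈ proj₁ (e (d * conj v)) (on⇒On (on-ray-0 {b≉0 = ∦⇒≉0ˡ ∦} ∥-refl)) ⌉)))
      (bisects d v d≉0 (∦⇒≉0ˡ ∦) (∦⇒≉0ʳ ∦))) ≋-refl

  re∼1⇒≉0 : ∀ {d} → re d ∼ 1ᴿ → ¬ d ≋ 0ᶜ
  re∼1⇒≉0 p q = 1≁0 (∼-trans (∼-sym p) (re∼ q))

  1≉0 : ¬ 1ᶜ ≋ 0ᶜ
  1≉0 = re∼1⇒≉0 ∼-refl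

  i≉0 : ¬ i ≋ 0ᶜ
  i≉0 p = 1≁0 (im∼ p)

  Ruled-1 : Ruled 1ᶜ
  Ruled-1 = mkRuled (fold-through Point-0 Point-1 (λ p → 1≁0 (∼-sym (re∼ p))) (base-on x-axis)
      (mk-on (pointwise (λ _ → refl)))) ≋-refl
    where
    x-axis = ray 0ᶜ 1ᶜ 1≉0

  Ruled-i : Ruled i
  Ruled-i = mkRuled (fold-perpendicular Point-0 (ray-foldable Point-0 Ruled-1 1≉0) (base-on y-axis)
      (pointwise (λ _ → refl))) ≋-refl
    where
    y-axis = ray 0ᶜ i i≉0

  -- The lines through 1 and i and through i and -1 are at 45° to the axes.
  Point-−1 : Point (- 1ᶜ)
  Point-−1 = intersect (ray-foldable Point-i Ruled-diagonal diagonal≉0) (ray-foldable Point-0 Ruled-1 1≉0)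
      (λ p → 1≁0 (by ((-ᴿ 1ᴿ) ⊙ difference (collinearity p)) (λ _ → refl)))
      (mk-on (pointwise (λ _ → refl))) (mk-on (pointwise (λ _ → refl)))
    where
    diagonal antidiagonal v : ℂ
    diagonal     = 1ᴿ +i 1ᴿ
    antidiagonal = 1ᴿ +i (-ᴿ 1ᴿ)
    -- Chosen so that (1 + i) · conj v = 1 and (1 + i) · v = i: the diagonal bisects the two axes.
    v            = fromℚ ½ +i fromℚ ½
    diagonal≉0 : ¬ diagonal ≋ 0ᶜ
    diagonal≉0 = re∼1⇒≉0 ∼-refl
    Ruled-diagonal : Ruled diagonal
    Ruled-diagonal = bisect {v = v}
      (Ruled-resp-≋ (mk≋ (pointwise (λ _ → refl)) (pointwise (λ _ → refl))) Ruled-1)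
      (Ruled-resp-≋ (mk≋ (pointwise (λ _ → refl)) (pointwise (λ _ → refl))) Ruled-i)
      (λ p → 1≁0 (∼-trans (pointwise (λ _ → refl)) (collinearity p))) diagonal≉0
    antidiagonal-line = ray 1ᶜ antidiagonal (re∼1⇒≉0 ∼-refl)
    Point-i : Point i
    Point-i = intersect
      (fold-perpendicular Point-1 (ray-foldable Point-0 Ruled-diagonal diagonal≉0) (base-on antidiagonal-line)
        (pointwise (λ _ → refl)))
      (ray-foldable Point-0 Ruled-i i≉0)
      (λ p → 1≁0 (∼-trans (pointwise (λ _ → refl)) (collinearity p)))
      (mk-on (pointwise (λ _ → refl))) (mk-on (pointwise (λ _ → refl)))

-- Regular polygons

fromℕ-+ : ∀ m n → fromℕ (m ℕ.+ n) ≡ fromℕ m ℚ.+ fromℕ n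
fromℕ-+ zero    n = sym (ℚP.+-identityˡ (fromℕ n))
fromℕ-+ (suc m) n = trans (fromℕ-suc (m ℕ.+ n)) (trans (cong (1ℚ ℚ.+_) (fromℕ-+ m n))
  (trans (sym (ℚP.+-assoc 1ℚ (fromℕ m) (fromℕ n))) (cong (ℚ._+ fromℕ n) (sym (fromℕ-suc m)))))

2/suc : ∀ n → + 2 ℚ./ suc n ≡ 1/suc n ℚ.+ 1/suc n
2/suc n = ℚP.toℚᵘ-injective (begin
  ℚ.toℚᵘ (+ 2 ℚ./ suc n)                     ≈⟨ ℚP.toℚᵘ-fromℚᵘ (ℚᵘ.mkℚᵘ (+ 2) n) ⟩
  ℚᵘ.mkℚᵘ (+ 2) n
    ≈⟨ ℚᵘ.*≡* (solve 1 (λ m → con (+ 2) :* (m :* m) := (con (+ 1) :* m :+ con (+ 1) :* m) :* m) refl (+ suc n)) ⟩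
  ℚᵘ.mkℚᵘ (+ 1) n ℚᵘ.+ ℚᵘ.mkℚᵘ (+ 1) n
    ≈⟨ ℚᵘP.+-cong (ℚP.toℚᵘ-fromℚᵘ (ℚᵘ.mkℚᵘ (+ 1) n)) (ℚP.toℚᵘ-fromℚᵘ (ℚᵘ.mkℚᵘ (+ 1) n)) ⟨
  ℚ.toℚᵘ (1/suc n) ℚᵘ.+ ℚ.toℚᵘ (1/suc n)     ≈⟨ ℚP.toℚᵘ-homo-+ (1/suc n) (1/suc n) ⟨
  ℚ.toℚᵘ (1/suc n ℚ.+ 1/suc n)               ∎)
  where
  open ℚᵘP.≃-Reasoning
  open ℤS.+-*-Solver

1/suc-halves : ∀ n → 1/suc (suc (n ℕ.+ n)) ℚ.+ 1/suc (suc (n ℕ.+ n)) ≡ 1/suc n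
1/suc-halves n = begin
  r ℚ.+ r                       ≡⟨ ℚP.*-identityʳ (r ℚ.+ r) ⟨
  (r ℚ.+ r) ℚ.* 1ℚ              ≡⟨ cong ((r ℚ.+ r) ℚ.*_) (suc*1/suc n) ⟨
  (r ℚ.+ r) ℚ.* (m ℚ.* q)       ≡⟨ solve 3 (λ r m q → (r :+ r) :* (m :* q) := ((m :+ m) :* r) :* q) refl r m q ⟩
  ((m ℚ.+ m) ℚ.* r) ℚ.* q       ≡⟨ cong (λ k → (k ℚ.* r) ℚ.* q) m+m ⟨
  (fromℕ (suc (suc (n ℕ.+ n))) ℚ.* r) ℚ.* q  ≡⟨ cong (ℚ._* q) (suc*1/suc (suc (n ℕ.+ n))) ⟩
  1ℚ ℚ.* q                      ≡⟨ ℚP.*-identityˡ q ⟩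
  q                             ∎
  where
  open Relation.Binary.PropositionalEquality.≡-Reasoning
  open +-*-Solver
  r = 1/suc (suc (n ℕ.+ n))
  m = fromℕ (suc n)
  q = 1/suc n
  m+m : fromℕ (suc (suc (n ℕ.+ n))) ≡ m ℚ.+ m
  m+m = trans (cong (λ k → fromℕ (suc k)) (sym (ℕP.+-suc n n))) (fromℕ-+ (suc n) (suc n))

*1/suc<1 : ∀ m n → m ℕ.≤ n → fromℕ m ℚ.* 1/suc n ℚ.< 1ℚ
*1/suc<1 m n m≤n = begin-strict
  fromℕ m ℚ.* 1/suc n                ≡⟨ ℚP.+-identityˡ (fromℕ m ℚ.* 1/suc n) ⟨
  0ℚ ℚ.+ fromℕ m ℚ.* 1/suc n         <⟨ ℚP.+-mono-<-≤ (0<1/suc n) (*-mono-≤ʳ (1/suc n) (ℚP.<⇒≤ (0<1/suc n)) (fromℕ-mono m≤n)) ⟩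
  1/suc n ℚ.+ fromℕ n ℚ.* 1/suc n    ≡⟨ solve 2 (λ q m → q :+ m :* q := (con 1ℚ :+ m) :* q) refl (1/suc n) (fromℕ n) ⟩
  (1ℚ ℚ.+ fromℕ n) ℚ.* 1/suc n       ≡⟨ cong (ℚ._* 1/suc n) (fromℕ-suc n) ⟨
  fromℕ (suc n) ℚ.* 1/suc n          ≡⟨ suc*1/suc n ⟩
  1ℚ                                 ∎
  where
  open ℚP.≤-Reasoning
  open +-*-Solver

^-cong : ∀ {z w} → z ≋ w → ∀ n → z ^ n ≋ w ^ n
^-cong p zero    = ≋-refl
^-cong p (suc n) = *-cong p (^-cong p n)

square-^ : ∀ z n → (z * z) ^ n ≐ z ^ n * z ^ n
square-^ z zero    = solve 0 (con 1ℚ := con 1ℚ :* con 1ℚ) ≐-refl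
  where open ℂ-Solver
square-^ z (suc n) = ≐-trans (Pointwise.*-cong (≐-refl {z * z}) (square-^ z n))
  (solve 2 (λ z y → (z :* z) :* (y :* y) := (z :* y) :* (z :* y)) ≐-refl z (z ^ n))
  where open ℂ-Solver

^-double : ∀ {z w} → z * z ≋ w → ∀ n → z ^ (n ℕ.+ n) ≋ w ^ n
^-double p zero    = ≋-refl
^-double {z} {w} p (suc n) rewrite ℕP.+-suc n n = ≋-trans
  (≐⇒≋ (solve 2 (λ z y → z :* (z :* y) := (z :* z) :* y) ≐-refl z (z ^ (n ℕ.+ n))))
  (*-cong p (^-double p n))
  where open ℂ-Solver

toℕ-next : ∀ {n} (j : Fin (suc n)) → toℕ (next j) ≡ suc (toℕ j) ℕD.% suc n
toℕ-next {n} j = FinP.toℕ-fromℕ< (ℕD.m%n<n (suc (toℕ j)) (suc n))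

cyclic : ∀ {n} (P : ℕ → ℂ) → P (suc n) ≋ P 0 → ∀ (j : Fin (suc n)) → P (suc (toℕ j)) ≋ P (toℕ (next j))
cyclic {n} P closed j with suc (toℕ j) ℕP.≟ suc n
... | yes eq = subst (λ m → P (suc (toℕ j)) ≋ P m)
  (sym (trans (toℕ-next j) (trans (cong (ℕD._% suc n) eq) (ℕD.n%n≡0 (suc n)))))
  (subst (λ m → P m ≋ P 0) (sym eq) closed)
... | no ≢ = subst (λ m → P (suc (toℕ j)) ≋ P m)
  (sym (trans (toℕ-next j) (ℕD.m<n⇒m%n≡m (ℕP.≤∧≢⇒< (FinP.toℕ<n j) ≢)))) ≋-refl

-- Numbers of modulus one

record Unit (u : ℂ) : Set where
  constructor mkUnit
  field
    modulus : dot u u ∼ 1ᴿ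

open Unit

Unit-resp-≋ : ∀ {u v} → u ≋ v → Unit u → Unit v
Unit-resp-≋ p (mkUnit h) = mkUnit (∼-trans
  (+ᴿ-cong (*ᴿ-cong (∼-sym (re∼ p)) (∼-sym (re∼ p))) (*ᴿ-cong (∼-sym (im∼ p)) (∼-sym (im∼ p)))) h)

Unit⇒*conj≋1 : ∀ {u} → Unit u → u * conj u ≋ 1ᶜ
Unit⇒*conj≋1 {u} (mkUnit h) = mk≋
  (∼-trans (pointwise (λ k → solve 2 (λ a b → a :* a :- b :* (:- b) := a :* a :+ b :* b) refl (seq (re u) k) (seq (im u) k))) h)
  (pointwise (λ k → solve 2 (λ a b → a :* (:- b) :+ b :* a := con 0ℚ) refl (seq (re u) k) (seq (im u) k)))
  where open +-*-Solver

Unit⇒≉0 : ∀ {u} → Unit u → ¬ u ≋ 0ᶜ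
Unit⇒≉0 U u≋0 = 1≁0 (∼-trans (∼-sym (modulus (Unit-resp-≋ u≋0 U))) (pointwise (λ _ → refl)))

-- δ u = 2 i im u
δ : ℂ → ℂ
δ u = u - conj u

-- Replacing 1 by u · conj u lets u factor out and leaves a purely imaginary number; this is where
-- half angles enter.
Unit⇒square-1 : ∀ {u} → Unit u → u * u - 1ᶜ ≋ u * δ u
Unit⇒square-1 {u} U = ≋-trans (+-congˡ (u * u) (-‿cong (≋-sym (Unit⇒*conj≋1 U))))
  (≐⇒≋ (solve 2 (λ u ū → u :* u :- u :* ū := u :* (u :- ū)) ≐-refl u (conj u)))
  where open ℂ-Solver

-- Multiplication by the purely imaginary `δ u` swaps the parts of z and scales them by ±2 im u, so
-- `*-cancel` treats each part separately.
δ-cancel : ∀ {u z} → ¬ im u ∼ 0ᴿ → δ u * z ≋ 0ᶜ → z ≋ 0ᶜ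
δ-cancel {u} {z} s≁0 p = mk≋
  (*-cancel (im u) (by (fromℚ ½ ⊙ difference (im∼ p))
    (λ k → solve 4 (λ c s a b → s :* a :- con 0ℚ :=
        con ½ :* (((c :- c) :* b :+ (s :- (:- s)) :* a) :- con 0ℚ)) refl
      (seq (re u) k) (seq (im u) k) (seq (re z) k) (seq (im z) k))) s≁0)
  (*-cancel (im u) (by (fromℚ (ℚ.- ½) ⊙ difference (re∼ p))
    (λ k → solve 4 (λ c s a b → s :* b :- con 0ℚ :=
        con (ℚ.- ½) :* (((c :- c) :* a :- (s :- (:- s)) :* b) :- con 0ℚ)) refl
      (seq (re u) k) (seq (im u) k) (seq (re z) k) (seq (im z) k))) s≁0)
  where open +-*-Solver

module Polygons (π : ℝ) (isPi : IsPi π) where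

  open Cis π isPi
  open Constructing π

  ∥-*ˡ : ∀ u {a b} → a ∥ b → u * a ∥ u * b
  ∥-*ˡ u {a} {b} (mk-∥ h) = mk-∥ (by (dot u u ⊙ difference h)
    (λ k → solve 6 (λ x y a a′ b b′ →
        ((x :* a :- y :* a′) :* (x :* b′ :+ y :* b) :- (x :* a′ :+ y :* a) :* (x :* b :- y :* b′)) :- con 0ℚ :=
        (x :* x :+ y :* y) :* ((a :* b′ :- a′ :* b) :- con 0ℚ)) refl
      (seq (re u) k) (seq (im u) k) (seq (re a) k) (seq (im a) k) (seq (re b) k) (seq (im b) k)))
    where open +-*-Solver

  -- As `δ a` and `δ b` are purely imaginary, z is a real multiple of v. The quotient im b / im a is
  -- avoided by cancelling im a from a multiple of the cross product.
  δ-∥ : ∀ {a b z v} → ¬ im a ∼ 0ᴿ → δ a * z ≋ δ b * v → z ∥ v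
  δ-∥ {a} {b} {z} {v} s≁0 p = mk-∥ (*-cancel (im a)
    (by ((fromℚ ½ *ᴿ im v) ⊙ difference (im∼ p) ⊕ (fromℚ ½ *ᴿ re v) ⊙ difference (re∼ p))
      (λ k → solve 8 (λ c s d t x y v w →
          s :* (x :* w :- y :* v) :- con 0ℚ :=
          (con ½ :* w) :* (((c :- c) :* y :+ (s :- (:- s)) :* x) :- ((d :- d) :* w :+ (t :- (:- t)) :* v)) :+
          (con ½ :* v) :* (((c :- c) :* x :- (s :- (:- s)) :* y) :- ((d :- d) :* v :- (t :- (:- t)) :* w))) refl
        (seq (re a) k) (seq (im a) k) (seq (re b) k) (seq (im b) k)
        (seq (re z) k) (seq (im z) k) (seq (re v) k) (seq (im v) k))) s≁0)
    where open +-*-Solver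

  -- cross a (z a) = |a|² im z.
  rotated-∦ : ∀ {z a} → ¬ im z ∼ 0ᴿ → Unit a → ¬ a ∥ z * a
  rotated-∦ {z} {a} s≁0 (mkUnit h) (mk-∥ p) = s≁0 (by ((-ᴿ im z) ⊙ difference h ⊕ difference p)
    (λ k → solve 4 (λ x y a b → y :- con 0ℚ :=
        (:- y) :* ((a :* a :+ b :* b) :- con 1ℚ) :+
        ((a :* (x :* b :+ y :* a) :- b :* (x :* a :- y :* b)) :- con 0ℚ)) refl
      (seq (re z) k) (seq (im z) k) (seq (re a) k) (seq (im a) k)))
    where open +-*-Solver

  Unit-cis-^ : ∀ q n → Unit (cis q ^ n)
  Unit-cis-^ q n = Unit-resp-≋ (≋-sym (cis-^ q n)) (mkUnit (cis-unit (fromℕ n ℚ.* q)))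

  cis-1/suc-≁0 : ∀ n → ¬ im (cis (1/suc (suc n))) ∼ 0ᴿ
  cis-1/suc-≁0 n = sin≁0 (0<1/suc (suc n))
    (subst (ℚ._< 1ℚ) (ℚP.*-identityˡ (1/suc (suc n))) (*1/suc<1 1 (suc n) (ℕ.s≤s ℕ.z≤n)))

  -- Directions at dyadic fractions of π

  AllRuled : ℂ → Set
  AllRuled w = ∀ m → Ruled (w ^ m)

  -- `cis-½` makes `cis ½` purely imaginary, so its powers alternate between the two axes.
  AllRuled-½ : AllRuled (cis ½)
  AllRuled-½ m with axis m
    where
    open +-*-Solver
    c = cis ½
    axis : ∀ m → im (c ^ m) ∼ 0ᴿ ⊎ re (c ^ m) ∼ 0ᴿ
    axis zero = inj₁ ∼-refl
    axis (suc m) with axis m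
    ... | inj₁ h = inj₂ (by ((re (c ^ m)) ⊙ difference cis-½ ⊕ (-ᴿ im c) ⊙ difference h)
      (λ k → solve 4 (λ a b x y → (a :* x :- b :* y) :- con 0ℚ := x :* (a :- con 0ℚ) :+ (:- b) :* (y :- con 0ℚ)) refl
        (seq (re c) k) (seq (im c) k) (seq (re (c ^ m)) k) (seq (im (c ^ m)) k)))
    ... | inj₂ h = inj₁ (by ((im (c ^ m)) ⊙ difference cis-½ ⊕ (im c) ⊙ difference h)
      (λ k → solve 4 (λ a b x y → (a :* y :+ b :* x) :- con 0ℚ := y :* (a :- con 0ℚ) :+ b :* (x :- con 0ℚ)) refl
        (seq (re c) k) (seq (im c) k) (seq (re (c ^ m)) k) (seq (im (c ^ m)) k)))
  ... | inj₁ h = Ruled-resp-∥ Ruled-1 (Unit⇒≉0 (Unit-cis-^ ½ m))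
    (mk-∥ (by ((-ᴿ 1ᴿ) ⊙ difference h) (λ k → solve 2 (λ x y →
        (x :* con 0ℚ :- y :* con 1ℚ) :- con 0ℚ := con (ℚ.- 1ℚ) :* (y :- con 0ℚ)) refl
      (seq (re (cis ½ ^ m)) k) (seq (im (cis ½ ^ m)) k))))
    where open +-*-Solver
  ... | inj₂ h = Ruled-resp-∥ Ruled-i (Unit⇒≉0 (Unit-cis-^ ½ m))
    (mk-∥ (by (difference h) (λ k → solve 2 (λ x y →
        (x :* con 1ℚ :- y :* con 0ℚ) :- con 0ℚ := x :- con 0ℚ) refl
      (seq (re (cis ½ ^ m)) k) (seq (im (cis ½ ^ m)) k))))
    where open +-*-Solver

  halve : ∀ m → ∃ λ j → m ≡ j ℕ.+ j ⊎ m ≡ suc (j ℕ.+ j)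
  halve zero = 0 , inj₁ refl
  halve (suc m) with halve m
  ... | j , inj₁ refl = j , inj₂ refl
  ... | j , inj₂ refl = suc j , inj₁ (cong suc (sym (ℕP.+-suc j j)))

  -- An even power of v is a power of w. An odd power v^(2j+1) bisects the angle between w^j and
  -- w^(j+1), which are its products with conj v and with v.
  AllRuled-halved : ∀ {v w} → (∀ n → Unit (v ^ n)) → ¬ im w ∼ 0ᴿ → v * v ≋ w → AllRuled w → AllRuled v
  AllRuled-halved {v} {w} U s≁0 vv≋w R m with halve m
  ... | j , inj₁ refl = Ruled-resp-≋ (≋-sym (^-double vv≋w j)) (R j)
  ... | j , inj₂ refl = bisect {v = v} (Ruled-resp-≋ (≋-sym below) (R j)) (Ruled-resp-≋ (≋-sym above) (R (suc j)))
      (λ p → rotated-∦ s≁0 (Unit-resp-≋ even (U (j ℕ.+ j))) (∥-respˡ below (∥-respʳ above p)))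
      (Unit⇒≉0 (U (suc (j ℕ.+ j))))
    where
    open ℂ-Solver
    even : v ^ (j ℕ.+ j) ≋ w ^ j
    even = ^-double vv≋w j
    Uv : Unit v
    Uv = Unit-resp-≋ (≐⇒≋ (solve 1 (λ v → v :* con 1ℚ := v) ≐-refl v)) (U 1)
    below : v ^ suc (j ℕ.+ j) * conj v ≋ w ^ j
    below = ≋-trans (≐⇒≋ (solve 3 (λ v x v̄ → (v :* x) :* v̄ := (v :* v̄) :* x) ≐-refl v (v ^ (j ℕ.+ j)) (conj v)))
      (≋-trans (*-cong (Unit⇒*conj≋1 Uv) even) (≐⇒≋ (solve 1 (λ x → con 1ℚ :* x := x) ≐-refl (w ^ j))))
    above : v ^ suc (j ℕ.+ j) * v ≋ w ^ suc j
    above = ≋-trans (≐⇒≋ (solve 2 (λ v x → (v :* x) :* v := (v :* v) :* x) ≐-refl v (v ^ (j ℕ.+ j))))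
      (*-cong vv≋w even)

  -- dyadic k = 2ᵏ - 1
  dyadic : ℕ → ℕ
  dyadic zero    = 0
  dyadic (suc k) = suc (dyadic k ℕ.+ dyadic k)

  AllRuled-dyadic : ∀ k → AllRuled (cis (1/suc (dyadic (suc k))))
  AllRuled-dyadic zero    = AllRuled-½
  AllRuled-dyadic (suc k) = AllRuled-halved (Unit-cis-^ (1/suc (suc (d ℕ.+ d)))) (cis-1/suc-≁0 (dyadic k ℕ.+ dyadic k))
    (subst (λ q → cis (1/suc (suc (d ℕ.+ d))) * cis (1/suc (suc (d ℕ.+ d))) ≋ cis q) (1/suc-halves d)
      (cis-+ (1/suc (suc (d ℕ.+ d))) (1/suc (suc (d ℕ.+ d)))))
    (AllRuled-dyadic k)
    where
    d = dyadic (suc k)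

  k≤dyadic : ∀ k → k ℕ.≤ dyadic k
  k≤dyadic zero    = ℕ.z≤n
  k≤dyadic (suc k) = ℕ.s≤s (ℕP.≤-trans (k≤dyadic k) (ℕP.m≤m+n (dyadic k) (dyadic k)))

  cis-2/suc : ∀ n → cis (+ 2 ℚ./ suc n) ≋ cis (1/suc n) * cis (1/suc n)
  cis-2/suc n = ≋-sym (subst (λ q → cis (1/suc n) * cis (1/suc n) ≋ cis q) (sym (2/suc n)) (cis-+ (1/suc n) (1/suc n)))

  -- Sums of powers of a root of unity

  geometric : ∀ z n → (z - 1ᶜ) * Cℂ.Σ (z ^_) n ≐ z ^ n - 1ᶜ
  geometric z zero    = solve 1 (λ z → (z :- con 1ℚ) :* con 0ℚ := con 1ℚ :- con 1ℚ) ≐-refl z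
    where open ℂ-Solver
  geometric z (suc n) = ≐-trans
    (solve 3 (λ z s y → (z :- con 1ℚ) :* (s :+ y) := (z :- con 1ℚ) :* s :+ (z :- con 1ℚ) :* y) ≐-refl z (Cℂ.Σ (z ^_) n) (z ^ n))
    (≐-trans (Pointwise.+-cong (geometric z n) (≐-refl {(z - 1ᶜ) * z ^ n}))
      (solve 2 (λ z y → (y :- con 1ℚ) :+ (z :- con 1ℚ) :* y := z :* y :- con 1ℚ) ≐-refl z (z ^ n)))
    where open ℂ-Solver

  geometric² : ∀ z n → (z - 1ᶜ) * Cℂ.Σ (Cℂ.Σ (z ^_)) n ≐ Cℂ.Σ (z ^_) n - Cℂ.ι n
  geometric² z zero    = solve 1 (λ z → (z :- con 1ℚ) :* con 0ℚ := con 0ℚ :- con 0ℚ) ≐-refl z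
    where open ℂ-Solver
  geometric² z (suc n) = ≐-trans
    (solve 3 (λ z s y → (z :- con 1ℚ) :* (s :+ y) := (z :- con 1ℚ) :* s :+ (z :- con 1ℚ) :* y) ≐-refl
      z (Cℂ.Σ (Cℂ.Σ (z ^_)) n) (Cℂ.Σ (z ^_) n))
    (≐-trans (Pointwise.+-cong (geometric² z n) (geometric z n))
      (solve 3 (λ s ι y → (s :- ι) :+ (y :- con 1ℚ) := (s :+ y) :- (con 1ℚ :+ ι)) ≐-refl
        (Cℂ.Σ (z ^_) n) (Cℂ.ι n) (z ^ n)))
    where open ℂ-Solver

  -- Here s stands for the sum of the powers of z, t for the sum of its partial sums, ι for the
  -- number of summands and r for 1/ι.
  inverse : ∀ {r s t ι z} → (z - 1ᶜ) * t ≋ s - ι → s ≋ 0ᶜ → r * ι ≋ 1ᶜ → (- (r * t)) * (z - 1ᶜ) ≋ 1ᶜ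
  inverse {r} {s} {t} {ι} {z} p q h = begin
    (- (r * t)) * (z - 1ᶜ)    ≈⟨ ≐⇒≋ (solve 3 (λ r t z → (:- (r :* t)) :* z := :- (r :* (z :* t))) ≐-refl r t (z - 1ᶜ)) ⟩
    - (r * ((z - 1ᶜ) * t))    ≈⟨ -‿cong (*-congˡ r (≋-trans p (+-congʳ (- ι) q))) ⟩
    - (r * (0ᶜ - ι))          ≈⟨ ≐⇒≋ (solve 2 (λ r ι → :- (r :* (con 0ℚ :- ι)) := r :* ι) ≐-refl r ι) ⟩
    r * ι                     ≈⟨ h ⟩
    1ᶜ                        ∎
    where
    open ℂ-Solver
    open import Relation.Binary.Reasoning.Setoid ≋-setoid

  -- The regular (n + 2)-gon with P 0 = -1 and P 1 = 0, whence P 2 = ζ.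
  module Polygon (n : ℕ) where

    open ℂ-Solver
    open import Relation.Binary.Reasoning.Setoid ≋-setoid

    size : ℕ
    size = suc (suc n)

    -- z turns by the central angle of the polygon, w by half of it.
    w z : ℂ
    w = cis (1/suc (suc n))
    z = cis (+ 2 ℚ./ size)

    Unit-w^ : ∀ j → Unit (w ^ j)
    Unit-w^ = Unit-cis-^ (1/suc (suc n))

    Unit-w : Unit w
    Unit-w = mkUnit (cis-unit (1/suc (suc n)))

    z≋w² : z ≋ w * w
    z≋w² = cis-2/suc (suc n)

    z^≋ : ∀ j → z ^ j ≋ w ^ j * w ^ j
    z^≋ j = ≋-trans (^-cong z≋w² j) (≐⇒≋ (square-^ w j))

    Unit-z^ : ∀ j → Unit (z ^ j)
    Unit-z^ = Unit-cis-^ (+ 2 ℚ./ suc (suc n))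

    z^size≋1 : z ^ size ≋ 1ᶜ
    z^size≋1 = begin
      z ^ size               ≈⟨ z^≋ size ⟩
      w ^ size * w ^ size    ≈⟨ *-cong w^size≋-1 w^size≋-1 ⟩
      - 1ᶜ * - 1ᶜ            ≈⟨ ≐⇒≋ (solve 0 ((:- con 1ℚ) :* (:- con 1ℚ) := con 1ℚ) ≐-refl) ⟩
      1ᶜ                     ∎
      where
      w^size≋-1 : w ^ size ≋ - 1ᶜ
      w^size≋-1 = ≋-trans (cis-^ (1/suc (suc n)) size)
        (subst (λ q → cis q ≋ - 1ᶜ) (sym (suc*1/suc (suc n))) cis-1)

    z-1≋wδ : z - 1ᶜ ≋ w * δ w
    z-1≋wδ = ≋-trans (+-congʳ (- 1ᶜ) z≋w²) (Unit⇒square-1 Unit-w)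

    δ≋ : δ w ≋ conj w * (z - 1ᶜ)
    δ≋ = begin
      δ w                      ≈⟨ ≐⇒≋ (solve 1 (λ d → d := con 1ℚ :* d) ≐-refl (δ w)) ⟩
      1ᶜ * δ w                 ≈⟨ *-congʳ (δ w) (Unit⇒*conj≋1 Unit-w) ⟨
      (w * conj w) * δ w       ≈⟨ ≐⇒≋ (solve 3 (λ w w̄ d → (w :* w̄) :* d := w̄ :* (w :* d)) ≐-refl w (conj w) (δ w)) ⟩
      conj w * (w * δ w)       ≈⟨ *-congˡ (conj w) z-1≋wδ ⟨
      conj w * (z - 1ᶜ)        ∎

    -- Multiplying by conj w turns z - 1 into the purely imaginary `δ w`, whose size is governed by
    -- the nonzero sin (π/size).
    z-1-cancel : ∀ x → (z - 1ᶜ) * x ≋ 0ᶜ → x ≋ 0ᶜ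
    z-1-cancel x p = δ-cancel (cis-1/suc-≁0 n) (begin
      δ w * x                        ≈⟨ *-congʳ x δ≋ ⟩
      (conj w * (z - 1ᶜ)) * x        ≈⟨ ≐⇒≋ (solve 3 (λ w̄ z x → (w̄ :* z) :* x := w̄ :* (z :* x)) ≐-refl (conj w) (z - 1ᶜ) x) ⟩
      conj w * ((z - 1ᶜ) * x)        ≈⟨ *-congˡ (conj w) p ⟩
      conj w * 0ᶜ                    ≈⟨ ≐⇒≋ (solve 1 (λ w̄ → w̄ :* con 0ℚ := con 0ℚ) ≐-refl (conj w)) ⟩
      0ᶜ                             ∎)

    Σz^≋0 : Cℂ.Σ (z ^_) size ≋ 0ᶜ
    Σz^≋0 = z-1-cancel (Cℂ.Σ (z ^_) size) (≋-trans (≐⇒≋ (geometric z size))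
      (≋-trans (+-congʳ (- 1ᶜ) z^size≋1) (≐⇒≋ (solve 0 (con 1ℚ :- con 1ℚ := con 0ℚ) ≐-refl))))

    opaque
      -- (z - 1) Σₖ Σ_{j<k} zʲ = Σₖ (zᵏ - 1) = - size
      ρ : ℂ
      ρ = - (scalar (1/suc (suc n)) * Cℂ.Σ (Cℂ.Σ (z ^_)) size)

      ρ[z-1]≋1 : ρ * (z - 1ᶜ) ≋ 1ᶜ
      ρ[z-1]≋1 = inverse (≐⇒≋ (geometric² z size)) Σz^≋0 (≐⇒≋ (proj₂ (ℂ-inverse (suc n))))

    -- The centre places vertex 0 at -1, and the radius ρ = 1/(z - 1) turns the side vectors into
    -- the powers of z.
    P : ℕ → ℂ
    P j = (- 1ᶜ - ρ) + ρ * z ^ j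

    P-0 : P 0 ≋ - 1ᶜ
    P-0 = ≐⇒≋ (solve 1 (λ r → ((:- con 1ℚ) :- r) :+ r :* con 1ℚ := :- con 1ℚ) ≐-refl ρ)

    P-suc : ∀ j → P (suc j) - P j ≋ z ^ j
    P-suc j = begin
      P (suc j) - P j
        ≈⟨ ≐⇒≋ (solve 3 (λ r z y → (((:- con 1ℚ) :- r) :+ r :* (z :* y)) :- (((:- con 1ℚ) :- r) :+ r :* y)
                                   := (r :* (z :- con 1ℚ)) :* y) ≐-refl ρ z (z ^ j)) ⟩
      (ρ * (z - 1ᶜ)) * z ^ j    ≈⟨ *-congʳ (z ^ j) ρ[z-1]≋1 ⟩
      1ᶜ * z ^ j                ≈⟨ ≐⇒≋ (solve 1 (λ y → con 1ℚ :* y := y) ≐-refl (z ^ j)) ⟩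
      z ^ j                     ∎

    step : ∀ j → P (suc j) ≋ P j + z ^ j
    step j = ≋-trans (≐⇒≋ (solve 2 (λ a b → a := b :+ (a :- b)) ≐-refl (P (suc j)) (P j))) (+-congˡ (P j) (P-suc j))

    P-1 : P 1 ≋ 0ᶜ
    P-1 = ≋-trans (step 0) (≋-trans (+-congʳ 1ᶜ P-0) (≐⇒≋ (solve 0 ((:- con 1ℚ) :+ con 1ℚ := con 0ℚ) ≐-refl)))

    P-2 : P 2 ≋ z
    P-2 = ≋-trans (step 1) (≋-trans (+-congʳ (z ^ 1) P-1) (≐⇒≋ (solve 1 (λ z → con 0ℚ :+ z :* con 1ℚ := z) ≐-refl z)))

    P-size : P size ≋ P 0
    P-size = +-congˡ (- 1ᶜ - ρ) (*-congˡ ρ z^size≋1)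

    ρ≉0 : ¬ ρ ≋ 0ᶜ
    ρ≉0 p = 1≁0 (re∼ (≋-trans (≋-sym ρ[z-1]≋1) (≋-trans (*-congʳ (z - 1ᶜ) p)
      (≐⇒≋ (solve 1 (λ x → con 0ℚ :* x := con 0ℚ) ≐-refl (z - 1ᶜ))))))

    regular : ∀ (A : Fin size → ℂ) → (∀ j → A j ≋ P (toℕ j)) → RegularPolygon π size A
    regular A h = record
      { centre = - 1ᶜ - ρ ; radius = ρ ; nonzero = λ p → ρ≉0 (≈⇒≋ p) ; vertices = λ j →
        ≋⇒≈ (subst (λ ζ → A j ≋ (- 1ᶜ - ρ) + ρ * ζ ^ toℕ j) (cis≡ζ size) (h j)) }

    -- The inscribed angle theorem: consecutive chords through a vertex differ by half the central angle.
    chord : ∀ j → P (suc j) - (- 1ᶜ) ∥ w ^ j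
    chord j = δ-∥ {b = u} (cis-1/suc-≁0 n) (begin
      δ w * (P (suc j) - (- 1ᶜ))
        ≈⟨ ≐⇒≋ (solve 3 (λ d r y → d :* ((((:- con 1ℚ) :- r) :+ r :* y) :- (:- con 1ℚ)) := d :* (r :* (y :- con 1ℚ))) ≐-refl
             (δ w) ρ (z ^ suc j)) ⟩
      δ w * (ρ * (z ^ suc j - 1ᶜ))
        -- Both z - 1 and z^(j+1) - 1 are now factored: ρ absorbs the first, conj w lowers the power
        -- w^(j+1) to w^j, and only the imaginary factor `δ u` remains.
        ≈⟨ *-cong δ≋ (*-congˡ ρ (≋-trans (+-congʳ (- 1ᶜ) (z^≋ (suc j))) (Unit⇒square-1 (Unit-w^ (suc j))))) ⟩
      (conj w * (z - 1ᶜ)) * (ρ * (u * δ u))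
        ≈⟨ rearrange (conj w) (z - 1ᶜ) ρ w (w ^ j) (δ u) ⟩
      ((w * conj w) * (ρ * (z - 1ᶜ))) * (δ u * w ^ j)
        ≈⟨ *-congʳ (δ u * w ^ j) (*-cong (Unit⇒*conj≋1 Unit-w) ρ[z-1]≋1) ⟩
      (1ᶜ * 1ᶜ) * (δ u * w ^ j)
        ≈⟨ ≐⇒≋ (solve 1 (λ x → (con 1ℚ :* con 1ℚ) :* x := x) ≐-refl (δ u * w ^ j)) ⟩
      δ u * w ^ j ∎)
      where
      u = w ^ suc j
      rearrange : ∀ w̄ z r w y d → (w̄ * z) * (r * ((w * y) * d)) ≋ ((w * w̄) * (r * z)) * (d * y)
      rearrange w̄ z r w y d = ≐⇒≋ (solve 6 (λ w̄ z r w y d →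
        (w̄ :* z) :* (r :* ((w :* y) :* d)) := ((w :* w̄) :* (r :* z)) :* (d :* y)) ≐-refl w̄ z r w y d)

    -- Multiplication by z = w² carries the chord from `P 0` to `P (suc j)` to the chord from `P 1`
    -- to the next vertex, which raises the exponent in `chord` by 2.
    chord-0 : ∀ j → P (suc (suc j)) - 0ᶜ ∥ w ^ suc (suc j)
    chord-0 j = ∥-respˡ (begin
      w * (w * (P (suc j) - (- 1ᶜ)))
        ≈⟨ ≐⇒≋ (solve 2 (λ w q → w :* (w :* q) := (w :* w) :* q) ≐-refl w (P (suc j) - (- 1ᶜ))) ⟩
      (w * w) * (P (suc j) - (- 1ᶜ))  ≈⟨ *-congʳ (P (suc j) - (- 1ᶜ)) z≋w² ⟨
      z * (P (suc j) - (- 1ᶜ))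
        ≈⟨ ≐⇒≋ (solve 3 (λ z r y → z :* ((((:- con 1ℚ) :- r) :+ r :* y) :- (:- con 1ℚ)) :=
               (((:- con 1ℚ) :- r) :+ r :* (z :* y)) :- (((:- con 1ℚ) :- r) :+ r :* (z :* con 1ℚ))) ≐-refl
             z ρ (z ^ suc j)) ⟩
      P (suc (suc j)) - P 1           ≈⟨ +-congˡ (P (suc (suc j))) (-‿cong P-1) ⟩
      P (suc (suc j)) - 0ᶜ            ∎)
      (∥-*ˡ w (∥-*ˡ w (chord j)))

    Vertices : Set
    Vertices = ∀ j → j ℕ.< size → Point (P j)

    AllRuled⇒Vertices : AllRuled w → Vertices
    AllRuled⇒Vertices R zero          _ = Point-resp-≋ (≋-sym P-0) Point-−1
    AllRuled⇒Vertices R (suc zero)    _ = Point-resp-≋ (≋-sym P-1) Point-0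
    AllRuled⇒Vertices R (suc (suc j)) _ = intersect
      (ray-foldable Point-−1 (R (suc j)) (Unit⇒≉0 (Unit-w^ (suc j))))
      (ray-foldable Point-0 (R (suc (suc j))) (Unit⇒≉0 (Unit-w^ (suc (suc j)))))
      -- The directions of the two chords differ by the factor w.
      (rotated-∦ (cis-1/suc-≁0 n) (Unit-w^ (suc j)))
      (mk-on (collinearity (chord (suc j)))) (mk-on (collinearity (chord-0 j)))

    side : ℕ → Line
    side j = ray (P j) (z ^ j) (Unit⇒≉0 (Unit-z^ j))

    P-on-side : ∀ j → P (suc j) on side j
    P-on-side j = mk-on (collinearity (∥-respˡ (≋-sym (P-suc j)) ∥-refl))

  -- Descent to all regular polygons

  open Polygon using (Vertices)

  -- Vertex j + 1 of the smaller polygon is where its sides j and j + 1 meet; vertex 0 is -1.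
  descend : ∀ n → Vertices (suc (suc n)) → Vertices (suc n)
  descend n V = vertices
    where
    module A = Polygon (suc (suc n))
    module B = Polygon (suc n)
    given-vertices : ∀ (j : Fin A.size) → Point (A.P (toℕ j))
    given-vertices j = V (toℕ j) (FinP.toℕ<n j)
    -- RPA needs points of the list itself, so the representatives serve as vertices;
    -- `RegularPolygon` admits them because it is stated up to equality in ℂ.
    A : Fin A.size → ℂ
    A j = Point.representative (given-vertices j)
    A≋P : ∀ j → A j ≋ A.P (toℕ j)
    A≋P j = ≋-sym (Point.represents (given-vertices j))
    first : B.P 0 ≋ A zero
    first = ≋-trans B.P-0 (≋-sym (≋-trans (A≋P zero) A.P-0))
    second : B.P 1 ≋ A (suc zero)
    second = ≋-trans B.P-1 (≋-sym (≋-trans (A≋P (suc zero)) A.P-1))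
    B : Fin B.size → ℂ
    B j = B.P (toℕ j)
    end-on : ∀ j → B (next j) on B.side (toℕ j)
    end-on j = on-resp-≋ (cyclic B.P B.P-size j) (B.P-on-side (toℕ j))
    sides : ∀ (j : Fin B.size) → Foldable (B.side (toℕ j))
    sides j = fold (simultaneously A.size (point ∘ A) (λ j → Point.constructible (given-vertices j)))
      where
      fold : (∃ λ Γ → Construction π Γ × (∀ j → point (A j) ∈ˡ Γ)) → Foldable (B.side (toℕ j))
      fold (Γ , c , A∈Γ) = _ , (c then RPA n {A = A} {B = B} {f = B.side (toℕ j)}
        (A.regular A A≋P) A∈Γ (B.regular B (λ _ → ≋-refl))
        (≋⇒≈ {B zero} {A zero} first) (≋⇒≈ {B (suc zero)} {A (suc zero)} second)
        j (on⇒On {B j} {B.side (toℕ j)} (base-on (B.side (toℕ j)))) (on⇒On {B (next j)} {B.side (toℕ j)} (end-on j))) , here refl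
    side : ∀ {j} → j ℕ.< B.size → Foldable (B.side j)
    side {j} j<size = subst (λ m → Foldable (B.side m)) (FinP.toℕ-fromℕ< j<size) (sides (fromℕ< j<size))
    -- Consecutive sides enclose the angle 2π/(n + 3), and 0 < 2/(n + 3) < 1.
    im-z≁0 : ¬ im B.z ∼ 0ᴿ
    im-z≁0 = sin≁0 (subst (0ℚ ℚ.<_) (sym (2/suc (suc (suc n)))) (ℚP.+-mono-< (0<1/suc (suc (suc n))) (0<1/suc (suc (suc n)))))
      (subst (ℚ._< 1ℚ) (trans (solve 1 (λ q → con 2ℚ :* q := q :+ q) refl (1/suc (suc (suc n)))) (sym (2/suc (suc (suc n)))))
        (*1/suc<1 2 (suc (suc n)) (ℕ.s≤s (ℕ.s≤s ℕ.z≤n))))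
      where open +-*-Solver
    vertices : B.Vertices
    vertices zero    _    = Point-resp-≋ (≋-sym B.P-0) Point-−1
    vertices (suc j) j<size = intersect (side (ℕP.<⇒≤ j<size)) (side j<size)
      (rotated-∦ im-z≁0 (B.Unit-z^ j)) (B.P-on-side j) (base-on (B.side (suc j)))

  descend-by : ∀ t n → Vertices (suc (t ℕ.+ n)) → Vertices (suc n)
  descend-by zero    n V = V
  descend-by (suc t) n V = descend-by t n (descend (t ℕ.+ n) V)

  all-vertices : ∀ n → Vertices (suc n)
  all-vertices n = descend-by (m ℕ.∸ suc n) n
      (subst Vertices m≡ (Polygon.AllRuled⇒Vertices m (AllRuled-dyadic (suc n))))
    where
    m : ℕ
    -- The starting polygon has m + 2 = 2^(n+2) vertices, and `k≤dyadic` shows that this is at least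
    -- n + 3.
    m = dyadic (suc n) ℕ.+ dyadic (suc n)
    m≡ : m ≡ suc (m ℕ.∸ suc n ℕ.+ n)
    m≡ = trans (sym (ℕP.m∸n+n≡m (ℕP.≤-trans (k≤dyadic (suc n)) (ℕP.m≤m+n (dyadic (suc n)) (dyadic (suc n))))))
      (ℕP.+-suc (m ℕ.∸ suc n) n)

  cis∈𝒪 : ∀ n .{{_ : NonZero n}} → Point (cis (+ 2 ℚ./ n))
  -- For n = 1 and n = 2, where there is no polygon, ζ is 1 or -1.
  cis∈𝒪 (suc zero) = Point-resp-≋ (≋-sym (≋-trans (cis-2/suc 0) (≋-trans (*-cong cis-1 cis-1)
      (≐⇒≋ (solve 0 ((:- con 1ℚ) :* (:- con 1ℚ) := con 1ℚ) ≐-refl))))) Point-1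
    where open ℂ-Solver
  cis∈𝒪 (suc (suc zero)) = Point-resp-≋ (≋-sym cis-1) Point-−1
  cis∈𝒪 (suc (suc (suc n))) = Point-resp-≋ (Polygon.P-2 (suc n))
    (all-vertices n 2 (ℕ.s≤s (ℕ.s≤s (ℕ.s≤s ℕ.z≤n))))

lemma4p4 : ∀ (π : ℝ) → IsPi π → ∀ (n : ℕ) .{{_ : NonZero n}} → ζ π n ∈ 𝒪-RP π
lemma4p4 π isPi n = subst (_∈ 𝒪-RP π) (Cis.cis≡ζ π isPi n) (Point⇒∈ (cis∈𝒪 n))
  where
  open Constructing π using (Point⇒∈)
  open Polygons π isPi using (cis∈𝒪)
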